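{- Let $\lambda,\mu,\lambda',\mu'$ be partitions with $\mu\subseteq\lambda$, $\mu'\subseteq\lambda'$, and for integers $n\ge0$ let $Q(n)=\sum_\nu c(n\lambda+\lambda';n\mu+\mu',\nu)$. Suppose the skew diagram $\lambda/\mu$ is a partition or a rotated partition. Then there exists an $m$ with $Q(n)=Q(m)$ for all $n\geq m$. Furthermore, suppose $\lambda=(\alpha_1^{a_1},\alpha_2,\alpha_3,\ldots,\alpha_k)$ (i.e. $\alpha_1$ repeated $a_1\ge1$ times followed by $\alpha_2\ge\alpha_3\ge\dots\ge\alpha_k$) with $\alpha_k\neq 0$, $\mu=(\alpha_1^{a_1-1})$, and $\lambda'/\mu'$ is a basic skew diagram. Then the smallest $m$ such that $Q(n)=Q(m)$ for all $n\ge m$ is \[ m=\biggl\lceil \max_{\substack{1\leq j \leq k\\ \alpha_j>\alpha_{j+1}}} \Bigl( \frac{\lambda'_1- \lambda'_{a_j}+ \lambda'_{a_j+1}+\mu'_{a_1}-\mu'_{a_1-1}}{\alpha_j-\alpha_{j+1}} \Bigr) \biggr\rceil,\] where $a_j=a_1-1+j$, $\alpha_{k+1}=0$, and for $a_1=1$ one sets $\mu'_0=\lambda'_1$; and for this $m$, \[ Q(m)>Q(m-1)>\cdots>Q(0). \] Moreover, in the general case (i.e. only assuming that $\lambda/\mu$ is a partition or a rotated partition), if $m$ is chosen as the smallest integer with $Q(n)=Q(m)$ for all $n\ge m$, then again $Q(m)>Q(m-1)>\cdots>Q(0)$.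
   Context: $c(\alpha;\beta,\gamma)$ denotes the Littlewood–Richardson coefficient (number of semistandard tableaux of shape $\alpha/\beta$ and content $\gamma$ with lattice reverse row word; equivalently the coefficient of $s_\alpha$ in $s_\beta s_\gamma$). For a partition $\alpha$ and integer $n\ge0$, $n\alpha$ has parts $n\alpha_i$; $\alpha+\beta$ has parts $\alpha_i+\beta_i$; parts beyond the length are $0$. The skew diagram $\lambda/\mu$ is the set of boxes of the Young diagram of $\lambda$ not in that of $\mu$. A skew diagram is called a partition (resp. a rotated partition) if, after deleting all empty rows and empty columns and translating, its set of boxes is the Young diagram of a partition (resp. the $180^\circ$ rotation of the Young diagram of a partition). A skew diagram $\lambda'/\mu'$ is basic if $\mu'_i<\lambda'_i$ and $\mu'_i\le\lambda'_{i+1}$ for each $1\le i\le l(\lambda')$ (i.e. it has no empty rows or columns). $\lceil x\rceil$ is the smallest integer $\ge x$.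
   Formalization: The smallest m is stated as max(0, ⌈…⌉), since the printed ceiling can be negative (e.g. α=(1), a_1=1, λ'=(3,1), μ'=(1) gives −1 while Q is constant on n≥0, so the smallest m is 0). -}

module Defs where

open import Data.Bool using (Bool; true; false; T; _∧_; if_then_else_)
open import Data.Nat as ℕ using (ℕ; zero; suc; _+_; _*_; _∸_; _≤_; _<_; _≤ᵇ_; _<ᵇ_; _≡ᵇ_)
open import Data.Integer as ℤ using (ℤ) renaming (+_ to pos)
open import Data.Rational as ℚ using (ℚ; 0ℚ)
open import Data.List using (List; []; _∷_; map; concat; concatMap; filter; filterᵇ; length; upTo; reverse; inits; replicate; drop; foldr; _++_; cartesianProductWith)
open import Data.Nat.ListAction using (sum)
open import Data.Bool.ListAction using (all; any)
open import Data.List.Membership.Propositional using (_∈_)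
open import Data.Product using (_×_; _,_; ∃; Σ)
open import Function.Bundles using (_⇔_)
open import Relation.Binary.PropositionalEquality using (_≡_)
open import Relation.Nullary.Decidable using (⌊_⌋)

-- Partitions: lists of positive integers, weakly decreasing.
-- Parts beyond the length are 0.

isPartition : List ℕ → Bool
isPartition []           = true
isPartition (x ∷ [])     = 0 <ᵇ x
isPartition (x ∷ y ∷ r)  = (y ≤ᵇ x) ∧ isPartition (y ∷ r)

IsPartition : List ℕ → Set
IsPartition p = T (isPartition p)

-- 1-indexed lookup with default d (index 0 and indices beyond length give d)
get : {A : Set} → A → List A → ℕ → A
get d []       _             = d
get d (x ∷ xs) zero          = d
get d (x ∷ xs) (suc zero)    = x
get d (x ∷ xs) (suc (suc n)) = get d xs (suc n)

infixl 9 _!_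
_!_ : List ℕ → ℕ → ℕ
α ! i = get 0 α i

_⊆ₚ_ : List ℕ → List ℕ → Set
μ ⊆ₚ la = ∀ i → μ ! i ≤ la ! i

scale : ℕ → List ℕ → List ℕ
scale n α = map (n *_) α

addP : List ℕ → List ℕ → List ℕ
addP []       β        = β
addP (a ∷ α)  []       = a ∷ α
addP (a ∷ α)  (b ∷ β)  = (a + b) ∷ addP α β

fromTo : ℕ → ℕ → List ℕ
fromTo a b = map (a +_) (upTo (suc b ∸ a))

count : ℕ → List ℕ → ℕ
count k w = length (filter (λ x → x ℕ.≟ k) w)

-- Fillings of the skew shape α/β: a list of rows, row i (1 ≤ i ≤ l(α))
-- consisting of the entries in boxes (i, j), β_i < j ≤ α_i, left to right,
-- with entries in {1, ..., N}.

words : ℕ → ℕ → List (List ℕ)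
words N zero    = [] ∷ []
words N (suc l) = cartesianProductWith _∷_ (fromTo 1 N) (words N l)

fillingsRows : ℕ → List ℕ → List (List (List ℕ))
fillingsRows N []         = [] ∷ []
fillingsRows N (r ∷ rs)   = cartesianProductWith _∷_ (words N r) (fillingsRows N rs)

fillings : List ℕ → List ℕ → ℕ → List (List (List ℕ))
fillings α β N = fillingsRows N (map (λ i → α ! i ∸ β ! i) (fromTo 1 (length α)))

entry : List ℕ → List (List ℕ) → ℕ → ℕ → ℕ
entry β Tab i j = get 0 (get [] Tab i) (j ∸ β ! i)

weaklyIncreasing : List ℕ → Bool
weaklyIncreasing []          = true
weaklyIncreasing (x ∷ [])    = true
weaklyIncreasing (x ∷ y ∷ r) = (x ≤ᵇ y) ∧ weaklyIncreasing (y ∷ r)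

isSSYT : List ℕ → List ℕ → List (List ℕ) → Bool
isSSYT α β Tab =
  all weaklyIncreasing Tab ∧
  all (λ i → all (λ j → if (β ! suc i <ᵇ j) ∧ (j ≤ᵇ α ! suc i)
                          then entry β Tab i j <ᵇ entry β Tab (suc i) j
                          else true)
                 (fromTo (suc (β ! i)) (α ! i)))
      (fromTo 1 (length α))

reverseRowWord : List (List ℕ) → List ℕ
reverseRowWord Tab = concatMap reverse Tab

isLattice : ℕ → List ℕ → Bool
isLattice N w = all (λ u → all (λ k → count (suc k) u ≤ᵇ count k u) (fromTo 1 N)) (inits w)

hasContent : ℕ → List ℕ → List ℕ → Bool
hasContent N γ w = all (λ k → count k w ≡ᵇ γ ! k) (fromTo 1 N)

isLRTableau : List ℕ → List ℕ → List ℕ → List (List ℕ) → Bool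
isLRTableau α β γ Tab =
  isSSYT α β Tab ∧ isLattice (length γ) (reverseRowWord Tab) ∧
  hasContent (length γ) γ (reverseRowWord Tab)

-- Littlewood–Richardson coefficient c(α; β, γ) for partitions β ⊆ α, γ:
-- number of semistandard tableaux of shape α/β and content γ whose reverse
-- row word is a lattice word.  (Entries of such a tableau lie in 1..l(γ).)
c : List ℕ → List ℕ → List ℕ → ℕ
c α β γ = length (filterᵇ (λ Tab → isLRTableau α β γ Tab) (fillings α β (length γ)))

-- All partitions of s (listed once each): partitions of s have length ≤ s
-- and parts ≤ s.

listsUpTo : ℕ → ℕ → List (List ℕ)
listsUpTo N L = concatMap (words N) (fromTo 0 L)

partitionsOf : ℕ → List (List ℕ)
partitionsOf s = filterᵇ (λ ν → isPartition ν ∧ (sum ν ≡ᵇ s)) (listsUpTo s s)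

-- Σ_ν c(α; β, ν)  (only ν with |ν| = |α| - |β| can contribute)
sumLR : List ℕ → List ℕ → ℕ
sumLR α β = sum (map (c α β) (partitionsOf (sum α ∸ sum β)))

Q : List ℕ → List ℕ → List ℕ → List ℕ → ℕ → ℕ
Q la mu la' mu' n = sumLR (addP (scale n la) la') (addP (scale n mu) mu')

-- Skew diagrams, compressed (empty rows/columns deleted, translated).

InSkew : List ℕ → List ℕ → ℕ → ℕ → Set
InSkew la mu i j = (1 ≤ i) × (mu ! i < j) × (j ≤ la ! i)

boxes : List ℕ → List ℕ → List (ℕ × ℕ)
boxes la mu = concatMap (λ i → map (λ j → (i , j)) (fromTo (suc (mu ! i)) (la ! i)))
                        (fromTo 1 (length la))

nonemptyRows : List ℕ → List ℕ → List ℕ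
nonemptyRows la mu = filter (λ i → mu ! i ℕ.<? la ! i) (fromTo 1 (length la))

nonemptyCols : List ℕ → List ℕ → List ℕ
nonemptyCols la mu =
  filterᵇ (λ j → any (λ b → Data.Product.proj₂ b ≡ᵇ j) (boxes la mu))
          (fromTo 1 (la ! 1))
  where import Data.Product

-- new index of an old row/column = number of kept rows/columns up to it
rank : List ℕ → ℕ → ℕ
rank kept x = length (filter (λ y → y ℕ.≤? x) kept)

compressed : List ℕ → List ℕ → List (ℕ × ℕ)
compressed la mu =
  map (λ { (i , j) → (rank (nonemptyRows la mu) i , rank (nonemptyCols la mu) j) })
      (boxes la mu)

InYoung : List ℕ → ℕ → ℕ → Set
InYoung ρ p q = (1 ≤ p) × (1 ≤ q) × (q ≤ ρ ! p)

InRotYoung : List ℕ → ℕ → ℕ → Set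
InRotYoung ρ p q = (1 ≤ p) × (p ≤ length ρ) × (1 ≤ q) × (q ≤ ρ ! 1) ×
                   (suc (ρ ! 1) ∸ q ≤ ρ ! (suc (length ρ) ∸ p))

SkewIsPartition : List ℕ → List ℕ → Set
SkewIsPartition la mu = ∃ λ ρ → IsPartition ρ ×
  (∀ p q → ((p , q) ∈ compressed la mu) ⇔ InYoung ρ p q)

SkewIsRotatedPartition : List ℕ → List ℕ → Set
SkewIsRotatedPartition la mu = ∃ λ ρ → IsPartition ρ ×
  (∀ p q → ((p , q) ∈ compressed la mu) ⇔ InRotYoung ρ p q)

Basic : List ℕ → List ℕ → Set
Basic la' mu' = ∀ i → 1 ≤ i → i ≤ length la' →
  (mu' ! i < la' ! i) × (mu' ! i ≤ la' ! suc i)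

StabilizesFrom : (ℕ → ℕ) → ℕ → Set
StabilizesFrom f m = ∀ n → m ≤ n → f n ≡ f m

LeastStabilization : (ℕ → ℕ) → ℕ → Set
LeastStabilization f m = StabilizesFrom f m × (∀ m' → StabilizesFrom f m' → m ≤ m')

StrictlyIncreasingUpTo : (ℕ → ℕ) → ℕ → Set
StrictlyIncreasingUpTo f m = ∀ i → i < m → f i < f (suc i)

lamOf : List ℕ → ℕ → List ℕ
lamOf α a1 = replicate a1 (α ! 1) ++ drop 1 α

muOf : List ℕ → ℕ → List ℕ
muOf α a1 = replicate (a1 ∸ 1) (α ! 1)

-- z / d for d > 0 (the value for d = 0 is never used)
frac : ℤ → ℕ → ℚ
frac z zero    = 0ℚ
frac z (suc d) = z ℚ./ suc d

-- μ'_{a_1 - 1}, with the convention μ'_0 = λ'_1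
muPrev : List ℕ → List ℕ → ℕ → ℕ
muPrev la' mu' a1 = if a1 ≡ᵇ 1 then la' ! 1 else mu' ! (a1 ∸ 1)

term : List ℕ → ℕ → List ℕ → List ℕ → ℕ → ℚ
term α a1 la' mu' j =
  let aj = a1 ∸ 1 + j in
  frac ((pos (la' ! 1)) ℤ.- (pos (la' ! aj)) ℤ.+ (pos (la' ! suc aj))
          ℤ.+ (pos (mu' ! a1)) ℤ.- (pos (muPrev la' mu' a1)))
       (α ! j ∸ α ! suc j)

-- max over 1 ≤ j ≤ k with α_j > α_{j+1} (α_{k+1} = 0); j = k always qualifies
maxTerm : List ℕ → ℕ → List ℕ → List ℕ → ℚ
maxTerm α a1 la' mu' =
  foldr ℚ._⊔_ (term α a1 la' mu' (length α))
        (map (term α a1 la' mu')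
             (filter (λ j → α ! suc j ℕ.<? α ! j) (fromTo 1 (length α))))

formulaℤ : List ℕ → ℕ → List ℕ → List ℕ → ℤ
formulaℤ α a1 la' mu' = ℚ.ceiling (maxTerm α a1 la' mu')

{-# OPTIONS --safe #-}
module Submission where

-- A Littlewood–Richardson tableau is recorded by the array t of its row multiplicities, on which
-- the tableau conditions are linear inequalities. The shape λ/μ is a sum of columns (r , s) (rows
-- s+1, …, r), and adding the array of such a column embeds the tableaux of A/B into those of the
-- shape enlarged by that column. This embedding is onto exactly if
--   A_r − B_{s+1} ≥ #columns of the rows ≤ s + #columns of the rows > r   (for s < r),
--   B_r ≥ A_{r+1}                                                          (for s = r):
-- the difference of the two sides bounds from below every inequality that is strict on the added
-- column, and if it is negative a greedy filling makes one of these inequalities an equality.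
-- If λ/μ is a partition or a rotated partition, no two of its columns are staggered, so that the
-- criterion, once it holds for all columns of λ/μ, persists when any of them is inserted. Hence
-- Q(n) = Q(n+1) iff the criterion holds at n for all columns of λ/μ, and then Q is constant from
-- n on. For a basic λ'/μ' no columns are empty and the criterion reads off the stated formula.

open import Defs
open import Data.Bool using (Bool; true; false; T; T?; _∧_; if_then_else_)
open import Data.Bool.Properties using (T-∧; T-∨)
import Data.Bool.ListAction as Bool
open import Data.Empty using (⊥; ⊥-elim)
open import Data.Fin as Fin using (Fin)
import Data.Fin.Properties as Finₚ
open import Data.Integer as ℤ using (ℤ; ∣_∣; _⊔_; 0ℤ) renaming (+_ to int)
import Data.Integer.DivMod as ℤᵈ
import Data.Integer.Properties as ℤₚ
import Data.Integer.Tactic.RingSolver as ℤring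
open import Data.List using (List; []; _∷_; _++_; map; length; lookup; upTo; applyUpTo; reverse; inits; take; drop; replicate; filter; filterᵇ; foldr)
open import Data.List.Membership.Propositional using (_∈_; lose; find)
open import Data.List.Membership.Propositional.Properties
open import Data.List.Properties using (++-assoc; ++-identityʳ; concatMap-++; filter-++; filter-accept; filter-reject; length-++; length-applyUpTo; length-map; length-replicate; map-++; map-applyUpTo; map-upTo; map-∘; reverse-++; take++drop≡id; take-all; unfold-reverse; upTo-∷ʳ; ∷-injective; ∷-injectiveʳ; ∷-injectiveˡ)
open import Data.List.Relation.Binary.Permutation.Propositional using (_↭_; ↭-sym)
import Data.List.Relation.Binary.Permutation.Propositional.Properties as ↭ₚ
open import Data.List.Relation.Unary.All as All using (All)
import Data.List.Relation.Unary.All.Properties as Allₚ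
open import Data.List.Relation.Unary.AllPairs as AllPairs using (AllPairs)
import Data.List.Relation.Unary.AllPairs.Properties as AllPairsₚ
open import Data.List.Relation.Unary.Any as Any using (Any; here; there)
import Data.List.Relation.Unary.Any.Properties as Anyₚ
open import Data.List.Relation.Unary.Unique.Propositional using (Unique)
import Data.List.Relation.Unary.Unique.Propositional.Properties as Uniqueₚ
open import Data.Nat as ℕ hiding (_⊔_)
open import Data.Nat.ListAction using (sum)
open import Data.Nat.ListAction.Properties using (sum-++; sum-↭)
open import Data.Nat.Properties
open import Data.Nat.Tactic.RingSolver using (solve)
open import Data.Product using (_×_; _,_; proj₁; proj₂; ∃)
open import Data.Product.Properties using (,-injectiveˡ; ,-injectiveʳ)
open import Data.Rational as ℚ using (ℚ; mkℚ; ↥_; ↧_; toℚᵘ)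
import Data.Rational.Properties as ℚₚ
open import Data.Rational.Unnormalised as ℚᵘ using (mkℚᵘ)
import Data.Rational.Unnormalised.Properties as ℚᵘₚ
open import Data.Sum using (_⊎_; inj₁; inj₂)
open import Function.Bundles using (Equivalence)
open import Relation.Binary.Definitions using (tri<; tri≈; tri>)
open import Relation.Binary.PropositionalEquality hiding ([_])
open import Relation.Nullary using (¬_; Dec; yes; no)

-- The sum over all `ν` removes the content from the problem: Q(n) counts all arrays satisfying
-- `LR`, so two consecutive stretched shapes are compared along one injection. The three terms of
-- the criterion arise as follows. In the first s rows each non-empty column holds at most one entry
-- 1; by the lattice condition the number R of these columns bounds the entries k + 1 in the first s
-- + k rows. Column strictness keeps the entries up to k of row s + k + 1 within the first B_{s+1}
-- columns. The boxes of row r beyond these two amounts are forced to hold the last entry of the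
-- added column, and they have to make up for the next larger entries in the rows below r, again at
-- most one per non-empty column. Which inequality becomes an equality when the criterion fails
-- depends on the shape, so the greedy filling keeps these bounds attained from row to row and stops
-- where the first of them is exhausted. Columns are treated one at a time because the criterion of
-- a single column is one inequality; the price is that each insertion changes the criteria of the
-- others.

-- Certificate for linear inequalities: the hypotheses are added up to `L ≤ R` and a ring identity
-- does the rest; `z` is the amount given away.
lin : ∀ {e f L R} z → L ≤ R → e + R + z ≡ f + L → e ≤ f
lin {e} {f} {L} {R} z h eq =
  +-cancelʳ-≤ R e f (≤-trans (m≤m+n (e + R) z) (≤-trans (≤-reflexive eq) (+-monoʳ-≤ f h)))

infixr 5 _⊕_
_⊕_ : ∀ {a b c d} → a ≤ b → c ≤ d → a + c ≤ b + d
_⊕_ = +-mono-≤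

-- Finite sums and indicators

Σ< : (ℕ → ℕ) → ℕ → ℕ
Σ< f zero    = 0
Σ< f (suc n) = Σ< f n + f n

Σ<-cong : ∀ {f g} n → (∀ i → i < n → f i ≡ g i) → Σ< f n ≡ Σ< g n
Σ<-cong zero    h = refl
Σ<-cong (suc n) h = cong₂ _+_ (Σ<-cong n (λ i i<n → h i (m<n⇒m<1+n i<n))) (h n ≤-refl)

Σ<-+ : ∀ f g n → Σ< (λ i → f i + g i) n ≡ Σ< f n + Σ< g n
Σ<-+ f g zero    = refl
Σ<-+ f g (suc n) rewrite Σ<-+ f g n = swap (Σ< f n) (Σ< g n) (f n) (g n)
  where
  swap : ∀ a b c d → a + b + (c + d) ≡ a + c + (b + d)
  swap a b c d = solve (a ∷ b ∷ c ∷ d ∷ [])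

Σ<-mono-≤ : ∀ {f g} n → (∀ i → i < n → f i ≤ g i) → Σ< f n ≤ Σ< g n
Σ<-mono-≤ zero    h = z≤n
Σ<-mono-≤ (suc n) h = Σ<-mono-≤ n (λ i i<n → h i (m<n⇒m<1+n i<n)) ⊕ h n ≤-refl

Σ<-extend : ∀ f {m n} → m ≤ n → Σ< f m ≤ Σ< f n
Σ<-extend f {m} {n} m≤n with m≤n⇒m<n∨m≡n m≤n
... | inj₂ refl = ≤-refl
Σ<-extend f {m} {suc n} _ | inj₁ (s≤s m≤n) = ≤-trans (Σ<-extend f m≤n) (m≤m+n _ _)

Σ<-zero : ∀ {f} n → (∀ i → i < n → f i ≡ 0) → Σ< f n ≡ 0
Σ<-zero zero    h = refl
Σ<-zero (suc n) h rewrite Σ<-zero n (λ i i<n → h i (m<n⇒m<1+n i<n)) = h n ≤-refl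

Σ<-stable : ∀ f {m n} → m ≤ n → (∀ i → m ≤ i → f i ≡ 0) → Σ< f n ≡ Σ< f m
Σ<-stable f {m} {n} m≤n h with m≤n⇒m<n∨m≡n m≤n
... | inj₂ refl = refl
Σ<-stable f {m} {suc n} _ h | inj₁ (s≤s m≤n) =
  trans (cong₂ _+_ (Σ<-stable f m≤n h) (h n m≤n)) (+-identityʳ _)

-- Indicators of `<` and `≡` with values in `ℕ`, so that a column is a summand of shapes and arrays
-- and its effect on an inequality is arithmetic.
lt : ℕ → ℕ → ℕ
lt _       zero    = 0
lt zero    (suc n) = 1
lt (suc i) (suc n) = lt i n

eq : ℕ → ℕ → ℕ
eq zero    zero    = 1
eq zero    (suc j) = 0
eq (suc i) zero    = 0
eq (suc i) (suc j) = eq i j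

lt-yes : ∀ {i n} → i < n → lt i n ≡ 1
lt-yes {zero}  {suc n} _         = refl
lt-yes {suc i} {suc n} (s≤s i<n) = lt-yes i<n

lt-no : ∀ {i n} → n ≤ i → lt i n ≡ 0
lt-no {i}     {zero}  _         = refl
lt-no {suc i} {suc n} (s≤s n≤i) = lt-no n≤i

lt≤1 : ∀ i n → lt i n ≤ 1
lt≤1 i       zero    = z≤n
lt≤1 zero    (suc n) = ≤-refl
lt≤1 (suc i) (suc n) = lt≤1 i n

lt-sucʳ : ∀ i j → lt i (suc j) ≡ lt i j + eq i j
lt-sucʳ zero    zero    = refl
lt-sucʳ zero    (suc j) = refl
lt-sucʳ (suc i) zero    = refl
lt-sucʳ (suc i) (suc j) = lt-sucʳ i j

lt-sucˡ : ∀ i j → lt j (suc i) ≡ lt j i + eq i j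
lt-sucˡ zero    zero    = refl
lt-sucˡ zero    (suc j) = refl
lt-sucˡ (suc i) zero    = refl
lt-sucˡ (suc i) (suc j) = lt-sucˡ i j

lt-suc-≤ : ∀ i n → lt (suc i) n ≤ lt i n
lt-suc-≤ i       zero    = z≤n
lt-suc-≤ zero    (suc n) = lt≤1 0 n
lt-suc-≤ (suc i) (suc n) = lt-suc-≤ i n

lt-suc-≢ : ∀ i n → n ≢ suc i → lt (suc i) n ≡ lt i n
lt-suc-≢ i n n≢ with <-cmp (suc i) n
... | tri< l _ _ = trans (lt-yes l) (sym (lt-yes (<-trans (n<1+n i) l)))
... | tri≈ _ e _ = ⊥-elim (n≢ (sym e))
... | tri> _ _ g = trans (lt-no (<⇒≤ g)) (sym (lt-no (≤-pred g)))

eq-no : ∀ {i j} → i ≢ j → eq i j ≡ 0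
eq-no {zero}  {zero}  h = ⊥-elim (h refl)
eq-no {zero}  {suc j} h = refl
eq-no {suc i} {zero}  h = refl
eq-no {suc i} {suc j} h = eq-no (λ e → h (cong suc e))

eq-transport : ∀ (f : ℕ → ℕ) i j → f i * eq i j ≡ f j * eq i j
eq-transport f i j with i ≟ j
... | yes refl = refl
... | no i≢j   = trans (zeroˡ (f i)) (sym (zeroˡ (f j)))
  where
  zeroˡ : ∀ n → n * eq i j ≡ 0
  zeroˡ n = trans (cong (n *_) (eq-no i≢j)) (*-zeroʳ n)

eq-refl : ∀ i → eq i i ≡ 1
eq-refl zero    = refl
eq-refl (suc i) = eq-refl i

-- Arrays of multiplicities

-- t i k is the number of entries k + 1 in row i + 1.
Array : Set
Array = ℕ → ℕ → ℕ

-- The last column of row i + 1 with an entry at most k, for a shape with inner partition B.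
end : (ℕ → ℕ) → Array → ℕ → ℕ → ℕ
end B t i k = B i + Σ< (t i) k

mult : Array → ℕ → ℕ → ℕ
mult t i k = Σ< (λ j → t j k) i

-- `rows` stops at the entry `i + 1` because `latt` excludes larger entries from row `i + 1`. `cols`
-- is column strictness: whatever is at most `k + 1` in a row lies below the inner shape or an entry
-- at most `k`. `latt` tests the lattice word only at its worst moment, when row `i + 1` has
-- contributed its entries `k + 2` but not yet its `k + 1`.
record LR (A B : ℕ → ℕ) (t : Array) : Set where
  field
    rows : ∀ i → end B t i (suc i) ≡ A i
    cols : ∀ i k → end B t (suc i) (suc k) ≤ end B t i k
    latt : ∀ i k → mult t (suc i) (suc k) ≤ mult t i k

infix 4 _≗₂_
_≗₂_ : Array → Array → Set
t ≗₂ t' = ∀ i k → t i k ≡ t' i k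

LR-resp : ∀ {A A' B B' t t'} → (∀ i → A i ≡ A' i) → (∀ i → B i ≡ B' i) → t ≗₂ t' →
          LR A B t → LR A' B' t'
LR-resp {A} {A'} {B} {B'} {t} {t'} a b e l = record
  { rows = λ i → trans (sym (ends i (suc i))) (trans (LR.rows l i) (a i))
  ; cols = λ i k → subst₂ _≤_ (ends (suc i) (suc k)) (ends i k) (LR.cols l i k)
  ; latt = λ i k → subst₂ _≤_ (mults (suc i) (suc k)) (mults i k) (LR.latt l i k)
  }
  where
  ends : ∀ i k → end B t i k ≡ end B' t' i k
  ends i k = cong₂ _+_ (b i) (Σ<-cong k (λ j _ → e i j))
  mults : ∀ i k → mult t i k ≡ mult t' i k
  mults i k = Σ<-cong i (λ j _ → e j k)

-- The column (r , s) occupies the rows s + 1, …, r.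
Column : Set
Column = ℕ × ℕ

_+ᴬ_ : (ℕ → ℕ) → Column → ℕ → ℕ
(A +ᴬ (r , s)) i = A i + lt i r

_+ᴮ_ : (ℕ → ℕ) → Column → ℕ → ℕ
(B +ᴮ (r , s)) i = B i + lt i s

-- The only Littlewood-Richardson tableau of a single column: the entries 1, ..., r - s from top to
-- bottom.
col : Column → Array
col (r , s) i k = lt i r * eq i (s + k)

_+ᵀ_ : Array → Column → Array
(t +ᵀ u) i k = t i k + col u i k

lt-*-≤ : ∀ i {s r} → s ≤ r → lt i s ≡ lt i r * lt i s
lt-*-≤ i {s} {r} s≤r with <-≤-connex i s
... | inj₁ i<s rewrite lt-yes i<s | lt-yes (<-≤-trans i<s s≤r) = refl
... | inj₂ s≤i rewrite lt-no s≤i = sym (*-zeroʳ (lt i r))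

-- In a row `i < s` the column belongs to the inner shape, in a row `s ≤ i < r` it carries the entry
-- `i − s + 1`; in both cases it counts towards the end exactly if `i < s + k`.
end-col : ∀ {r s} → s ≤ r → ∀ B t i k →
          end (B +ᴮ (r , s)) (t +ᵀ (r , s)) i k ≡ end B t i k + lt i r * lt i (s + k)
end-col {r} {s} s≤r B t i k = begin
  B i + lt i s + Σ< (λ j → t i j + col (r , s) i j) k      ≡⟨ cong (B i + lt i s +_) (Σ<-+ (t i) (col (r , s) i) k) ⟩
  B i + lt i s + (Σ< (t i) k + Σ< (col (r , s) i) k)       ≡⟨ shuffle (B i) (lt i s) _ _ ⟩
  end B t i k + (lt i s + Σ< (col (r , s) i) k)            ≡⟨ cong (end B t i k +_) (row k) ⟩
  end B t i k + lt i r * lt i (s + k)                      ∎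
  where
  open ≡-Reasoning
  shuffle : ∀ a b c d → a + b + (c + d) ≡ a + c + (b + d)
  shuffle a b c d = solve (a ∷ b ∷ c ∷ d ∷ [])
  row : ∀ k → lt i s + Σ< (col (r , s) i) k ≡ lt i r * lt i (s + k)
  row zero    rewrite +-identityʳ s = trans (+-identityʳ _) (lt-*-≤ i s≤r)
  row (suc k) = begin
    lt i s + (Σ< (col (r , s) i) k + lt i r * eq i (s + k))  ≡⟨ sym (+-assoc (lt i s) _ _) ⟩
    lt i s + Σ< (col (r , s) i) k + lt i r * eq i (s + k)    ≡⟨ cong (_+ lt i r * eq i (s + k)) (row k) ⟩
    lt i r * lt i (s + k) + lt i r * eq i (s + k)            ≡⟨ sym (*-distribˡ-+ (lt i r) _ _) ⟩
    lt i r * (lt i (s + k) + eq i (s + k))                   ≡⟨ cong (lt i r *_) (sym (lt-sucʳ i (s + k))) ⟩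
    lt i r * lt i (suc (s + k))                              ≡⟨ cong (λ z → lt i r * lt i z) (sym (+-suc s k)) ⟩
    lt i r * lt i (s + suc k)                                ∎

mult-col : ∀ r s t i k → mult (t +ᵀ (r , s)) i k ≡ mult t i k + lt (s + k) r * lt (s + k) i
mult-col r s t i k = trans (Σ<-+ (λ j → t j k) (λ j → col (r , s) j k) i) (cong (mult t i k +_) (column i))
  where
  column : ∀ i → Σ< (λ j → col (r , s) j k) i ≡ lt (s + k) r * lt (s + k) i
  column zero    = sym (*-zeroʳ (lt (s + k) r))
  column (suc i) rewrite column i | eq-transport (λ z → lt z r) i (s + k) =
    trans (sym (*-distribˡ-+ (lt (s + k) r) _ _)) (cong (lt (s + k) r *_) (sym (lt-sucˡ i (s + k))))

LR-+ : ∀ {A B t} u → proj₂ u ≤ proj₁ u → LR A B t → LR (A +ᴬ u) (B +ᴮ u) (t +ᵀ u)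
LR-+ {A} {B} {t} (r , s) s≤r l = record { rows = rows' ; cols = cols' ; latt = latt' }
  where
  open LR l
  rows' : ∀ i → end (B +ᴮ (r , s)) (t +ᵀ (r , s)) i (suc i) ≡ A i + lt i r
  rows' i = trans (end-col s≤r B t i (suc i)) (cong₂ _+_ (rows i)
    (trans (cong (lt i r *_) (lt-yes (m≤n+m (suc i) s))) (*-identityʳ _)))
  cols' : ∀ i k → end (B +ᴮ (r , s)) (t +ᵀ (r , s)) (suc i) (suc k) ≤ end (B +ᴮ (r , s)) (t +ᵀ (r , s)) i k
  cols' i k rewrite end-col s≤r B t (suc i) (suc k) | end-col s≤r B t i k | +-suc s k =
    cols i k ⊕ *-monoˡ-≤ (lt i (s + k)) (lt-suc-≤ i r)
  latt' : ∀ i k → mult (t +ᵀ (r , s)) (suc i) (suc k) ≤ mult (t +ᵀ (r , s)) i k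
  latt' i k rewrite mult-col r s t (suc i) (suc k) | mult-col r s t i k | +-suc s k =
    latt i k ⊕ *-monoˡ-≤ (lt (s + k) i) (lt-suc-≤ (s + k) r)

-- The inequalities defining LR that are strict on the tableau of the single column (r , s).
record Slack (r s : ℕ) (B : ℕ → ℕ) (t : Array) : Set where
  field
    diag  : ∀ k → s + k < r → 1 ≤ t (s + k) k
    below : ∀ i k → r ≡ suc i → r ≤ s + k → end B t (suc i) (suc k) < end B t i k
    strict : ∀ i k → r ≡ suc (s + k) → r ≤ i → mult t (suc i) (suc k) < mult t i k

slack-+ : ∀ {A B t r s} → s ≤ r → LR A B t → Slack r s (B +ᴮ (r , s)) (t +ᵀ (r , s))
slack-+ {A} {B} {t} {r} {s} s≤r l = record { diag = diag' ; below = below' ; strict = strict' }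
  where
  open LR l
  diag' : ∀ k → s + k < r → 1 ≤ (t +ᵀ (r , s)) (s + k) k
  diag' k h rewrite lt-yes h | eq-refl (s + k) = m≤n+m 1 (t (s + k) k)
  below' : ∀ i k → r ≡ suc i → r ≤ s + k →
           end (B +ᴮ (r , s)) (t +ᵀ (r , s)) (suc i) (suc k) < end (B +ᴮ (r , s)) (t +ᵀ (r , s)) i k
  below' i k refl h rewrite end-col s≤r B t (suc i) (suc k) | end-col s≤r B t i k
    | lt-no {suc i} {suc i} ≤-refl | lt-yes {i} {suc i} ≤-refl | lt-yes h
    | +-identityʳ (end B t (suc i) (suc k)) | +-comm (end B t i k) 1 = s≤s (cols i k)
  strict' : ∀ i k → r ≡ suc (s + k) → r ≤ i → mult (t +ᵀ (r , s)) (suc i) (suc k) < mult (t +ᵀ (r , s)) i k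
  strict' i k refl h rewrite mult-col r s t (suc i) (suc k) | mult-col r s t i k | +-suc s k
    | lt-no {suc (s + k)} {suc (s + k)} ≤-refl | lt-yes {s + k} {suc (s + k)} ≤-refl | lt-yes h
    | +-identityʳ (mult t (suc i) (suc k)) | +-comm (mult t i k) 1 = s≤s (latt i k)

slack-resp : ∀ {r s B t t'} → t ≗₂ t' → Slack r s B t → Slack r s B t'
slack-resp {r} {s} {B} {t} {t'} e l = record
  { diag   = λ k h → subst (1 ≤_) (e (s + k) k) (diag k h)
  ; below  = λ i k p h → subst₂ _<_ (ends (suc i) (suc k)) (ends i k) (below i k p h)
  ; strict = λ i k p h → subst₂ _<_ (mults (suc i) (suc k)) (mults i k) (strict i k p h)
  }
  where
  open Slack l
  ends : ∀ i k → end B t i k ≡ end B t' i k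
  ends i k = cong (B i +_) (Σ<-cong k (λ j _ → e i j))
  mults : ∀ i k → mult t i k ≡ mult t' i k
  mults i k = Σ<-cong i (λ j _ → e j k)

-- Subtracting the column can harm an inequality only where the column contributes to its larger
-- side alone: for `cols` this means `r = i + 1 ≤ s + k`, for `latt` it means `r = s + k + 1 ≤ i`.
-- There `Slack` supplies the missing unit.
LR-∸ : ∀ {A B t r s} → s ≤ r → LR (A +ᴬ (r , s)) (B +ᴮ (r , s)) t → Slack r s (B +ᴮ (r , s)) t →
       ∃ λ t' → LR A B t' × (t' +ᵀ (r , s)) ≗₂ t
LR-∸ {A} {B} {t} {r} {s} s≤r l sl = t' , record { rows = rows' ; cols = cols' ; latt = latt' } , t'+u
  where
  u = (r , s)
  t' : Array
  t' i k = t i k ∸ col u i k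
  col≤t : ∀ i k → col u i k ≤ t i k
  col≤t i k with i ≟ s + k
  ... | no i≢ = subst (_≤ t i k) (sym (trans (cong (lt i r *_) (eq-no i≢)) (*-zeroʳ (lt i r)))) z≤n
  ... | yes refl with <-≤-connex (s + k) r
  ...   | inj₁ h rewrite lt-yes h | eq-refl (s + k) = Slack.diag sl k h
  ...   | inj₂ h rewrite lt-no h = z≤n
  t'+u : (t' +ᵀ u) ≗₂ t
  t'+u i k = m∸n+n≡m (col≤t i k)
  l' : LR (A +ᴬ u) (B +ᴮ u) (t' +ᵀ u)
  l' = LR-resp (λ _ → refl) (λ _ → refl) (λ i k → sym (t'+u i k)) l
  sl' : Slack r s (B +ᴮ u) (t' +ᵀ u)
  sl' = slack-resp (λ i k → sym (t'+u i k)) sl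
  rows' : ∀ i → end B t' i (suc i) ≡ A i
  rows' i = +-cancelʳ-≡ (lt i r) _ _ (trans (cong (end B t' i (suc i) +_)
    (sym (trans (cong (lt i r *_) (lt-yes (m≤n+m (suc i) s))) (*-identityʳ _))))
    (trans (sym (end-col s≤r B t' i (suc i))) (LR.rows l' i)))
  cols' : ∀ i k → end B t' (suc i) (suc k) ≤ end B t' i k
  cols' i k with r ≟ suc i
  ... | no r≢ = +-cancelʳ-≤ (lt i r * lt i (s + k)) _ _ (subst₂ _≤_
      (trans (end-col s≤r B t' (suc i) (suc k)) (cong (end B t' (suc i) (suc k) +_)
        (cong₂ _*_ (lt-suc-≢ i r r≢) (cong (lt (suc i)) (+-suc s k)))))
      (end-col s≤r B t' i k) (LR.cols l' i k))
  ... | yes r≡ with <-≤-connex i (s + k)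
  ...   | inj₁ h = ≤-pred (begin-strict
      end B t' (suc i) (suc k)                     ≤⟨ m≤m+n _ _ ⟩
      end B t' (suc i) (suc k) + _                 ≡⟨ sym (end-col s≤r B t' (suc i) (suc k)) ⟩
      end (B +ᴮ u) (t' +ᵀ u) (suc i) (suc k)       <⟨ Slack.below sl' i k r≡ (subst (_≤ s + k) (sym r≡) h) ⟩
      end (B +ᴮ u) (t' +ᵀ u) i k                   ≡⟨ end-col s≤r B t' i k ⟩
      end B t' i k + lt i r * lt i (s + k)         ≤⟨ +-monoʳ-≤ (end B t' i k) (*-mono-≤ (lt≤1 i r) (lt≤1 i (s + k))) ⟩
      end B t' i k + 1                             ≡⟨ +-comm _ 1 ⟩
      suc (end B t' i k)                           ∎)
    where open ≤-Reasoning
  ...   | inj₂ h = begin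
      end B t' (suc i) (suc k)                     ≤⟨ m≤m+n _ _ ⟩
      end B t' (suc i) (suc k) + _                 ≡⟨ sym (end-col s≤r B t' (suc i) (suc k)) ⟩
      end (B +ᴮ u) (t' +ᵀ u) (suc i) (suc k)       ≤⟨ LR.cols l' i k ⟩
      end (B +ᴮ u) (t' +ᵀ u) i k                   ≡⟨ end-col s≤r B t' i k ⟩
      end B t' i k + lt i r * lt i (s + k)         ≡⟨ cong (λ z → end B t' i k + lt i r * z) (lt-no h) ⟩
      end B t' i k + lt i r * 0                    ≡⟨ cong (end B t' i k +_) (*-zeroʳ (lt i r)) ⟩
      end B t' i k + 0                             ≡⟨ +-identityʳ _ ⟩
      end B t' i k                                 ∎
    where open ≤-Reasoning
  latt' : ∀ i k → mult t' (suc i) (suc k) ≤ mult t' i k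
  latt' i k with r ≟ suc (s + k)
  ... | no r≢ = +-cancelʳ-≤ (lt (s + k) r * lt (s + k) i) _ _ (subst₂ _≤_
      (trans (mult-col r s t' (suc i) (suc k)) (cong (mult t' (suc i) (suc k) +_)
        (trans (cong (λ z → lt z r * lt z (suc i)) (+-suc s k)) (cong (_* lt (s + k) i) (lt-suc-≢ (s + k) r r≢)))))
      (mult-col r s t' i k) (LR.latt l' i k))
  ... | yes r≡ with <-≤-connex (s + k) i
  ...   | inj₁ h = ≤-pred (begin-strict
      mult t' (suc i) (suc k)                      ≤⟨ m≤m+n _ _ ⟩
      mult t' (suc i) (suc k) + _                  ≡⟨ sym (mult-col r s t' (suc i) (suc k)) ⟩
      mult (t' +ᵀ u) (suc i) (suc k)               <⟨ Slack.strict sl' i k r≡ (subst (_≤ i) (sym r≡) h) ⟩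
      mult (t' +ᵀ u) i k                           ≡⟨ mult-col r s t' i k ⟩
      mult t' i k + lt (s + k) r * lt (s + k) i    ≤⟨ +-monoʳ-≤ (mult t' i k) (*-mono-≤ (lt≤1 (s + k) r) (lt≤1 (s + k) i)) ⟩
      mult t' i k + 1                              ≡⟨ +-comm _ 1 ⟩
      suc (mult t' i k)                            ∎)
    where open ≤-Reasoning
  ...   | inj₂ h = begin
      mult t' (suc i) (suc k)                      ≤⟨ m≤m+n _ _ ⟩
      mult t' (suc i) (suc k) + _                  ≡⟨ sym (mult-col r s t' (suc i) (suc k)) ⟩
      mult (t' +ᵀ u) (suc i) (suc k)               ≤⟨ LR.latt l' i k ⟩
      mult (t' +ᵀ u) i k                           ≡⟨ mult-col r s t' i k ⟩
      mult t' i k + lt (s + k) r * lt (s + k) i    ≡⟨ cong (λ z → mult t' i k + lt (s + k) r * z) (lt-no h) ⟩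
      mult t' i k + lt (s + k) r * 0               ≡⟨ cong (mult t' i k +_) (*-zeroʳ (lt (s + k) r)) ⟩
      mult t' i k + 0                              ≡⟨ +-identityʳ _ ⟩
      mult t' i k                                  ∎
    where open ≤-Reasoning

-- Lower bounds for the slack

Decreasing : (ℕ → ℕ) → Set
Decreasing f = ∀ i → f (suc i) ≤ f i

antitone : ∀ {f} → Decreasing f → ∀ {i j} → i ≤ j → f j ≤ f i
antitone d {i} {j} i≤j with m≤n⇒m<n∨m≡n i≤j
... | inj₂ refl = ≤-refl
antitone d {i} {suc j} _ | inj₁ (s≤s i≤j) = ≤-trans (d j) (antitone d i≤j)

record Skew (A B : ℕ → ℕ) : Set where
  field
    A↓  : Decreasing A
    B↓  : Decreasing B
    B≤A : ∀ i → B i ≤ A i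

fresh : (A B : ℕ → ℕ) → ℕ → ℕ
fresh A B i = A (suc i) ⊓ B i ∸ B (suc i)

-- The number of non-empty columns of the rows a + 1, …, a + n of A / B:
-- a later row contributes the columns that its predecessor does not reach on the left.
width : (A B : ℕ → ℕ) → ℕ → ℕ → ℕ
width A B a zero    = 0
width A B a (suc n) = (A a ∸ B a) + Σ< (λ j → fresh A B (a + j)) n

fresh+B : ∀ {A B} → Skew A B → ∀ i → fresh A B i + B (suc i) ≡ A (suc i) ⊓ B i
fresh+B sk i = m∸n+n≡m (⊓-glb (B≤A (suc i)) (B↓ i))
  where open Skew sk

-- Descent along the diagonal: entries `k + 2` in `i + 1` rows require entries `k + 1` in `i` rows,
-- and finally entries in no rows at all.
lattice⇒mult-zero : ∀ {t : Array} → (∀ i k → mult t (suc i) (suc k) ≤ mult t i k) → ∀ {i k} → i ≤ k → mult t i k ≡ 0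
lattice⇒mult-zero     latt {zero}          _         = refl
lattice⇒mult-zero {t} latt {suc i} {suc k} (s≤s i≤k) =
  n≤0⇒n≡0 (subst (mult t (suc i) (suc k) ≤_) (lattice⇒mult-zero {t} latt i≤k) (latt i k))

module _ {A B : ℕ → ℕ} {t : Array} (l : LR A B t) where
  open LR l

  mult-zero : ∀ {i k} → i ≤ k → mult t i k ≡ 0
  mult-zero = lattice⇒mult-zero {t} latt

  entry-zero : ∀ {i k} → i < k → t i k ≡ 0
  entry-zero {i} {k} i<k = n≤0⇒n≡0 (subst (t i k ≤_) (mult-zero i<k) (m≤n+m (t i k) (mult t i k)))

  end-mono : ∀ i {k k'} → k ≤ k' → end B t i k ≤ end B t i k'
  end-mono i k≤k' = +-monoʳ-≤ (B i) (Σ<-extend (t i) k≤k')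

  end≤A : ∀ i k → end B t i k ≤ A i
  end≤A i k with ≤-total k (suc i)
  ... | inj₁ h = ≤-trans (end-mono i h) (≤-reflexive (rows i))
  ... | inj₂ h = ≤-reflexive (trans (cong (B i +_) (Σ<-stable (t i) h (λ j i<j → entry-zero i<j))) (rows i))

-- All entries above `k` of a row are bounded by one multiplicity. Descending induction on `k`: by
-- `latt` the entries `k + 2` up to this row are at most the entries `k + 1` of the earlier rows,
-- and the row's own entries `k + 1` pass from the end to the multiplicity.
tail≤mult : ∀ {A B : ℕ → ℕ} {t : Array} i → end B t i (suc i) ≡ A i → (∀ k → mult t (suc i) (suc k) ≤ mult t i k) →
            ∀ k → A i ≤ end B t i k + mult t (suc i) k
tail≤mult {A} {B} {t} i rows latt k with ≤-total k (suc i)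
... | inj₂ h = ≤-trans (≤-reflexive (sym rows)) (≤-trans (+-monoʳ-≤ (B i) (Σ<-extend (t i) h)) (m≤m+n _ _))
... | inj₁ h = go (suc i ∸ k) k (m+[n∸m]≡n h)
  where
  step : ∀ a b c x y z → a ≤ b + (c + x) + y → y ≤ z → a ≤ b + c + (z + x)
  step a b c x y z p q = lin 0 (p ⊕ q) (solve (a ∷ b ∷ c ∷ x ∷ y ∷ z ∷ []))
  go : ∀ d k → k + d ≡ suc i → A i ≤ end B t i k + mult t (suc i) k
  go zero    k e rewrite trans (sym (+-identityʳ k)) e = ≤-trans (≤-reflexive (sym rows)) (m≤m+n _ _)
  go (suc d) k e = step (A i) (B i) (Σ< (t i) k) (t i k) (mult t (suc i) (suc k)) (mult t i k)
    (go d (suc k) (trans (sym (+-suc k d)) e)) (latt k)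

module _ {A B : ℕ → ℕ} {t : Array} (sk : Skew A B) (l : LR A B t) where
  open Skew sk
  open LR l

  -- An entry 1 has no box of the diagram above it, so a row after the first holds them only in
  -- columns that its predecessor does not reach.
  firsts≤width : ∀ s → mult t s 0 ≤ width A B 0 s
  firsts≤width zero          = z≤n
  firsts≤width (suc zero)    = lin 0 (end≤A l 0 1 ⊕ ≤-reflexive (sym (m∸n+n≡m (B≤A 0))))
                                 (arith (t 0 0) (A 0) (B 0) (A 0 ∸ B 0))
    where
    arith : ∀ a b c d → a + (b + (d + c)) + 0 ≡ (d + 0) + (c + a + b)
    arith a b c d = solve (a ∷ b ∷ c ∷ d ∷ [])
  firsts≤width (suc (suc n)) = ≤-trans (firsts≤width (suc n) ⊕ new)
      (≤-reflexive (+-assoc (A 0 ∸ B 0) _ _))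
    where
    new : t (suc n) 0 ≤ fresh A B n
    new = +-cancelˡ-≤ (B (suc n)) _ _ (subst (B (suc n) + t (suc n) 0 ≤_)
      (trans (sym (fresh+B sk n)) (+-comm _ (B (suc n))))
      (⊓-glb (end≤A l (suc n) 1) (subst (B (suc n) + t (suc n) 0 ≤_) (+-identityʳ (B n)) (cols n 0))))

  -- The lattice condition leads up the diagonal to the entries 1 of the first `s` rows.
  mult-diag : ∀ s k → mult t (s + k) k ≤ width A B 0 s
  mult-diag s zero    rewrite +-identityʳ s = firsts≤width s
  mult-diag s (suc k) rewrite +-suc s k = ≤-trans (latt (s + k) k) (mult-diag s k)

  -- Column strictness leads up the diagonal to row `s + 1`, where only the inner shape is left.
  end-diag : ∀ s k → end B t (s + k) k ≤ B s
  end-diag s zero    rewrite +-identityʳ s | +-identityʳ (B s) = ≤-refl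
  end-diag s (suc k) rewrite +-suc s k = ≤-trans (cols (s + k) k) (end-diag s k)

  -- Equal entries lie in different columns, and those in the rows up to r + n + 1
  -- avoid the columns up to end B t (r + n) k.
  entries≤width : ∀ r n k → Σ< (λ j → t (r + j) k) (suc n) + end B t (r + n) k ≤ width A B r (suc n) + B (r + n)
  entries≤width r zero    k rewrite +-identityʳ r =
    lin 0 (end≤A l r (suc k) ⊕ ≤-reflexive (sym (m∸n+n≡m (B≤A r))))
      (arith (t r k) (B r) (Σ< (t r) k) (A r) (A r ∸ B r))
    where
    arith : ∀ a b c d e → a + (b + c) + (d + (e + b)) + 0 ≡ (e + 0 + b) + (b + (c + a) + d)
    arith a b c d e = solve (a ∷ b ∷ c ∷ d ∷ e ∷ [])
  entries≤width r (suc n) k rewrite +-suc r n =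
    arith (Σ< (λ j → t (r + j) k) (suc n)) (end B t (r + n) k) (A r ∸ B r) (Σ< (λ j → fresh A B (r + j)) n)
      (B (r + n)) (t (suc (r + n)) k) (B (suc (r + n))) (Σ< (t (suc (r + n))) k) (fresh A B (r + n))
      (A (suc (r + n)) ⊓ B (r + n))
      (entries≤width r n k) (fresh+B sk (r + n)) new
    where
    new : B (r + n) + end B t (suc (r + n)) (suc k) ≤ end B t (r + n) k + (A (suc (r + n)) ⊓ B (r + n))
    new with ≤-total (A (suc (r + n))) (B (r + n))
    ... | inj₁ h rewrite m≤n⇒m⊓n≡m h = m≤m+n (B (r + n)) _ ⊕ end≤A l (suc (r + n)) (suc k)
    ... | inj₂ h rewrite m≥n⇒m⊓n≡n h | +-comm (B (r + n)) (end B t (suc (r + n)) (suc k)) =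
      cols (r + n) k ⊕ ≤-refl
    arith : ∀ S e a w b x b' y f m → S + e ≤ a + w + b → f + b' ≡ m → b + (b' + (y + x)) ≤ e + m →
            S + x + (b' + y) ≤ a + (w + f) + b'
    arith S e a w b x b' y f m p refl q = lin 0 (p ⊕ q)
      (solve (S ∷ e ∷ a ∷ w ∷ b ∷ x ∷ b' ∷ y ∷ f ∷ []))

  -- `tail` bounds the length of a row by an end and a multiplicity. Evaluated on the diagonal,
  -- `end-diag` and `mult-diag` bound these by `B s` and `R`, up to the diagonal entry itself. By
  -- `W` the remainder exceeds a width: of no rows for `diag`, of the row below the column for
  -- `below`, and for `strict` of all rows between the column and row `i + 1`, where the next entry
  -- occurs at most once per column.
  slack : ∀ {r' s} → s ≤ r' → (∀ n → B s + width A B 0 s + width A B (suc r') n < A r') → Slack (suc r') s B t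
  slack {r'} {s} s≤r' W = record { diag = diag ; below = below ; strict = strict }
    where
    R = width A B 0 s
    tail : ∀ i k → A i ≤ end B t i k + mult t (suc i) k
    tail i = tail≤mult {A} {B} {t} i (rows i) (latt i)
    W₀ : B s + R < A r'
    W₀ = subst (_< A r') (+-identityʳ (B s + R)) (W 0)
    diag : ∀ k → s + k < suc r' → 1 ≤ t (s + k) k
    diag k (s≤s h) = arith (B (s + k)) (Σ< (t (s + k)) k) (t (s + k) k) (A r') (A (s + k)) (mult t (suc (s + k)) (suc k)) (mult t (s + k) k) (B s) R
      (tail (s + k) (suc k)) (latt (s + k) k) (mult-diag s k) (end-diag s k) (antitone A↓ h) W₀
      where
      arith : ∀ b σ x a' a m m' c R → a ≤ b + (σ + x) + m → m ≤ m' → m' ≤ R → b + σ ≤ c → a' ≤ a → c + R < a' → 1 ≤ x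
      arith b σ x a' a m m' c R h1 h2 h3 h4 h5 h6 = lin 0 (h1 ⊕ h2 ⊕ h3 ⊕ h4 ⊕ h5 ⊕ h6)
        (solve (b ∷ σ ∷ x ∷ a' ∷ a ∷ m ∷ m' ∷ c ∷ R ∷ []))
    below : ∀ i k → suc r' ≡ suc i → suc r' ≤ s + k → end B t (suc i) (suc k) < end B t i k
    below i k refl h = arith (end B t (suc i) (suc k)) (A (suc i)) (B (suc i)) (A (suc i) ∸ B (suc i)) (B s) R (A i)
        (end B t i q) (mult t (suc i) q) (end B t i k)
        (end≤A l (suc i) (suc k)) (m∸n+n≡m (B≤A (suc i))) (antitone B↓ (m≤n⇒m≤1+n s≤r')) (W 1) (tail i q)
        (subst (λ z → mult t z q ≤ R) s+q (mult-diag s q)) (end-mono l i q≤k)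
      where
      -- The height of the column: its last row is the row number `s + q`, so `mult-diag` bounds the
      -- entries `q + 1` up to there.
      q = suc i ∸ s
      s+q : s + q ≡ suc i
      s+q = m+[n∸m]≡n (m≤n⇒m≤1+n s≤r')
      q≤k : q ≤ k
      q≤k = +-cancelˡ-≤ s q k (subst (_≤ s + k) (sym s+q) h)
      arith : ∀ e a b d c R a' e' m e'' → e ≤ a → d + b ≡ a → b ≤ c → c + R + (d + 0) < a' →
              a' ≤ e' + m → m ≤ R → e' ≤ e'' → e < e''
      arith e a b d c R a' e' m e'' h1 refl h3 h4 h5 h6 h7 = lin 0 (h1 ⊕ h3 ⊕ h4 ⊕ h5 ⊕ h6 ⊕ h7)
        (solve (e ∷ b ∷ d ∷ c ∷ R ∷ a' ∷ e' ∷ m ∷ e'' ∷ []))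
    strict : ∀ i k → suc r' ≡ suc (s + k) → suc r' ≤ i → mult t (suc i) (suc k) < mult t i k
    strict i k refl h with n ← i ∸ suc r' | refl ← m+[n∸m]≡n h =
      arith (mult t (suc (s + k)) (suc k)) (Σ< (λ j → t (suc (s + k + j)) (suc k)) (suc n)) (width A B (suc (s + k)) (suc n))
        (B (suc (s + k + n))) (end B t (suc (s + k + n)) (suc k)) (mult t (s + k) k) (t (s + k) k)
        (B (s + k)) (Σ< (t (s + k)) k) (A (s + k)) (B s) R (mult t (suc (s + k + n)) k) (mult t (suc (suc (s + k + n))) (suc k))
        (trans (cong (λ z → mult t (suc z) (suc k)) (sym (+-suc (s + k) n))) (split (suc n))) (entries≤width (suc (s + k)) n (suc k)) (m≤m+n _ _)
        (tail (s + k) (suc k)) (end-diag s k) (latt (s + k) k) (mult-diag s k)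
        (Σ<-extend (λ j → t j k) (m≤m+n (suc (s + k)) n)) (W (suc n))
      where
      split : ∀ n → mult t (suc (s + k + n)) (suc k) ≡
              mult t (suc (s + k)) (suc k) + Σ< (λ j → t (suc (s + k + j)) (suc k)) n
      split zero    rewrite +-identityʳ (s + k) = sym (+-identityʳ _)
      split (suc n) rewrite +-suc (s + k) n = trans (cong (_+ t (suc (s + k + n)) (suc k)) (split n))
        (+-assoc (mult t (suc (s + k)) (suc k)) _ _)
      arith : ∀ m S w b e m' x b₀ σ a c R M M' →
              M' ≡ m + S → S + e ≤ w + b → b ≤ e → a ≤ b₀ + (σ + x) + m → b₀ + σ ≤ c → m ≤ m' → m' ≤ R →
              m' + x ≤ M → c + R + w < a → M' < M
      arith m S w b e m' x b₀ σ a c R M M' refl h1 h2 h3 h4 h5 h6 h7 h8 =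
        lin 0 (h1 ⊕ h2 ⊕ h3 ⊕ h4 ⊕ h5 ⊕ h5 ⊕ h6 ⊕ h7 ⊕ h8)
          (solve (m ∷ S ∷ w ∷ b ∷ e ∷ m' ∷ x ∷ b₀ ∷ σ ∷ a ∷ c ∷ R ∷ M ∷ []))

-- Greedy fillings

setRow : Array → ℕ → (ℕ → ℕ) → Array
setRow t n ρ i with i ≟ n
... | yes _ = ρ
... | no  _ = t i

setRow-same : ∀ t n ρ → setRow t n ρ n ≡ ρ
setRow-same t n ρ with n ≟ n
... | yes _   = refl
... | no  n≢n = ⊥-elim (n≢n refl)

setRow-other : ∀ t n ρ {i} → i ≢ n → setRow t n ρ i ≡ t i
setRow-other t n ρ {i} i≢n with i ≟ n
... | yes i≡n = ⊥-elim (i≢n i≡n)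
... | no  _   = refl

module Filling {A B : ℕ → ℕ} (sk : Skew A B) where
  open Skew sk

  record Partial (n : ℕ) (t : Array) : Set where
    field
      rows  : ∀ i → i < n → end B t i (suc i) ≡ A i
      cols  : ∀ i k → suc i < n → end B t (suc i) (suc k) ≤ end B t i k
      latt  : ∀ i k → i < n → mult t (suc i) (suc k) ≤ mult t i k
      blank : ∀ i k → n ≤ i → t i k ≡ 0

  -- Row 1 has no predecessor; `A 0` is a bound that it respects anyway.
  above : Array → ℕ → ℕ → ℕ
  above t zero    k = A 0
  above t (suc m) k = end B t m k

  mult-antiᴾ : ∀ {n t} → Partial n t → ∀ k → mult t n (suc k) ≤ mult t n k
  mult-antiᴾ {zero}  p k = z≤n
  mult-antiᴾ {suc m} p k = ≤-trans (Partial.latt p m k ≤-refl) (m≤m+n _ _)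

  above≥B : ∀ n t k → B n ≤ above t n k
  above≥B zero    t k = B≤A 0
  above≥B (suc m) t k = ≤-trans (B↓ m) (m≤m+n (B m) _)

  above-mono : ∀ n t k → above t n k ≤ above t n (suc k)
  above-mono zero    t k = ≤-refl
  above-mono (suc m) t k = +-monoʳ-≤ (B m) (m≤m+n _ _)

  above≥A : ∀ {n t} → Partial n t → A n ≤ above t n n
  above≥A {zero}  p = ≤-refl
  above≥A {suc m} p = ≤-trans (A↓ m) (≤-reflexive (sym (Partial.rows p m ≤-refl)))

  -- `latt` for the preceding row in terms of its ends: filling up to the bound of column strictness
  -- does not violate the lattice condition.
  above-mult : ∀ {n t} → Partial n t → ∀ k → above t n (suc k) + mult t n (suc k) ≤ above t n k + mult t n k
  above-mult {zero}      p k = ≤-refl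
  above-mult {suc m} {t} p k = arith (B m) (Σ< (t m) k) (t m k) (mult t (suc m) (suc k)) (mult t m k)
      (Partial.latt p m k ≤-refl)
    where
    arith : ∀ b σ x a c → a ≤ c → b + (σ + x) + a ≤ b + σ + (c + x)
    arith b σ x a c h = lin 0 h (solve (b ∷ σ ∷ x ∷ a ∷ c ∷ []))

  above-tail : ∀ {n t} → Partial n t → ∀ k → A n ≤ above t n k + mult t n k
  above-tail {zero}      p k = m≤m+n (A 0) 0
  above-tail {suc m} {t} p k = ≤-trans (A↓ m)
    (tail≤mult {A} {B} {t} m (Partial.rows p m ≤-refl) (λ k → Partial.latt p m k ≤-refl) k)

  record Extension (n : ℕ) (t : Array) (g : ℕ → ℕ) : Set where
    field
      t'      : Array
      partial : Partial (suc n) t'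
      old     : ∀ {i} → i < n → t' i ≡ t i
      start   : end B t' n 0 ≡ B n
      new     : ∀ k → end B t' n (suc k) ≡ A n ⊓ above t n k ⊓ g k

    end-old : ∀ {i} → i < n → ∀ k → end B t' i k ≡ end B t i k
    end-old {i} i<n k = cong (λ ρ → B i + Σ< ρ k) (old i<n)

    mult-old : ∀ {i} → i ≤ n → ∀ k → mult t' i k ≡ mult t i k
    mult-old {i} i≤n k = Σ<-cong i (λ j j<i → cong (λ ρ → ρ k) (old (<-≤-trans j<i i≤n)))

  abstract
    -- An entry k + 1 or smaller may only be placed in the columns up to above t n k (strictness)
    -- and up to the cap g k.
    extend : ∀ {n t} → Partial n t → (g : ℕ → ℕ) → (∀ k → B n ≤ g k) → (∀ k → g k ≤ g (suc k)) → A n ≤ g n →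
             (∀ k → A n ⊓ above t n (suc k) ⊓ g (suc k) + mult t n (suc k) ≤ g k + mult t n k) →
             Extension n t g
    extend {n} {t} p g g≥B g-mono g≥A g-mult = record
      { t' = t'
      ; partial = record { rows = rows' ; cols = cols' ; latt = latt' ; blank = blank' }
      ; old = old ; start = +-identityʳ (B n) ; new = λ k → endY (suc k) }
      where
      open Partial p
      -- The row is planned by its ends: entries up to `k` reach as far as all three bounds allow,
      -- and the multiplicities are the differences.
      Y : ℕ → ℕ
      Y zero    = B n
      Y (suc k) = A n ⊓ above t n k ⊓ g k
      Y-mono : ∀ k → Y k ≤ Y (suc k)
      Y-mono zero    = ⊓-glb (⊓-glb (B≤A n) (above≥B n t 0)) (g≥B 0)
      Y-mono (suc k) = ⊓-mono-≤ (⊓-mono-≤ (≤-refl {A n}) (above-mono n t k)) (g-mono k)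
      ρ : ℕ → ℕ
      ρ k = Y (suc k) ∸ Y k
      t' : Array
      t' = setRow t n ρ
      old : ∀ {i} → i < n → t' i ≡ t i
      old i<n = setRow-other t n ρ (<⇒≢ i<n)
      Σρ : ∀ k → B n + Σ< ρ k ≡ Y k
      Σρ zero    = +-identityʳ (B n)
      Σρ (suc k) = trans (sym (+-assoc (B n) _ _)) (trans (cong (_+ ρ k) (Σρ k)) (m+[n∸m]≡n (Y-mono k)))
      endY : ∀ k → end B t' n k ≡ Y k
      endY k = trans (cong (λ z → B n + Σ< z k) (setRow-same t n ρ)) (Σρ k)
      ends : ∀ {i} → i < n → ∀ k → end B t' i k ≡ end B t i k
      ends {i} i<n k = cong (λ z → B i + Σ< z k) (old i<n)
      mults : ∀ {i} → i ≤ n → ∀ k → mult t' i k ≡ mult t i k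
      mults {i} i≤n k = Σ<-cong i (λ j j<i → cong (λ z → z k) (old (<-≤-trans j<i i≤n)))
      multY : ∀ k → mult t' (suc n) k ≡ mult t n k + ρ k
      multY k = cong₂ _+_ (mults ≤-refl k) (cong (λ z → z k) (setRow-same t n ρ))
      rows' : ∀ i → i < suc n → end B t' i (suc i) ≡ A i
      rows' i (s≤s i≤n) with m≤n⇒m<n∨m≡n i≤n
      ... | inj₁ i<n  = trans (ends i<n (suc i)) (rows i i<n)
      ... | inj₂ refl = trans (endY (suc n)) (trans (cong (_⊓ g n) (m≤n⇒m⊓n≡m (above≥A p))) (m≤n⇒m⊓n≡m g≥A))
      cols' : ∀ i k → suc i < suc n → end B t' (suc i) (suc k) ≤ end B t' i k
      cols' i k (s≤s i<n) with m≤n⇒m<n∨m≡n i<n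
      ... | inj₁ si<n = subst₂ _≤_ (sym (ends si<n (suc k))) (sym (ends i<n k)) (cols i k si<n)
      ... | inj₂ refl = subst₂ _≤_ (sym (endY (suc k))) (sym (ends i<n k))
                          (≤-trans (m⊓n≤m _ (g k)) (m⊓n≤n (A n) _))
      -- The lattice condition for the new row, stated for ends. The right side is a minimum, so
      -- each of the three bounds can be checked separately.
      Y-mult : ∀ k → Y (suc (suc k)) + mult t n (suc k) ≤ Y (suc k) + mult t n k
      Y-mult k = subst (Y (suc (suc k)) + mult t n (suc k) ≤_)
        (sym (trans (+-distribʳ-⊓ (mult t n k) (A n ⊓ above t n k) (g k))
                    (cong (_⊓ (g k + mult t n k)) (+-distribʳ-⊓ (mult t n k) (A n) (above t n k)))))
        (⊓-glb (⊓-glb (≤-trans (m⊓n≤m _ (g (suc k))) (m⊓n≤m (A n) _) ⊕ mult-antiᴾ p k)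
                      (≤-trans ((≤-trans (m⊓n≤m _ (g (suc k))) (m⊓n≤n (A n) _)) ⊕ ≤-refl) (above-mult p k)))
               (g-mult k))
      latt' : ∀ i k → i < suc n → mult t' (suc i) (suc k) ≤ mult t' i k
      latt' i k (s≤s i≤n) with m≤n⇒m<n∨m≡n i≤n
      ... | inj₁ i<n  = subst₂ _≤_ (sym (mults i<n (suc k))) (sym (mults i≤n k)) (latt i k i<n)
      ... | inj₂ refl = subst₂ _≤_ (sym (multY (suc k))) (sym (mults ≤-refl k))
          (arith (mult t n (suc k)) (ρ (suc k)) (Y (suc k)) (Y (suc (suc k))) (mult t n k)
            (m+[n∸m]≡n (Y-mono (suc k))) (Y-mult k))
        where
        arith : ∀ m d y y' m' → y + d ≡ y' → y' + m ≤ y + m' → m + d ≤ m'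
        arith m d y y' m' refl h = lin 0 h (solve (m ∷ d ∷ y ∷ m' ∷ []))
      blank' : ∀ i k → suc n ≤ i → t' i k ≡ 0
      blank' i k n<i = trans (cong (λ z → z k) (setRow-other t n ρ (λ e → <-irrefl (sym e) n<i))) (blank i k (<⇒≤ n<i))

  empty : Partial 0 (λ _ _ → 0)
  empty = record { rows = λ _ () ; cols = λ _ _ () ; latt = λ _ _ () ; blank = λ _ _ _ → refl }

  extendFree : ∀ {n t} → Partial n t → Extension n t (λ _ → A n)
  extendFree {n} {t} p = extend p (λ _ → A n) (λ _ → B≤A n) (λ _ → ≤-refl) ≤-refl
    (λ k → m⊓n≤n _ (A n) ⊕ mult-antiᴾ p k)

  Agrees : ℕ → Array → Array → Set
  Agrees n t t' = ∀ {i} → i < n → t' i ≡ t i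

  extendTo : ∀ {n t} d → Partial n t → ∃ λ t' → Partial (d + n) t' × Agrees n t t'
  extendTo zero    p = _ , p , λ _ → refl
  extendTo {n} (suc d) p with extendTo d p
  ... | t' , p' , e = E.t' , E.partial , λ i<n → trans (E.old (<-≤-trans i<n (m≤n+m n d))) (e i<n)
    where module E = Extension (extendFree p')

  complete : ∀ {N n t} → n ≤ N → (∀ i → N ≤ i → A i ≡ 0) → Partial n t →
             ∃ λ t' → LR A B t' × Agrees n t t'
  complete {N} {n} n≤N A≡0 p with extendTo (N ∸ n) p
  ... | t' , p' , e rewrite m∸n+n≡m n≤N = t' , record { rows = rows' ; cols = cols' ; latt = latt' } , e
    where
    open Partial p'
    B≡0 : ∀ i → N ≤ i → B i ≡ 0
    B≡0 i h = n≤0⇒n≡0 (subst (B i ≤_) (A≡0 i h) (B≤A i))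
    end≡0 : ∀ i k → N ≤ i → end B t' i k ≡ 0
    end≡0 i k h rewrite B≡0 i h = Σ<-zero k (λ j _ → blank i j h)
    rows' : ∀ i → end B t' i (suc i) ≡ A i
    rows' i with <-≤-connex i N
    ... | inj₁ h = rows i h
    ... | inj₂ h = trans (end≡0 i (suc i) h) (sym (A≡0 i h))
    cols' : ∀ i k → end B t' (suc i) (suc k) ≤ end B t' i k
    cols' i k with <-≤-connex (suc i) N
    ... | inj₁ h = cols i k h
    ... | inj₂ h = subst (_≤ end B t' i k) (sym (end≡0 (suc i) (suc k) h)) z≤n
    latt' : ∀ i k → mult t' (suc i) (suc k) ≤ mult t' i k
    latt' i k with <-≤-connex i N
    ... | inj₁ h = latt i k h
    ... | inj₂ h = subst₂ _≤_ (sym (Σ<-stable _ (m≤n⇒m≤1+n h) (λ j g → blank j (suc k) g)))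
                     (sym (Σ<-stable _ h (λ j g → blank j k g))) (mult-antiᴾ p' k)

-- Raising a multiplicity lowers the cap `b ⊔ (a ∸ m)` by at most as much, which is what `extend`
-- demands of the cap chosen in `middle-step`.
∸-+-lipschitz : ∀ b a {m m'} → m' ≤ m → (b ℕ.⊔ (a ∸ m')) + m' ≤ (b ℕ.⊔ (a ∸ m)) + m
∸-+-lipschitz b a {m} {m'} m'≤m = subst (_≤ (b ℕ.⊔ (a ∸ m)) + m) (sym (+-distribʳ-⊔ m' b (a ∸ m')))
  (⊔-lub (m≤m⊔n b (a ∸ m) ⊕ m'≤m) second)
  where
  second : a ∸ m' + m' ≤ (b ℕ.⊔ (a ∸ m)) + m
  second with ≤-total m' a
  ... | inj₁ m'≤a = ≤-trans (≤-reflexive (m∸n+n≡m m'≤a)) (≤-trans (m≤n+m∸n a m)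
                      (≤-trans (≤-reflexive (+-comm m (a ∸ m))) (m≤n⊔m b (a ∸ m) ⊕ ≤-refl)))
  ... | inj₂ a≤m' rewrite m≤n⇒m∸n≡0 a≤m' = ≤-trans m'≤m (m≤n+m m _)

module Tightness {A B : ℕ → ℕ} (sk : Skew A B) where
  open Skew sk
  open Filling sk

  mult-zeroᴾ : ∀ {n t} → Partial n t → ∀ {i k} → i ≤ n → i ≤ k → mult t i k ≡ 0
  mult-zeroᴾ p {zero}          _   _         = refl
  mult-zeroᴾ {n} {t} p {suc i} {suc k} i<n (s≤s i≤k) =
    n≤0⇒n≡0 (subst (mult t (suc i) (suc k) ≤_) (mult-zeroᴾ p (<⇒≤ i<n) i≤k) (Partial.latt p i k i<n))

  -- The failure is visible in the first `n` rows and survives every continuation, so that any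
  -- completion of the filling will serve.
  Tight : ℕ → ℕ → ℕ → Array → Set
  Tight r s n t = ∀ t' → Agrees n t t' → ¬ Slack r s B t'

  finish : ∀ {N n r s t} → n ≤ N → (∀ i → N ≤ i → A i ≡ 0) → Partial n t → Tight r s n t →
           ∃ λ t' → LR A B t' × ¬ Slack r s B t'
  finish n≤N A≡0 p tight with complete n≤N A≡0 p
  ... | t' , l , e = t' , l , tight t' e

  end-agree : ∀ {n t t'} → Agrees n t t' → ∀ {i} → i < n → ∀ k → end B t' i k ≡ end B t i k
  end-agree e {i} i<n k = cong (λ ρ → B i + Σ< ρ k) (e i<n)

  mult-agree : ∀ {n t t'} → Agrees n t t' → ∀ {i} → i ≤ n → ∀ k → mult t' i k ≡ mult t i k
  mult-agree e {i} i≤n k = Σ<-cong i (λ j j<i → cong (λ ρ → ρ k) (e (<-≤-trans j<i i≤n)))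

  -- Rows filled with consecutive entries down each column: every non-empty column contains the smallest entry.
  superstandard : ∀ s → ∃ λ t → Partial s t × mult t s 0 ≡ width A B 0 s
  superstandard zero    = _ , empty , refl
  superstandard (suc n) with superstandard n
  ... | t , p , e = E.t' , E.partial , trans (cong₂ _+_ (trans (E.mult-old ≤-refl 0) e) refl) (last n t E.t' (E.new 0))
    where
    module E = Extension (extendFree p)
    last : ∀ n t t' → end B t' n 1 ≡ A n ⊓ above t n 0 ⊓ A n → width A B 0 n + t' n 0 ≡ width A B 0 (suc n)
    last zero    t t' h = trans (+-cancelʳ-≡ (B 0) _ _ (trans (trans (+-comm _ (B 0)) h)
      (trans (cong (_⊓ A 0) (⊓-idem (A 0))) (trans (⊓-idem (A 0)) (sym (m∸n+n≡m (B≤A 0))))))) (sym (+-identityʳ _))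
    last (suc m) t t' h = trans (+-assoc (A 0 ∸ B 0) _ _) (cong (λ z → A 0 ∸ B 0 + (Σ< (fresh A B) m + z))
      (+-cancelʳ-≡ (B (suc m)) _ _ (trans (trans (+-comm _ (B (suc m))) h)
        (trans (cong (λ z → A (suc m) ⊓ z ⊓ A (suc m)) (+-identityʳ (B m)))
          (trans (m≤n⇒m⊓n≡m (m⊓n≤m (A (suc m)) (B m))) (sym (fresh+B sk m)))))))

  -- In the free filling the entries 1 of row `r' + 2` extend right up to column `B r'`, since the
  -- row is long enough; this is equality in `below` for `k = 0`.
  tight-empty : ∀ {N r'} → suc r' ≤ N → (∀ i → N ≤ i → A i ≡ 0) → B r' ≤ A (suc r') →
                ∃ λ t → LR A B t × ¬ Slack (suc r') (suc r') B t
  tight-empty {N} {r'} r≤N A≡0 h with superstandard (suc r')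
  ... | t , p , _ = finish (s≤s r≤N) (λ i N<i → A≡0 i (<⇒≤ N<i)) E.partial tight
    where
    module E = Extension (extendFree p)
    touch : end B E.t' (suc r') 1 ≡ end B E.t' r' 0
    touch = trans (E.new 0) (trans (cong (λ z → A (suc r') ⊓ z ⊓ A (suc r')) (+-identityʳ (B r')))
      (trans (cong (_⊓ A (suc r')) (m≥n⇒m⊓n≡n h)) (trans (m≤n⇒m⊓n≡m h) (sym (+-identityʳ (B r'))))))
    tight : Tight (suc r') (suc r') (suc (suc r')) E.t'
    tight t' e sl = <-irrefl touch (subst₂ _<_ (end-agree e ≤-refl 1) (end-agree e (n≤1+n (suc r')) 0)
      (Slack.below sl r' 0 refl (m≤m+n (suc r') 0)))

  module _ {r' s : ℕ} (s≤r' : s ≤ r') where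
    r = suc r'
    R = width A B 0 s

    -- The state before row n + 1 = s + k + 1, while the rows from s + 1 on contain as many
    -- entries above the diagonal as the lattice condition allows, namely R.
    record Middle (n k : ℕ) (t : Array) : Set where
      field
        index   : n ≡ s + k
        partial : Partial n t
        top     : mult t n k ≡ R
        -- The preceding row, if it meets the column, is extremal: entries smaller than the diagonal
        -- one stop at `B s`, larger ones number `R`, and the diagonal entry fills the columns
        -- between.
        prev    : (k ≡ 0) ⊎ (∃ λ j → ∃ λ n' → k ≡ suc j × n ≡ suc n' × end B t n' j ≡ B s ×
                    end B t n' k + R ≡ A n' × mult t n j + B s ≡ A n' × R + B s < A n')

    -- Beyond column `B s` the row gives as many boxes to large entries as the lattice condition
    -- permits. On the diagonal this leaves to the entry `k + 1` the columns from `B s` to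
    -- `A n - R`: if there are none, `diag` fails and the search ends; otherwise the new row is
    -- extremal again.
    middle-step : ∀ {n k t} → n ≤ r' → Middle n k t →
                  (∃ λ t' → Middle (suc n) (suc k) t') ⊎ (∃ λ t' → Partial (suc n) t' × Tight r s (suc n) t')
    middle-step {n} {k} {t} n≤r' mid = result
      where
      open Middle mid
      -- `mult t n j` is the largest possible number of entries above `j + 1` in this row; the
      -- columns up to `B s` are never taken from the small entries.
      g : ℕ → ℕ
      g j = B s ℕ.⊔ (A n ∸ mult t n j)
      s≤n : s ≤ n
      s≤n = subst (s ≤_) (sym index) (m≤m+n s k)
      ext : Extension n t g
      ext = extend partial g
        (λ j → ≤-trans (antitone B↓ s≤n) (m≤m⊔n (B s) _))
        (λ j → ⊔-monoʳ-≤ (B s) (∸-monoʳ-≤ (A n) (mult-antiᴾ partial j)))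
        (≤-trans (≤-reflexive (sym (cong (A n ∸_) (mult-zeroᴾ partial ≤-refl ≤-refl)))) (m≤n⊔m (B s) _))
        (λ j → ≤-trans (m⊓n≤n _ (g (suc j)) ⊕ ≤-refl) (∸-+-lipschitz (B s) (A n) (mult-antiᴾ partial j)))
      module E = Extension ext
      endₖ : end B E.t' n k ≡ A n ⊓ B s
      endₖ with prev
      ... | inj₁ refl = trans E.start (trans (cong B n≡s) (sym (m≥n⇒m⊓n≡n (subst (λ z → B s ≤ A z) (sym n≡s) (B≤A s)))))
        where
        n≡s : n ≡ s
        n≡s = trans index (+-identityʳ s)
      ... | inj₂ (j , n' , refl , refl , e , _) = trans (E.new j) (trans (cong (λ z → A n ⊓ z ⊓ g j) e)
              (m≤n⇒m⊓n≡m (≤-trans (m⊓n≤n (A n) (B s)) (m≤m⊔n (B s) _))))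
      result : (∃ λ t' → Middle (suc n) (suc k) t') ⊎ (∃ λ t' → Partial (suc n) t' × Tight r s (suc n) t')
      result with <-≤-connex (R + B s) (A n)
      ... | inj₂ A≤ = inj₂ (E.t' , E.partial , tight)
        where
        end₊ : end B E.t' n (suc k) ≤ end B E.t' n k
        end₊ = ≤-trans (≤-reflexive (E.new k)) (≤-trans (⊓-mono-≤ (m⊓n≤m (A n) _)
          (⊔-lub (≤-refl {B s}) (≤-trans (≤-reflexive (cong (A n ∸_) top)) (m≤n+o⇒m∸n≤o (A n) R A≤))))
          (≤-reflexive (sym endₖ)))
        zero! : E.t' n k ≡ 0
        zero! = n≤0⇒n≡0 (+-cancelˡ-≤ (end B E.t' n k) _ _
          (≤-trans (≤-reflexive (+-assoc (B n) _ _)) (≤-trans end₊ (≤-reflexive (sym (+-identityʳ _))))))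
        tight : Tight r s (suc n) E.t'
        tight t' e sl = n≮0 (subst (1 ≤_) (trans (cong (λ z → t' z k) (sym index))
          (trans (cong (λ ρ → ρ k) (e ≤-refl)) zero!)) (Slack.diag sl k (subst (_< r) index (s≤s n≤r'))))
      ... | inj₁ A> = inj₁ (E.t' , record
          { index = trans (cong suc index) (sym (+-suc s k)) ; partial = E.partial ; top = top'
          ; prev = inj₂ (k , n , refl , refl , endₖ' , end₊ , mult₊ , A>) })
        where
        B≤A∸ : ∀ {m} → m ≤ R → B s ≤ A n ∸ m
        B≤A∸ {m} m≤R = m+n≤o⇒m≤o∸n (B s) (≤-trans (≤-reflexive (+-comm (B s) m)) (≤-trans (m≤R ⊕ ≤-refl) (<⇒≤ A>)))
        value : ∀ j → mult t n j ≤ R → end B E.t' n (suc j) + mult t n j ≡ A n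
        value j m≤R = trans (cong (_+ mult t n j) (trans (E.new j)
            (trans (cong (A n ⊓ above t n j ⊓_) (m≤n⇒m⊔n≡n (B≤A∸ m≤R)))
              (m≥n⇒m⊓n≡n (⊓-glb (m∸n≤m (A n) (mult t n j)) (m≤n+o⇒m∸n≤o (A n) (mult t n j)
                (≤-trans (above-tail partial j) (≤-reflexive (+-comm _ (mult t n j))))))))))
          (m∸n+n≡m (≤-trans m≤R (≤-trans (m≤m+n R (B s)) (<⇒≤ A>))))
        endₖ' : end B E.t' n k ≡ B s
        endₖ' = trans endₖ (m≥n⇒m⊓n≡n (≤-trans (m≤n+m (B s) R) (<⇒≤ A>)))
        end₊ : end B E.t' n (suc k) + R ≡ A n
        end₊ = trans (cong (end B E.t' n (suc k) +_) (sym top)) (value k (≤-reflexive top))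
        mult₊ : mult E.t' (suc n) k + B s ≡ A n
        mult₊ = trans (cong₂ (λ a b → a + E.t' n k + b) (trans (E.mult-old ≤-refl k) top) (sym endₖ'))
          (trans (arith R (E.t' n k) (B n) (Σ< (E.t' n) k)) end₊)
          where
          arith : ∀ a b c d → a + b + (c + d) ≡ c + (d + b) + a
          arith a b c d = solve (a ∷ b ∷ c ∷ d ∷ [])
        top' : mult E.t' (suc n) (suc k) ≡ R
        top' = trans (cong (_+ E.t' n (suc k)) (E.mult-old ≤-refl (suc k)))
          (arith (mult t n (suc k)) (E.t' n (suc k)) (B n) (Σ< (E.t' n) (suc k)) R (A n) end₊
            (value (suc k) (≤-trans (mult-antiᴾ partial k) (≤-reflexive top))))
          where
          arith : ∀ m x b σ R a → b + σ + R ≡ a → b + (σ + x) + m ≡ a → m + x ≡ R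
          arith m x b σ R a e f = +-cancelˡ-≡ (b + σ) _ _ (trans (trans (shuffle b σ x m) f) (sym e))
            where
            shuffle : ∀ b σ x m → b + σ + (m + x) ≡ b + (σ + x) + m
            shuffle b σ x m = solve (b ∷ σ ∷ x ∷ m ∷ [])

    middle : ∀ d → s + d ≤ r → (∃ λ t → Middle (s + d) d t) ⊎ (∃ λ n → ∃ λ t → n ≤ r × Partial n t × Tight r s n t)
    middle zero    _ with superstandard s
    ... | t , p , e = inj₁ (t , record { index = refl ; partial = subst (λ z → Partial z t) (sym (+-identityʳ s)) p
            ; top = trans (cong (λ z → mult t z 0) (+-identityʳ s)) e ; prev = inj₁ refl })
    middle (suc d) h rewrite +-suc s d with middle d (<⇒≤ h)
    ... | inj₂ x = inj₂ x
    ... | inj₁ (t , mid) with middle-step (≤-pred h) mid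
    ...   | inj₁ x            = inj₁ x
    ...   | inj₂ (t' , p , x) = inj₂ (suc (s + d) , t' , h , p , x)

    module _ {q' : ℕ} (s+q' : r' ≡ s + q') where
      q = suc q'

      r≡s+q : r ≡ s + q
      r≡s+q = trans (cong suc s+q') (sym (+-suc s q'))

      -- The state before row r + n + 1, while all the boxes of the rows from r + 1 on that can
      -- hold the entry q + 1 do so.
      record Lower (M n : ℕ) (t : Array) : Set where
        field
          partial : Partial (r + n) t
          multq'  : mult t (r + n) q' ≡ M
          multq   : mult t (r + n) q ≡ R + width A B r n
          room    : R + width A B r n < M
          cap     : (A (r + n) ⊓ above t (r + n) q ∸ B (r + n)) + width A B r n ≡ width A B r (suc n)

      -- Entry `q + 1` occupies all columns open to it and entry `q` none, so its multiplicity grows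
      -- by the width of the new row while that of `q` stays `M`. Once it reaches `M`, `strict`
      -- fails at `k = q'`.
      lower-step : ∀ {M n t} → Lower M n t →
                   (∃ λ t' → Lower M (suc n) t') ⊎ (∃ λ t' → Partial (suc (r + n)) t' × Tight r s (suc (r + n)) t')
      lower-step {M} {n} {t} low = result
        where
        open Lower low
        m = r + n
        a = A m ⊓ above t m q
        -- The entries `q + 1` of the row fill the columns after `cut` up to `a`; `cut` exceeds
        -- `B m` only if their total would otherwise pass `M`.
        cut = B m ℕ.⊔ (a + mult t m q ∸ M)
        g : ℕ → ℕ
        g j with j <? q
        ... | yes _ = cut
        ... | no  _ = A m
        g-low : ∀ {j} → j < q → g j ≡ cut
        g-low {j} h with j <? q
        ... | yes _ = refl
        ... | no ¬h = ⊥-elim (¬h h)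
        g-high : ∀ {j} → q ≤ j → g j ≡ A m
        g-high {j} h with j <? q
        ... | yes h' = ⊥-elim (<⇒≱ h' h)
        ... | no _   = refl
        B≤a : B m ≤ a
        B≤a = ⊓-glb (B≤A m) (above≥B m t q)
        mq≤M : mult t m q ≤ M
        mq≤M = ≤-trans (≤-reflexive multq) (<⇒≤ room)
        cut≤A : cut ≤ A m
        cut≤A = ⊔-lub (B≤A m) (≤-trans (m≤n+o⇒m∸n≤o (a + mult t m q) M
          (≤-trans (+-monoʳ-≤ a mq≤M) (≤-reflexive (+-comm a M)))) (m⊓n≤m (A m) _))
        q≤m : q ≤ m
        q≤m = ≤-trans (≤-trans (m≤n+m q s) (≤-reflexive (sym r≡s+q))) (m≤m+n r n)
        ext : Extension m t g
        ext = extend partial g g≥B g-mono (≤-reflexive (sym (g-high q≤m))) g-mult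
          where
          g≥B : ∀ j → B m ≤ g j
          g≥B j with j <? q
          ... | yes _ = m≤m⊔n (B m) _
          ... | no _  = B≤A m
          g-mono : ∀ j → g j ≤ g (suc j)
          g-mono j with <-≤-connex (suc j) q
          ... | inj₁ h rewrite g-low (<-trans (n<1+n j) h) | g-low h = ≤-refl
          ... | inj₂ h rewrite g-high h with j <? q
          ...   | yes _ = cut≤A
          ...   | no _  = ≤-refl
          g-mult : ∀ j → A m ⊓ above t m (suc j) ⊓ g (suc j) + mult t m (suc j) ≤ g j + mult t m j
          g-mult j with <-cmp j q'
          ... | tri< h _ _ rewrite g-low (m<n⇒m<1+n h) | g-low (s≤s h) =
                m⊓n≤n (A m ⊓ above t m (suc j)) cut ⊕ mult-antiᴾ partial j
          ... | tri≈ _ refl _ rewrite g-low {q'} ≤-refl = ≤-trans (m⊓n≤m a _ ⊕ ≤-refl)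
                (≤-trans (m≤n+m∸n (a + mult t m q) M) (≤-trans (≤-reflexive (+-comm M _))
                  (m≤n⊔m (B m) _ ⊕ ≤-reflexive (sym multq'))))
          ... | tri> _ _ h rewrite g-high h = ≤-trans (m⊓n≤m _ _) (m⊓n≤m (A m) _) ⊕ mult-antiᴾ partial j
        module E = Extension ext
        endq+ : end B E.t' m (suc q) ≡ a
        endq+ = trans (E.new q) (trans (cong (a ⊓_) (g-high ≤-refl)) (m≤n⇒m⊓n≡m (m⊓n≤m (A m) _)))
        endq : end B E.t' m q ≤ cut
        endq = ≤-trans (≤-reflexive (E.new q')) (≤-trans (m⊓n≤n _ (g q')) (≤-reflexive (g-low ≤-refl)))
        multq+ : mult E.t' (suc m) q ≡ mult t m q + E.t' m q
        multq+ = cong (_+ E.t' m q) (E.mult-old ≤-refl q)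
        result : (∃ λ t' → Lower M (suc n) t') ⊎ (∃ λ t' → Partial (suc (r + n)) t' × Tight r s (suc (r + n)) t')
        result with <-≤-connex (mult t m q + (a ∸ B m)) M
        ... | inj₂ M≤ = inj₂ (E.t' , E.partial , tight)
          where
          cut≡ : cut + M ≡ a + mult t m q
          cut≡ = trans (cong (_+ M) (m≤n⇒m⊔n≡n (m+n≤o⇒m≤o∸n (B m) B+M≤))) (m∸n+n≡m (≤-trans (m≤n+m M (B m)) B+M≤))
            where
            arith : ∀ b d m M a → d + b ≡ a → M ≤ m + d → b + M ≤ a + m
            arith b d m M a refl h = lin 0 h (solve (b ∷ d ∷ m ∷ M ∷ []))
            B+M≤ : B m + M ≤ a + mult t m q
            B+M≤ = arith (B m) (a ∸ B m) (mult t m q) M a (m∸n+n≡m B≤a) M≤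
          reach : M ≤ mult E.t' (suc m) q
          reach = ≤-trans (arith (B m) (Σ< (E.t' m) q) (E.t' m q) a cut M (mult t m q) endq+ endq cut≡) (≤-reflexive (sym multq+))
            where
            arith : ∀ b σ x a c M m → b + (σ + x) ≡ a → b + σ ≤ c → c + M ≡ a + m → M ≤ m + x
            arith b σ x a c M m refl h e = lin 0 (h ⊕ ≤-reflexive e) (solve (b ∷ σ ∷ x ∷ c ∷ M ∷ m ∷ []))
          tight : Tight r s (suc m) E.t'
          tight t' e sl = <⇒≱ (Slack.strict sl m q' (cong suc s+q') (m≤m+n r n))
            (subst₂ _≤_ (sym (trans (mult-agree e (n≤1+n m) q') (trans (E.mult-old ≤-refl q') multq')))
              (sym (mult-agree e ≤-refl q)) reach)
        ... | inj₁ M> = inj₁ (E.t' , record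
            { partial = subst (λ z → Partial z E.t') (sym (+-suc r n)) E.partial
            ; multq' = trans (cong (λ z → mult E.t' z q') (+-suc r n)) (trans (cong₂ _+_ (trans (E.mult-old ≤-refl q') multq') q'-zero) (+-identityʳ M))
            ; multq = trans (cong (λ z → mult E.t' z q) (+-suc r n)) (trans multq+ grow)
            ; room = subst (_< M) (trans (cong (mult t m q +_) (sym q-entry)) grow) M>
            ; cap = cap' })
          where
          endq≡ : end B E.t' m q ≡ B m
          endq≡ = ≤-antisym (≤-trans endq (⊔-lub ≤-refl (m≤n+o⇒m∸n≤o (a + mult t m q) M below))) (m≤m+n (B m) _)
            where
            arith : ∀ b d m M a → d + b ≡ a → m + d < M → a + m ≤ M + b
            arith b d m M a refl h = lin 1 h (solve (b ∷ d ∷ m ∷ M ∷ []))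
            below : a + mult t m q ≤ M + B m
            below = arith (B m) (a ∸ B m) (mult t m q) M a (m∸n+n≡m B≤a) M>
          q'-zero : E.t' m q' ≡ 0
          q'-zero = n≤0⇒n≡0 (+-cancelˡ-≤ (B m + Σ< (E.t' m) q') _ _ (≤-trans (≤-reflexive (trans (+-assoc (B m) _ _) endq≡))
            (≤-trans (m≤m+n (B m) _) (≤-reflexive (sym (+-identityʳ _))))))
          q-entry : E.t' m q ≡ a ∸ B m
          q-entry = trans (sym (m+n∸m≡n (B m) _)) (cong (_∸ B m)
            (trans (cong (_+ E.t' m q) (sym endq≡)) (trans (+-assoc (B m) _ _) endq+)))
          grow : mult t m q + E.t' m q ≡ R + width A B r (suc n)
          grow = trans (cong₂ _+_ multq q-entry) (trans (+-assoc R _ _)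
            (cong (R +_) (trans (+-comm (width A B r n) _) cap)))
          cap' : (A (r + suc n) ⊓ above E.t' (r + suc n) q ∸ B (r + suc n)) + width A B r (suc n) ≡ width A B r (suc (suc n))
          cap' = go (r + suc n) (+-suc r n)
            where
            go : ∀ z → z ≡ suc m → (A z ⊓ above E.t' z q ∸ B z) + width A B r (suc n) ≡ width A B r (suc (suc n))
            go .(suc m) refl = trans (cong (λ e → (A (suc m) ⊓ e ∸ B (suc m)) + width A B r (suc n)) endq≡)
              (trans (+-comm (fresh A B m) _) (+-assoc (A r ∸ B r) _ _))

      lower : ∀ {M t} → Lower M 0 t → ∀ n →
              (∃ λ t' → Lower M n t') ⊎ (∃ λ m → ∃ λ t' → m ≤ r + n × Partial m t' × Tight r s m t')
      lower low zero    = inj₁ (_ , low)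
      lower low (suc n) with lower low n
      ... | inj₂ (m , t' , h , x) = inj₂ (m , t' , ≤-trans h (+-monoʳ-≤ r (n≤1+n n)) , x)
      ... | inj₁ (t , low') with lower-step low'
      ...   | inj₁ x       = inj₁ x
      ...   | inj₂ (t' , x) = inj₂ (suc (r + n) , t' , ≤-reflexive (sym (+-suc r n)) , x)

      -- If row `r + 1` reaches the end of the entries up to `q` of row `r`, the free filling
      -- violates `below`. Otherwise all its boxes can hold `q + 1` and the lower rows are filled
      -- with this entry. They cannot stay below `M` for `N` rows, because `M + B s = A r'` and `W`
      -- bounds this by `B s + R` plus the width.
      tight-lower : ∀ {N t} → Middle r q t → A r' ≤ B s + R + width A B r N →
                    ∃ λ m → ∃ λ t' → m ≤ r + suc N × Partial m t' × Tight r s m t'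
      tight-lower {N} {t} mid W with Middle.prev mid
      ... | inj₂ (.q' , .r' , refl , refl , _ , endq , multq' , room) with <-≤-connex (A r) (end B t r' q)
      ...   | inj₂ h = suc r , E.t' , (≤-trans (s≤s (m≤m+n r N)) (≤-reflexive (sym (+-suc r N)))) , E.partial , tight
        where
        module E = Extension (extendFree (Middle.partial mid))
        tight : Tight r s (suc r) E.t'
        tight t' e sl = <⇒≱ (Slack.below sl r' q refl (≤-reflexive r≡s+q)) (subst₂ _≤_
          (sym (trans (end-agree e (n≤1+n r) q) (E.end-old ≤-refl q)))
          (sym (trans (end-agree e ≤-refl (suc q)) (E.new q)))
          (⊓-glb (⊓-glb h ≤-refl) h))
      ...   | inj₁ h with lower low N
        where
        low : Lower (mult t r q') 0 t
        low = record
          { partial = subst (λ z → Partial z t) (sym (+-identityʳ r)) (Middle.partial mid)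
          ; multq' = cong (λ z → mult t z q') (+-identityʳ r)
          ; multq = trans (cong (λ z → mult t z q) (+-identityʳ r)) (trans (Middle.top mid) (sym (+-identityʳ R)))
          ; room = +-cancelʳ-< (B s) _ _ (subst₂ _<_ (cong (_+ B s) (sym (+-identityʳ R))) (sym multq') room)
          ; cap = cap₀ }
          where
          cap₀ : (A (r + 0) ⊓ above t (r + 0) q ∸ B (r + 0)) + 0 ≡ A r ∸ B r + 0
          cap₀ rewrite +-identityʳ r' | m≤n⇒m⊓n≡m (<⇒≤ h) = refl
      ...     | inj₂ (m , t' , m≤ , x) = m , t' , ≤-trans m≤ (+-monoʳ-≤ r (n≤1+n N)) , x
      ...     | inj₁ (t' , low') = ⊥-elim (<⇒≱ (arith (Lower.room low') multq') W)
        where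
        arith : ∀ {w m b a R} → R + w < m → m + b ≡ a → b + R + w < a
        arith {w} {m} {b} {a} {R} h refl = lin 0 h (solve (w ∷ m ∷ b ∷ R ∷ []))

    tight-exists : ∀ {N} → (∀ i → N ≤ i → A i ≡ 0) → r ≤ N → A r' ≤ B s + R + width A B r N →
                   ∃ λ t → LR A B t × ¬ Slack r s B t
    tight-exists {N} A≡0 r≤N W with middle (suc (r' ∸ s)) (≤-reflexive s+q)
      where
      s+q : s + suc (r' ∸ s) ≡ r
      s+q = trans (+-suc s (r' ∸ s)) (cong suc (m+[n∸m]≡n s≤r'))
    ... | inj₂ (n , t , n≤r , p , x) = finish (≤-trans n≤r r≤N) A≡0 p x
    ... | inj₁ (t , mid) with tight-lower (sym (m+[n∸m]≡n s≤r')) (subst (λ z → Middle z (suc (r' ∸ s)) t)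
            (trans (+-suc s (r' ∸ s)) (cong suc (m+[n∸m]≡n s≤r'))) mid) W
    ...   | m , t' , m≤ , p , x = finish m≤ (λ i h → A≡0 i (≤-trans (m≤n+m N r) (≤-trans (+-monoʳ-≤ r (n≤1+n N)) h))) p x

-- Insertion of a column

Vanishes : ℕ → (ℕ → ℕ) → Set
Vanishes N f = ∀ i → N ≤ i → f i ≡ 0

record IsColumn (N : ℕ) (u : Column) : Set where
  constructor isColumn
  field
    s≤r : proj₂ u ≤ proj₁ u
    1≤r : 1 ≤ proj₁ u
    r≤N : proj₁ u ≤ N

-- The column u can be inserted without creating new tableaux, with e to spare.
record Neutral (e N : ℕ) (A B : ℕ → ℕ) (u : Column) : Set where
  constructor neutral
  private
    r = proj₁ u
    s = proj₂ u
  field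
    thick : s < r → e + (B s + width A B 0 s + width A B r N) ≤ A (pred r)
    thin  : s ≡ r → e + A r ≤ B (pred r)

lt-mono : ∀ i {s r} → s ≤ r → lt i s ≤ lt i r
lt-mono i {s} {r} s≤r with <-≤-connex i s
... | inj₁ i<s rewrite lt-yes i<s | lt-yes (<-≤-trans i<s s≤r) = ≤-refl
... | inj₂ s≤i rewrite lt-no s≤i = z≤n

Skew-+ : ∀ {A B} u → proj₂ u ≤ proj₁ u → Skew A B → Skew (A +ᴬ u) (B +ᴮ u)
Skew-+ (r , s) s≤r sk = record
  { A↓ = λ i → A↓ i ⊕ lt-suc-≤ i r ; B↓ = λ i → B↓ i ⊕ lt-suc-≤ i s ; B≤A = λ i → B≤A i ⊕ lt-mono i s≤r }
  where open Skew sk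

Vanishes-+ : ∀ {N A} u → proj₁ u ≤ N → Vanishes N A → Vanishes N (A +ᴬ u)
Vanishes-+ u r≤N v i N≤i rewrite v i N≤i = lt-no (≤-trans r≤N N≤i)

∸-cancel-+ : ∀ m n o → m + o ∸ (n + o) ≡ m ∸ n
∸-cancel-+ m n o = trans (cong₂ _∸_ (+-comm m o) (+-comm n o)) ([m+n]∸[m+o]≡n∸o o m n)

fresh-shift : ∀ a b c → (a + 1) ⊓ (b + 1) ∸ (c + 1) ≡ a ⊓ b ∸ c
fresh-shift a b c = trans (cong (_∸ (c + 1)) (sym (+-distribʳ-⊓ 1 a b))) (∸-cancel-+ (a ⊓ b) c 1)

module _ (A B : ℕ → ℕ) {r s : ℕ} (s≤r : s ≤ r) where
  private
    u = (r , s)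
    A⁺ = A +ᴬ u
    B⁺ = B +ᴮ u

  fresh-below : ∀ i → r ≤ i → fresh A⁺ B⁺ i ≡ fresh A B i
  fresh-below i r≤i rewrite lt-no (m≤n⇒m≤1+n r≤i) | lt-no (≤-trans s≤r r≤i) | lt-no (m≤n⇒m≤1+n (≤-trans s≤r r≤i))
    | +-identityʳ (A (suc i)) | +-identityʳ (B i) | +-identityʳ (B (suc i)) = refl

  fresh-above : ∀ i → suc i < s → fresh A⁺ B⁺ i ≡ fresh A B i
  fresh-above i h rewrite lt-yes (<-≤-trans h s≤r) | lt-yes (<-trans (n<1+n i) h) | lt-yes h =
    fresh-shift (A (suc i)) (B i) (B (suc i))

  width-below : ∀ a n → r ≤ a → width A⁺ B⁺ a n ≡ width A B a n
  width-below a zero    h = refl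
  width-below a (suc n) h rewrite lt-no h | lt-no (≤-trans s≤r h) | +-identityʳ (A a) | +-identityʳ (B a) =
    cong (A a ∸ B a +_) (Σ<-cong n (λ j _ → fresh-below (a + j) (≤-trans h (m≤m+n a j))))

  width-above : ∀ a n → a + n ≤ s → width A⁺ B⁺ a n ≡ width A B a n
  width-above a zero    h = refl
  width-above a (suc n) h = cong₂ _+_
    (trans (cong₂ (λ x y → A a + x ∸ (B a + y)) (lt-yes (<-≤-trans a<s s≤r)) (lt-yes a<s)) (∸-cancel-+ (A a) (B a) 1))
    (Σ<-cong n (λ j j<n → fresh-above (a + j) (<-≤-trans (s≤s (≤-trans (≤-reflexive (sym (+-suc a j))) (+-monoʳ-≤ a j<n)))
      (≤-trans (≤-reflexive (sym (+-suc a n))) h))))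
    where
    a<s : a < s
    a<s = ≤-trans (≤-trans (≤-reflexive (+-comm 1 a)) (+-monoʳ-≤ a (s≤s z≤n))) h

  suc-∸-≤ : ∀ m n → suc m ∸ n ≤ suc (m ∸ n)
  suc-∸-≤ m n = m≤n+o⇒m∸n≤o (suc m) n (≤-trans (s≤s (m≤n+m∸n m n)) (≤-reflexive (sym (+-suc n _))))

  module _ (s<r : s < r) (gap : ∀ i → s ≤ i → suc i < r → B i ≤ A (suc i)) where

    -- The inserted column can be fresh only in its top row `s + 1`: further down `gap` makes `B i`
    -- the minimum, and that is unchanged. The indicators on both sides are placed so that the
    -- bounds telescope in `width-insert`.
    fresh-insert : ∀ i → fresh A⁺ B⁺ i + lt s (suc i) ≤ fresh A B i + lt s (suc (suc i))
    fresh-insert i with <-cmp (suc i) s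
    ... | tri< h _ _ rewrite fresh-above i h | lt-no (<⇒≤ h) | lt-no h = ≤-refl
    ... | tri≈ _ refl _ rewrite lt-yes s<r | lt-yes (n<1+n i) | lt-no {suc i} {suc i} ≤-refl
      | +-identityʳ (B (suc i)) | +-identityʳ ((A (suc i) + 1) ⊓ (B i + 1) ∸ B (suc i))
      | sym (+-distribʳ-⊓ 1 (A (suc i)) (B i)) | +-comm (A (suc i) ⊓ B i) 1 | +-comm (A (suc i) ⊓ B i ∸ B (suc i)) 1 =
        suc-∸-≤ (A (suc i) ⊓ B i) (B (suc i))
    ... | tri> _ _ (s≤s h) rewrite lt-no h | lt-no (m≤n⇒m≤1+n h) | lt-yes (s≤s h) | lt-yes (s≤s (m≤n⇒m≤1+n h))
      | +-identityʳ (B i) | +-identityʳ (B (suc i)) with <-≤-connex (suc i) r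
    ...   | inj₂ g rewrite lt-no g | +-identityʳ (A (suc i)) = ≤-refl
    ...   | inj₁ g rewrite lt-yes g | m≥n⇒m⊓n≡n (gap i h g) | m≥n⇒m⊓n≡n (≤-trans (gap i h g) (m≤m+n (A (suc i)) 1)) = ≤-refl

    width-insert : ∀ a n → width A⁺ B⁺ a n ≤ width A B a n + lt s (a + n)
    width-insert a zero = z≤n
    width-insert a (suc zero) with <-≤-connex a s
    ... | inj₁ h rewrite lt-yes h | lt-yes (<-≤-trans h s≤r) | ∸-cancel-+ (A a) (B a) 1 = m≤m+n _ _
    ... | inj₂ h rewrite lt-no h | +-identityʳ (B a) | +-comm a 1 | lt-yes (s≤s h) | +-identityʳ (A a ∸ B a)
      | +-identityʳ (A a + lt a r ∸ B a) = ≤-trans (∸-monoˡ-≤ (B a) (+-monoʳ-≤ (A a) (lt≤1 a r)))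
          (≤-trans (≤-reflexive (cong (_∸ B a) (+-comm (A a) 1))) (≤-trans (suc-∸-≤ (A a) (B a)) (≤-reflexive (+-comm 1 _))))
    width-insert a (suc (suc n)) = arith (A⁺ a ∸ B⁺ a) (Σ< (λ j → fresh A⁺ B⁺ (a + j)) n) (fresh A⁺ B⁺ (a + n))
        (A a ∸ B a) (Σ< (λ j → fresh A B (a + j)) n) (fresh A B (a + n)) (lt s (a + suc n)) (lt s (a + suc (suc n)))
        (width-insert a (suc n))
        (subst₂ (λ x y → fresh A⁺ B⁺ (a + n) + lt s x ≤ fresh A B (a + n) + lt s y) (sym (+-suc a n))
          (sym (trans (+-suc a (suc n)) (cong suc (+-suc a n)))) (fresh-insert (a + n)))
      where
      arith : ∀ a b c a' b' c' x y → a + b ≤ a' + b' + x → c + x ≤ c' + y → a + (b + c) ≤ a' + (b' + c') + y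
      arith a b c a' b' c' x y h g = lin 0 (h ⊕ g) (solve (a ∷ b ∷ c ∷ a' ∷ b' ∷ c' ∷ x ∷ y ∷ []))

-- Only the transition from row `r` to row `r + 1` sees the empty column, and there the minimum is
-- `A r` both before and after the insertion.
width-insert-empty : ∀ A B {r} → (∀ i → suc i ≡ r → A r ≤ B i) → ∀ a n →
                     width (A +ᴬ (r , r)) (B +ᴮ (r , r)) a n ≤ width A B a n
width-insert-empty A B {r} h a zero    = z≤n
width-insert-empty A B {r} h a (suc n) rewrite ∸-cancel-+ (A a) (B a) (lt a r) =
  +-monoʳ-≤ (A a ∸ B a) (Σ<-mono-≤ n (λ j _ → new (a + j)))
  where
  new : ∀ i → fresh (A +ᴬ (r , r)) (B +ᴮ (r , r)) i ≤ fresh A B i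
  new i with <-cmp (suc i) r
  ... | tri< g _ _ = ≤-reflexive (fresh-above A B ≤-refl i g)
  ... | tri> _ _ (s≤s g) = ≤-reflexive (fresh-below A B ≤-refl i g)
  ... | tri≈ _ refl _ rewrite lt-no {suc i} {suc i} ≤-refl | lt-yes (n<1+n i) | +-identityʳ (B (suc i)) | +-identityʳ (A (suc i))
    | m≤n⇒m⊓n≡m (h i refl) | m≤n⇒m⊓n≡m (≤-trans (h i refl) (m≤m+n (B i) 1)) = ≤-refl

width-mono : ∀ A B a {m n} → m ≤ n → width A B a m ≤ width A B a n
width-mono A B a {zero}          _         = z≤n
width-mono A B a {suc m} {suc n} (s≤s m≤n) = +-monoʳ-≤ (A a ∸ B a) (Σ<-extend _ m≤n)

width-bounded : ∀ {A B N} → Vanishes N A → ∀ r n → width A B (suc r) n ≤ width A B (suc r) N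
width-bounded {A} {B} {N} v r zero = z≤n
width-bounded {A} {B} {N} v r (suc n) with ≤-total (suc n) N
... | inj₁ h = width-mono A B (suc r) h
width-bounded {A} {B} {zero} v r (suc n) | inj₂ h rewrite v (suc r) z≤n | 0∸n≡0 (B (suc r)) =
  ≤-reflexive (Σ<-zero n (λ j _ → trans (cong (λ z → z ⊓ B (suc (r + j)) ∸ B (suc (suc (r + j)))) (v (suc (suc (r + j))) z≤n)) (0∸n≡0 (B (suc (suc (r + j)))))))
width-bounded {A} {B} {suc N} v r (suc n) | inj₂ (s≤s h) =
  +-monoʳ-≤ (A (suc r) ∸ B (suc r)) (≤-reflexive (Σ<-stable _ h (λ j N≤j →
    trans (cong (λ z → z ⊓ B (suc (r + j)) ∸ B (suc (suc (r + j)))) (v (suc (suc (r + j))) (s≤s (m≤n⇒m≤1+n (≤-trans N≤j (m≤n+m j r))))))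
      (0∸n≡0 (B (suc (suc (r + j))))))))

module _ {N : ℕ} {A B : ℕ → ℕ} (sk : Skew A B) (v : Vanishes N A) where
  open Skew sk

  -- `Slack` refers to the enlarged shape. There `A r'` has grown by one while `B s` and both widths
  -- are unchanged, which turns the weak inequality of `Neutral` into the strict hypothesis of
  -- `slack`. For an empty column it is `B r'` that has grown.
  remove : ∀ {u} → IsColumn N u → Neutral 0 N A B u → ∀ {t} → LR (A +ᴬ u) (B +ᴮ u) t →
           ∃ λ t' → LR A B t' × (t' +ᵀ u) ≗₂ t
  remove {suc r' , s} (isColumn s≤r _ r≤N) (neutral ok ok₀) {t} l = LR-∸ s≤r l sl
    where
    u = (suc r' , s)
    sk⁺ = Skew-+ u s≤r sk
    sl : Slack (suc r') s (B +ᴮ u) t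
    sl with m≤n⇒m<n∨m≡n s≤r
    ... | inj₁ (s≤s s≤r') = slack sk⁺ l s≤r' W
      where
      W : ∀ n → (B +ᴮ u) s + width (A +ᴬ u) (B +ᴮ u) 0 s + width (A +ᴬ u) (B +ᴮ u) (suc r') n < (A +ᴬ u) r'
      W n rewrite width-above A B s≤r 0 s ≤-refl | width-below A B s≤r (suc r') n ≤-refl
        | lt-no {s} {s} ≤-refl | lt-yes (n<1+n r') | +-identityʳ (B s) | +-comm (A r') 1 =
        s≤s (≤-trans (+-monoʳ-≤ (B s + width A B 0 s) (width-bounded v r' n)) (ok (s≤s s≤r')))
    ... | inj₂ refl = record
      { diag = λ k h → ⊥-elim (<⇒≱ h (m≤m+n (suc r') k))
      ; below = below
      ; strict = λ i k e _ → ⊥-elim (<-irrefl e (s≤s (m≤m+n (suc r') k))) }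
      where
      below : ∀ i k → suc r' ≡ suc i → suc r' ≤ suc r' + k → end (B +ᴮ u) t (suc i) (suc k) < end (B +ᴮ u) t i k
      below .r' k refl _ = begin-strict
        end (B +ᴮ u) t (suc r') (suc k)  ≤⟨ end≤A l (suc r') (suc k) ⟩
        A (suc r') + lt (suc r') (suc r') ≡⟨ trans (cong (A (suc r') +_) (lt-no {suc r'} {suc r'} ≤-refl)) (+-identityʳ _) ⟩
        A (suc r')                       ≤⟨ ok₀ refl ⟩
        B r'                             <⟨ ≤-reflexive (trans (+-comm 1 (B r')) (cong (B r' +_) (sym (lt-yes (n<1+n r'))))) ⟩
        B r' + lt r' (suc r')            ≤⟨ m≤m+n _ _ ⟩
        end (B +ᴮ u) t r' k              ∎
        where open ≤-Reasoning

  -- The negated criterion is the input of the greedy fillings; by `slack-+` a tableau without slack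
  -- does not come from the smaller shape.
  neutral⊎new : ∀ {u} → IsColumn N u → Neutral 0 N A B u ⊎
                (∃ λ t → LR (A +ᴬ u) (B +ᴮ u) t × (∀ t' → LR A B t' → ¬ ((t' +ᵀ u) ≗₂ t)))
  neutral⊎new {suc r' , s} (isColumn s≤r _ r≤N) = result
    where
    u = (suc r' , s)
    sk⁺ = Skew-+ u s≤r sk
    v⁺ : Vanishes N (A +ᴬ u)
    v⁺ = Vanishes-+ u r≤N v
    new : (∃ λ t → LR (A +ᴬ u) (B +ᴮ u) t × ¬ Slack (suc r') s (B +ᴮ u) t) →
          ∃ λ t → LR (A +ᴬ u) (B +ᴮ u) t × (∀ t' → LR A B t' → ¬ ((t' +ᵀ u) ≗₂ t))
    new (t , l , tight) = t , l , λ t' l' e → tight (slack-resp e (slack-+ s≤r l'))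
    result : Neutral 0 N A B u ⊎
             (∃ λ t → LR (A +ᴬ u) (B +ᴮ u) t × (∀ t' → LR A B t' → ¬ ((t' +ᵀ u) ≗₂ t)))
    result with m≤n⇒m<n∨m≡n s≤r
    ... | inj₁ (s≤s s≤r') with ≤-<-connex (B s + width A B 0 s + width A B (suc r') N) (A r')
    ...   | inj₁ ok = inj₁ (neutral (λ _ → ok) (λ e → ⊥-elim (<-irrefl e (s≤s s≤r'))))
    ...   | inj₂ bad = inj₂ (new (Tightness.tight-exists sk⁺ s≤r' v⁺ r≤N W))
      where
      W : (A +ᴬ u) r' ≤ (B +ᴮ u) s + width (A +ᴬ u) (B +ᴮ u) 0 s + width (A +ᴬ u) (B +ᴮ u) (suc r') N
      W rewrite width-above A B s≤r 0 s ≤-refl | width-below A B s≤r (suc r') N ≤-refl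
        | lt-no {s} {s} ≤-refl | lt-yes (n<1+n r') | +-identityʳ (B s) | +-comm (A r') 1 = bad
    result | inj₂ refl with ≤-<-connex (A (suc r')) (B r')
    ...   | inj₁ ok = inj₁ (neutral (λ h → ⊥-elim (<-irrefl refl h)) (λ _ → ok))
    ...   | inj₂ bad = inj₂ (new (Tightness.tight-empty sk⁺ r≤N v⁺ W))
      where
      W : (B +ᴮ u) r' ≤ (A +ᴬ u) (suc r')
      W rewrite lt-no {suc r'} {suc r'} ≤-refl | lt-yes (n<1+n r') | +-identityʳ (A (suc r')) | +-comm (B r') 1 = bad

-- Neither of u and v is strictly staggered with respect to the other, also if one of them is empty.
record Compatible (u v : Column) : Set where
  field
    nested : proj₂ u < proj₁ u → proj₂ v < proj₁ v → proj₂ u ≡ proj₂ v ⊎ proj₁ u ≡ proj₁ v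
    emptyᵛ : proj₂ u < proj₁ u → proj₂ v ≡ proj₁ v → proj₁ v ≤ proj₂ u ⊎ proj₁ u ≤ proj₁ v
    emptyᵘ : proj₂ u ≡ proj₁ u → proj₁ u ≤ proj₂ v ⊎ proj₁ v ≤ proj₁ u

suc-pred′ : ∀ {n} → 1 ≤ n → suc (pred n) ≡ n
suc-pred′ {suc n} _ = refl

balance : ∀ e b w₀ w₁ a b⁺ w₀⁺ w₁⁺ a⁺ x y z d → e + (b + w₀ + w₁) ≤ a → b⁺ ≤ b + x → w₀⁺ ≤ w₀ + y → w₁⁺ ≤ w₁ + z →
          a + d ≤ a⁺ → x + y + z ≤ d → e + (b⁺ + w₀⁺ + w₁⁺) ≤ a⁺
balance e b w₀ w₁ a b⁺ w₀⁺ w₁⁺ a⁺ x y z d h₁ h₂ h₃ h₄ h₅ h₆ = lin 0 (h₁ ⊕ h₂ ⊕ h₃ ⊕ h₄ ⊕ h₅ ⊕ h₆)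
  (solve (e ∷ b ∷ w₀ ∷ w₁ ∷ a ∷ b⁺ ∷ w₀⁺ ∷ w₁⁺ ∷ a⁺ ∷ x ∷ y ∷ z ∷ d ∷ []))

-- Inserting `v` raises the left side of the criterion of `u` by at most one, and only if `v`
-- reaches down to row `r`, where the right side is raised too. With a common top only the lower
-- width can grow, with a common bottom only one of `B s` and the upper width. For staggered
-- columns, `s < s' < r < r'`, both `B s` and the lower width could grow.
neutral-persists : ∀ {N A B e u v} → Skew A B → IsColumn N u → IsColumn N v → Compatible u v →
                   Neutral 0 N A B v → Neutral e N A B u → Neutral e N (A +ᴬ v) (B +ᴮ v) u
neutral-persists {N} {A} {B} {e} {r , s} {r' , s'} sk (isColumn s≤r 1≤r _) (isColumn s'≤r' 1≤r' _) comp okᵛ okᵘ =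
  neutral thick thin
  where
  open Skew sk
  open Compatible comp
  v = (r' , s')
  A⁺ = A +ᴬ v
  B⁺ = B +ᴮ v
  -- The criterion for `v` itself shows that successive rows met by `v` overlap, as `width-insert`
  -- requires.
  gap : s' < r' → ∀ i → s' ≤ i → suc i < r' → B i ≤ A (suc i)
  gap h i s'≤i i<r' = ≤-trans (antitone B↓ s'≤i) (≤-trans (≤-trans (m≤m+n (B s') _) (m≤m+n _ (width A B r' N)))
    (≤-trans (Neutral.thick okᵛ h) (antitone A↓ (≤-pred (subst (suc (suc i) ≤_) (sym (suc-pred′ 1≤r')) i<r')))))
  inside : r ≤ r' → lt (pred r) r' ≡ 1
  inside h = lt-yes (subst (_≤ r') (sym (suc-pred′ 1≤r)) h)
  combine : ∀ s r x y z d → e + (B s + width A B 0 s + width A B r N) ≤ A (pred r) → B⁺ s ≤ B s + x →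
            width A⁺ B⁺ 0 s ≤ width A B 0 s + y → width A⁺ B⁺ r N ≤ width A B r N + z →
            A (pred r) + d ≤ A⁺ (pred r) → x + y + z ≤ d → e + (B⁺ s + width A⁺ B⁺ 0 s + width A⁺ B⁺ r N) ≤ A⁺ (pred r)
  combine s r x y z d = balance e (B s) (width A B 0 s) (width A B r N) (A (pred r)) (B⁺ s) (width A⁺ B⁺ 0 s)
    (width A⁺ B⁺ r N) (A⁺ (pred r)) x y z d
  ≤+0 : ∀ {a b} → a ≤ b → a ≤ b + 0
  ≤+0 {a} {b} h = subst (a ≤_) (sym (+-identityʳ b)) h
  thick : s < r → e + (B⁺ s + width A⁺ B⁺ 0 s + width A⁺ B⁺ r N) ≤ A⁺ (pred r)
  thick s<r with m≤n⇒m<n∨m≡n s'≤r'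
  ... | inj₁ s'<r' with nested s<r s'<r'
  ...   | inj₁ refl with ≤-<-connex r' r
  ...     | inj₁ r'≤r = combine s r 0 0 0 (lt (pred r) r') (Neutral.thick okᵘ s<r) (≤-reflexive (cong (B s +_) (lt-no {s} {s} ≤-refl)))
              (≤+0 (≤-reflexive (width-above A B s'≤r' 0 s ≤-refl))) (≤+0 (≤-reflexive (width-below A B s'≤r' r N r'≤r)))
              ≤-refl z≤n
  ...     | inj₂ r<r' = combine s r 0 0 1 1 (Neutral.thick okᵘ s<r) (≤-reflexive (cong (B s +_) (lt-no {s} {s} ≤-refl)))
              (≤+0 (≤-reflexive (width-above A B s'≤r' 0 s ≤-refl)))
              (≤-trans (width-insert A B s'≤r' s'<r' (gap s'<r') r N) (+-monoʳ-≤ (width A B r N) (lt≤1 s (r + N))))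
              (≤-reflexive (cong (A (pred r) +_) (sym (inside (<⇒≤ r<r'))))) ≤-refl
  thick s<r | inj₁ s'<r' | inj₂ refl = combine s r (lt s s') (lt s' s) 0 1 (Neutral.thick okᵘ s<r) ≤-refl
      (width-insert A B s'≤r' s'<r' (gap s'<r') 0 s) (≤+0 (≤-reflexive (width-below A B s'≤r' r N ≤-refl)))
      (≤-reflexive (cong (A (pred r) +_) (sym (inside ≤-refl)))) (≤-trans (≤-reflexive (+-identityʳ _)) (one s s'))
    where
    one : ∀ i j → lt i j + lt j i ≤ 1
    one zero    zero    = z≤n
    one zero    (suc j) = ≤-refl
    one (suc i) zero    = ≤-refl
    one (suc i) (suc j) = one i j
  thick s<r | inj₂ refl with emptyᵛ s<r refl
  ...   | inj₁ r'≤s = combine s r 0 0 0 (lt (pred r) r') (Neutral.thick okᵘ s<r) (≤-reflexive (cong (B s +_) (lt-no r'≤s)))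
            (≤+0 (shrink 0 s)) (≤+0 (shrink r N)) ≤-refl z≤n
    where
    shrink : ∀ a n → width A⁺ B⁺ a n ≤ width A B a n
    shrink = width-insert-empty A B {r'} (λ { i refl → Neutral.thin okᵛ refl })
  ...   | inj₂ r≤r' = combine s r 1 0 0 1 (Neutral.thick okᵘ s<r) (+-monoʳ-≤ (B s) (lt≤1 s r'))
            (≤+0 (shrink 0 s)) (≤+0 (shrink r N)) (≤-reflexive (cong (A (pred r) +_) (sym (inside r≤r')))) ≤-refl
    where
    shrink : ∀ a n → width A⁺ B⁺ a n ≤ width A B a n
    shrink = width-insert-empty A B {r'} (λ { i refl → Neutral.thin okᵛ refl })
  thin : s ≡ r → e + A⁺ r ≤ B⁺ (pred r)
  thin refl with emptyᵘ refl
  ... | inj₁ r≤s' rewrite lt-yes (subst (_≤ s') (sym (suc-pred′ 1≤r)) r≤s') =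
        ≤-trans (≤-reflexive (sym (+-assoc e (A r) (lt r r')))) (Neutral.thin okᵘ refl ⊕ lt≤1 r r')
  ... | inj₂ r'≤r rewrite lt-no r'≤r | +-identityʳ (A r) = ≤-trans (Neutral.thin okᵘ refl) (m≤m+n _ _)

-- A column leaves the left side of its own criterion alone and raises the right side. This gain is
-- what makes Q stabilise.
neutral-increases : ∀ {N A B e u} → IsColumn N u → Neutral e N A B u → Neutral (suc e) N (A +ᴬ u) (B +ᴮ u) u
neutral-increases {N} {A} {B} {e} {r , s} (isColumn s≤r 1≤r _) ok = neutral thick thin
  where
  top : lt (pred r) r ≡ 1
  top = lt-yes (≤-reflexive (suc-pred′ 1≤r))
  thick : s < r → suc e + (B s + lt s s + width (A +ᴬ (r , s)) (B +ᴮ (r , s)) 0 s + width (A +ᴬ (r , s)) (B +ᴮ (r , s)) r N) ≤ A (pred r) + lt (pred r) r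
  thick h rewrite top | lt-no {s} {s} ≤-refl | +-identityʳ (B s) | width-above A B s≤r 0 s ≤-refl | width-below A B s≤r r N ≤-refl
    | +-comm (A (pred r)) 1 = s≤s (Neutral.thick ok h)
  thin : s ≡ r → suc e + (A r + lt r r) ≤ B (pred r) + lt (pred r) s
  thin refl rewrite top | lt-no {r} {r} ≤-refl | +-identityʳ (A r) | +-comm (B (pred r)) 1 = s≤s (Neutral.thin ok refl)

width-cong : ∀ {A A' B B'} → (∀ i → A i ≡ A' i) → (∀ i → B i ≡ B' i) → ∀ a n → width A B a n ≡ width A' B' a n
width-cong a b c zero    = refl
width-cong a b c (suc n) = cong₂ _+_ (cong₂ _∸_ (a c) (b c))
  (Σ<-cong n (λ j _ → cong₂ _∸_ (cong₂ _⊓_ (a _) (b _)) (b _)))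

Neutral-resp : ∀ {e N A A' B B' u} → (∀ i → A i ≡ A' i) → (∀ i → B i ≡ B' i) → Neutral e N A B u → Neutral e N A' B' u
Neutral-resp {e} {N} {u = r , s} a b (neutral thick thin) = neutral
  (λ h → subst₂ _≤_ (cong (e +_) (cong₂ _+_ (cong₂ _+_ (b s) (width-cong a b 0 s)) (width-cong a b r N))) (a (pred r)) (thick h))
  (λ h → subst₂ _≤_ (cong (e +_) (a r)) (b (pred r)) (thin h))

Skew-resp : ∀ {A A' B B'} → (∀ i → A i ≡ A' i) → (∀ i → B i ≡ B' i) → Skew A B → Skew A' B'
Skew-resp a b sk = record
  { A↓ = λ i → subst₂ _≤_ (a (suc i)) (a i) (Skew.A↓ sk i)
  ; B↓ = λ i → subst₂ _≤_ (b (suc i)) (b i) (Skew.B↓ sk i)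
  ; B≤A = λ i → subst₂ _≤_ (b i) (a i) (Skew.B≤A sk i) }

-- Insertion of several columns

sumᴬ sumᴮ : List Column → ℕ → ℕ
sumᴬ w i = sum (map (λ u → lt i (proj₁ u)) w)
sumᴮ w i = sum (map (λ u → lt i (proj₂ u)) w)

sumᵀ : List Column → Array
sumᵀ w i k = sum (map (λ u → col u i k) w)

infixl 6 _⊞ᶠ_ _⊞ᵀ_
_⊞ᶠ_ : (ℕ → ℕ) → (ℕ → ℕ) → ℕ → ℕ
(f ⊞ᶠ g) i = f i + g i

_⊞ᵀ_ : Array → Array → Array
(t ⊞ᵀ t') i k = t i k + t' i k

assocᴬ : ∀ A u w i → (A +ᴬ u ⊞ᶠ sumᴬ w) i ≡ (A ⊞ᶠ sumᴬ (u ∷ w)) i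
assocᴬ A u w i = +-assoc (A i) _ _

assocᴮ : ∀ B u w i → (B +ᴮ u ⊞ᶠ sumᴮ w) i ≡ (B ⊞ᶠ sumᴮ (u ∷ w)) i
assocᴮ B u w i = +-assoc (B i) _ _

assocᵀ : ∀ t u w → ((t +ᵀ u) ⊞ᵀ sumᵀ w) ≗₂ (t ⊞ᵀ sumᵀ (u ∷ w))
assocᵀ t u w i k = +-assoc (t i k) _ _

module Columns {N : ℕ} (E : List Column) (isCol : ∀ {u} → u ∈ E → IsColumn N u)
               (compat : ∀ {u v} → u ∈ E → v ∈ E → Compatible u v) where

  AllNeutral : (ℕ → ℕ) → (ℕ → ℕ) → Set
  AllNeutral A B = ∀ {u} → u ∈ E → Neutral 0 N A B u

  AllNeutral-+ : ∀ {A B v} → Skew A B → v ∈ E → AllNeutral A B → AllNeutral (A +ᴬ v) (B +ᴮ v)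
  AllNeutral-+ sk v∈ ok u∈ = neutral-persists sk (isCol u∈) (isCol v∈) (compat u∈ v∈) (ok v∈) (ok u∈)

  neutral-⊞ : ∀ {A B} w → (∀ {u} → u ∈ w → u ∈ E) → Skew A B → AllNeutral A B → ∀ {e u} → u ∈ E → Neutral e N A B u →
              Neutral e N (A ⊞ᶠ sumᴬ w) (B ⊞ᶠ sumᴮ w) u
  neutral-⊞ {A} {B} []      w⊆E sk ok u∈ n = Neutral-resp (λ i → sym (+-identityʳ (A i))) (λ i → sym (+-identityʳ (B i))) n
  neutral-⊞ {A} {B} (v ∷ w) w⊆E sk ok u∈ n = Neutral-resp (assocᴬ A v w) (assocᴮ B v w)
    (neutral-⊞ w (λ x → w⊆E (there x)) (Skew-+ v (IsColumn.s≤r (isCol v∈)) sk) (AllNeutral-+ sk v∈ ok) u∈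
      (neutral-persists sk (isCol u∈) (isCol v∈) (compat u∈ v∈) (ok v∈) n))
    where v∈ = w⊆E (here refl)

  -- Every column gains one from its own insertion and loses nothing through the others.
  neutral-⊞-strict : ∀ {A B} w → (∀ {u} → u ∈ w → u ∈ E) → Skew A B → AllNeutral A B → ∀ {u} → u ∈ w →
                     Neutral 1 N (A ⊞ᶠ sumᴬ w) (B ⊞ᶠ sumᴮ w) u
  neutral-⊞-strict {A} {B} (v ∷ w) w⊆E sk ok u∈ = Neutral-resp (assocᴬ A v w) (assocᴮ B v w) (go u∈)
    where
    v∈ = w⊆E (here refl)
    sk⁺ = Skew-+ v (IsColumn.s≤r (isCol v∈)) sk
    go : ∀ {u} → u ∈ v ∷ w → Neutral 1 N (A +ᴬ v ⊞ᶠ sumᴬ w) (B +ᴮ v ⊞ᶠ sumᴮ w) u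
    go (here refl) = neutral-⊞ w (λ x → w⊆E (there x)) sk⁺ (AllNeutral-+ sk v∈ ok) v∈ (neutral-increases (isCol v∈) (ok v∈))
    go (there u∈)  = neutral-⊞-strict w (λ x → w⊆E (there x)) sk⁺ (AllNeutral-+ sk v∈ ok) u∈

  LR-⊞ : ∀ {A B t} w → (∀ {u} → u ∈ w → u ∈ E) → LR A B t → LR (A ⊞ᶠ sumᴬ w) (B ⊞ᶠ sumᴮ w) (t ⊞ᵀ sumᵀ w)
  LR-⊞ {A} {B} {t} []      w⊆E l = LR-resp (λ i → sym (+-identityʳ (A i))) (λ i → sym (+-identityʳ (B i)))
    (λ i k → sym (+-identityʳ (t i k))) l
  LR-⊞ {A} {B} {t} (u ∷ w) w⊆E l = LR-resp (assocᴬ A u w) (assocᴮ B u w) (assocᵀ t u w)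
    (LR-⊞ w (λ x → w⊆E (there x)) (LR-+ u (IsColumn.s≤r (isCol (w⊆E (here refl)))) l))

  remove-⊞ : ∀ {A B} w → (∀ {u} → u ∈ w → u ∈ E) → Skew A B → Vanishes N A → AllNeutral A B →
             ∀ {t} → LR (A ⊞ᶠ sumᴬ w) (B ⊞ᶠ sumᴮ w) t → ∃ λ t' → LR A B t' × (t' ⊞ᵀ sumᵀ w) ≗₂ t
  remove-⊞ {A} {B} []      w⊆E sk v ok {t} l =
    t , LR-resp (λ i → +-identityʳ (A i)) (λ i → +-identityʳ (B i)) (λ _ _ → refl) l , λ i k → +-identityʳ (t i k)
  remove-⊞ {A} {B} (u ∷ w) w⊆E sk v ok {t} l =
    let u∈ = w⊆E (here refl)
        c  = isCol u∈
        t₁ , l₁ , e₁ = remove-⊞ w (λ x → w⊆E (there x)) (Skew-+ u (IsColumn.s≤r c) sk) (Vanishes-+ u (IsColumn.r≤N c) v)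
          (AllNeutral-+ sk u∈ ok) {t} (LR-resp (λ i → sym (assocᴬ A u w i)) (λ i → sym (assocᴮ B u w i)) (λ _ _ → refl) l)
        t₂ , l₂ , e₂ = remove sk v c (ok u∈) l₁
    in t₂ , l₂ , λ i k → trans (sym (+-assoc (t₂ i k) _ _)) (trans (cong (_+ sumᵀ w i k) (e₂ i k)) (e₁ i k))

  -- The remaining columns are inserted into the new tableau. A preimage with respect to all of `E`
  -- would, after cancelling these columns, be a preimage with respect to `u` alone.
  new-⊞ : ∀ {A B} → Skew A B → Vanishes N A → ∀ {u} → u ∈ E →
          (∃ λ t → LR (A +ᴬ u) (B +ᴮ u) t × (∀ t' → LR A B t' → ¬ ((t' +ᵀ u) ≗₂ t))) →
          ∃ λ t → LR (A ⊞ᶠ sumᴬ E) (B ⊞ᶠ sumᴮ E) t × (∀ t' → LR A B t' → ¬ ((t' ⊞ᵀ sumᵀ E) ≗₂ t))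
  new-⊞ {A} {B} sk v {u} u∈ (t , l , not) with ∈-∃++ u∈
  ... | ws , zs , refl = t ⊞ᵀ sumᵀ w , LR-resp (λ i → reassoc (λ u → lt i (proj₁ u)) (A i))
          (λ i → reassoc (λ u → lt i (proj₂ u)) (B i)) (λ _ _ → refl)
          (LR-⊞ w (λ x → Any-resp x) l) ,
        λ t' l' e → not t' l' (λ i k → +-cancelʳ-≡ (sumᵀ w i k) _ _ (trans (reassoc (λ u → col u i k) (t' i k)) (e i k)))
    where
    w = ws ++ zs
    perm : u ∷ w ↭ ws ++ u ∷ zs
    perm = ↭-sym (↭ₚ.shift u ws zs)
    Any-resp : ∀ {x} → x ∈ w → x ∈ ws ++ u ∷ zs
    Any-resp x∈ = ↭ₚ.∈-resp-↭ perm (there x∈)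
    reassoc : ∀ (f : Column → ℕ) a → a + f u + sum (map f w) ≡ a + sum (map f (ws ++ u ∷ zs))
    reassoc f a = trans (+-assoc a _ _) (cong (a +_) (sum-↭ (↭ₚ.map⁺ f perm)))

-- Counting arrays

-- Arrays are functions, so a cardinality is given by a list of representatives for pointwise
-- equality.
record Counts (n : ℕ) (P : Array → Set) : Set where
  field
    elements : List Array
    size     : length elements ≡ n
    sound    : All P elements
    distinct : AllPairs (λ t t' → ¬ t ≗₂ t') elements
    complete : ∀ {t} → P t → Any (t ≗₂_) elements

AllPairs-lookup : ∀ {X : Set} {D : X → X → Set} {xs} → AllPairs D xs → ∀ {i j} → i Fin.< j → D (lookup xs i) (lookup xs j)
AllPairs-lookup (d AllPairs.∷ ds) {Fin.zero}  {Fin.suc j} _         = All.lookup d (∈-lookup j)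
AllPairs-lookup (d AllPairs.∷ ds) {Fin.suc i} {Fin.suc j} (s≤s i<j) = AllPairs-lookup ds i<j

-- A relation takes the place of an injection that is defined only up to pointwise equality; `clash`
-- is its injectivity.
pigeonhole : ∀ {X Y : Set} {D : X → X → Set} (R : X → Y → Set) {xs ys} →
             (∀ {x x' y} → D x x' → R x y → R x' y → ⊥) →
             AllPairs D xs → All (λ x → Any (R x) ys) xs → length xs ≤ length ys
pigeonhole R {xs} {ys} clash ds rs = Finₚ.injective⇒≤ {f = f} f-inj
  where
  rel : ∀ i → Any (R (lookup xs i)) ys
  rel i = All.lookup rs (∈-lookup i)
  f : Fin (length xs) → Fin (length ys)
  f i = Any.index (rel i)
  f-inj : ∀ {i j} → f i ≡ f j → i ≡ j
  f-inj {i} {j} e with Finₚ.<-cmp i j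
  ... | tri≈ _ i≡j _ = i≡j
  ... | tri< i<j _ _ = ⊥-elim (clash (AllPairs-lookup ds i<j) (Anyₚ.lookup-index (rel i))
          (subst (λ z → R (lookup xs j) (lookup ys z)) (sym e) (Anyₚ.lookup-index (rel j))))
  ... | tri> _ _ j<i = ⊥-elim (clash (AllPairs-lookup ds j<i) (Anyₚ.lookup-index (rel j))
          (subst (λ z → R (lookup xs i) (lookup ys z)) e (Anyₚ.lookup-index (rel i))))

module _ {m n : ℕ} {P P' : Array → Set} (c : Counts m P) (c' : Counts n P') (T : Array)
         (T-maps : ∀ {t} → P t → P' (t ⊞ᵀ T)) where
  private
    module C = Counts c
    module C' = Counts c'
    shifted : List Array
    shifted = map (_⊞ᵀ T) C.elements
    clash : ∀ {t t' y} → ¬ t ≗₂ t' → t ≗₂ y → t' ≗₂ y → ⊥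
    clash d e e' = d (λ i k → trans (e i k) (sym (e' i k)))
    shifted-distinct : AllPairs (λ t t' → ¬ t ≗₂ t') shifted
    shifted-distinct = AllPairsₚ.map⁺ (AllPairs.map (λ d e → d (λ i k → +-cancelʳ-≡ (T i k) _ _ (e i k))) C.distinct)
    shifted-sound : All P' shifted
    shifted-sound = Allₚ.map⁺ (All.map T-maps C.sound)

  count-≤ : m ≤ n
  count-≤ = subst₂ _≤_ (trans (length-map _ C.elements) C.size) C'.size
    (pigeonhole _≗₂_ clash shifted-distinct (All.map C'.complete shifted-sound))

  count-< : (∃ λ t → P' t × (∀ t' → P t' → ¬ ((t' ⊞ᵀ T) ≗₂ t))) → m < n
  count-< (t₀ , p₀ , not) = subst₂ _≤_ (cong suc (trans (length-map _ C.elements) C.size)) C'.size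
    (pigeonhole _≗₂_ clash (Allₚ.map⁺ (All.map (λ {t} p e → not t p (λ i k → sym (e i k))) C.sound) AllPairs.∷ shifted-distinct)
      (All.map C'.complete (p₀ All.∷ shifted-sound)))

  count-≡ : (∀ {t} → P' t → ∃ λ t' → P t' × (t' ⊞ᵀ T) ≗₂ t) → m ≡ n
  count-≡ onto = ≤-antisym count-≤ (subst₂ _≤_ C'.size C.size
    (pigeonhole (λ t t' → (t' ⊞ᵀ T) ≗₂ t) (λ d e e' → d (λ i k → trans (sym (e i k)) (e' i k))) C'.distinct
      (All.map found C'.sound)))
    where
    found : ∀ {t} → P' t → Any (λ t' → (t' ⊞ᵀ T) ≗₂ t) C.elements
    found p with onto p
    ... | t' , p' , e = Any.map (λ e' i k → trans (cong (_+ T i k) (sym (e' i k))) (e i k)) (C.complete p')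

-- Conjugate partitions and stretched shapes

lt≡1 : ∀ {i n} → lt i n ≡ 1 → i < n
lt≡1 {i} {n} e with <-≤-connex i n
... | inj₁ h = h
... | inj₂ h = ⊥-elim (0≢1+n (trans (sym (lt-no h)) e))

sum-upTo : ∀ f n → sum (map f (upTo n)) ≡ Σ< f n
sum-upTo f zero    = refl
sum-upTo f (suc n) = begin
  sum (map f (upTo (suc n)))             ≡⟨ cong (λ z → sum (map f z)) (sym (upTo-∷ʳ n)) ⟩
  sum (map f (upTo n ++ (n ∷ [])))          ≡⟨ cong sum (map-++ f (upTo n) (n ∷ [])) ⟩
  sum (map f (upTo n) ++ (f n ∷ []))        ≡⟨ sum-++ (map f (upTo n)) (f n ∷ []) ⟩
  sum (map f (upTo n)) + (f n + 0)       ≡⟨ cong₂ _+_ (sum-upTo f n) (+-identityʳ (f n)) ⟩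
  Σ< f n + f n                           ∎
  where open ≡-Reasoning

Σ<-lt : ∀ {m n} → m ≤ n → Σ< (λ c → lt c m) n ≡ m
Σ<-lt {m} {n} m≤n = trans (Σ<-stable (λ c → lt c m) m≤n (λ i → lt-no)) (trans (Σ<-cong m (λ i → lt-yes)) (ones m))
  where
  ones : ∀ m → Σ< (λ _ → 1) m ≡ m
  ones zero    = refl
  ones (suc m) = trans (cong (_+ 1) (ones m)) (+-comm m 1)

module Conjugate (N : ℕ) where

  conj : (ℕ → ℕ) → ℕ → ℕ
  conj f c = Σ< (λ i → lt c (f i)) N

  conj≤N : ∀ f c → conj f c ≤ N
  conj≤N f c = ≤-trans (Σ<-mono-≤ N (λ i i<N → ≤-trans (lt≤1 c (f i)) (≤-reflexive (sym (lt-yes i<N))))) (≤-reflexive (Σ<-lt ≤-refl))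

  module _ {f : ℕ → ℕ} (f↓ : Decreasing f) (v : Vanishes N f) where

    -- Both sides ask whether the same box lies in the diagram: since `f` decreases, the rows with
    -- `c < f i` form an initial segment, of length `conj f c`.
    lt-conj : ∀ i c → lt i (conj f c) ≡ lt c (f i)
    lt-conj i c with <-≤-connex c (f i)
    ... | inj₁ h = trans (lt-yes (≤-trans (≤-reflexive (sym full)) (Σ<-extend (λ i → lt c (f i)) i<N))) (sym (lt-yes h))
      where
      i<N : i < N
      i<N with <-≤-connex i N
      ... | inj₁ g = g
      ... | inj₂ g = ⊥-elim (n≮0 (subst (c <_) (v i g) h))
      full : Σ< (λ i → lt c (f i)) (suc i) ≡ suc i
      full = trans (Σ<-cong (suc i) (λ j j≤i → trans (lt-yes (<-≤-trans h (antitone f↓ (≤-pred j≤i)))) (sym (lt-yes j≤i)))) (Σ<-lt ≤-refl)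
    ... | inj₂ h = trans (lt-no (≤-trans (≤-trans small bounded) (≤-reflexive (Σ<-lt ≤-refl)))) (sym (lt-no h))
      where
      vanish : ∀ j → i ≤ j → lt c (f j) ≡ 0
      vanish j i≤j = lt-no (≤-trans (antitone f↓ i≤j) h)
      small : conj f c ≤ Σ< (λ i → lt c (f i)) i
      small with ≤-total i N
      ... | inj₁ i≤N = ≤-reflexive (Σ<-stable (λ i → lt c (f i)) i≤N vanish)
      ... | inj₂ N≤i = Σ<-extend (λ i → lt c (f i)) N≤i
      bounded : Σ< (λ j → lt c (f j)) i ≤ Σ< (λ j → lt j i) i
      bounded = Σ<-mono-≤ i (λ j j<i → ≤-trans (lt≤1 c (f j)) (≤-reflexive (sym (lt-yes j<i))))

    <-conj : ∀ {i c} → i < conj f c → c < f i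
    <-conj {i} {c} h = lt≡1 (trans (sym (lt-conj i c)) (lt-yes h))

    conj-< : ∀ {i c} → c < f i → i < conj f c
    conj-< {i} {c} h = lt≡1 (trans (lt-conj i c) (lt-yes h))

    ≤-conj : ∀ {i c} → conj f c ≤ i → f i ≤ c
    ≤-conj {i} {c} h with ≤-<-connex (f i) c
    ... | inj₁ g = g
    ... | inj₂ g = ⊥-elim (<⇒≱ (conj-< g) h)

  column : (la mu : ℕ → ℕ) → ℕ → Column
  column la mu c = conj la c , conj mu c

  columns : (la mu : ℕ → ℕ) → List Column
  columns la mu = map (column la mu) (upTo (la 0))

-- What a partition or rotated partition means before compression: the non-empty rows share their
-- left end or their right end.
Aligned : (la mu : ℕ → ℕ) → Set
Aligned la mu = (∀ {i j} → mu i < la i → mu j < la j → mu i ≡ mu j) ⊎ (∀ {i j} → mu i < la i → mu j < la j → la i ≡ la j)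

module _ {N : ℕ} {la mu : ℕ → ℕ} (sk : Skew la mu) (v : Vanishes N la) where
  open Skew sk
  open Conjugate N

  vμ : Vanishes N mu
  vμ i h = n≤0⇒n≡0 (subst (mu i ≤_) (v i h) (B≤A i))

  sumᴬ-columns : ∀ i → sumᴬ (columns la mu) i ≡ la i
  sumᴬ-columns i = trans (cong sum (sym (map-∘ (upTo (la 0))))) (trans (sum-upTo _ (la 0))
    (trans (Σ<-cong (la 0) (λ c _ → lt-conj A↓ v i c)) (Σ<-lt (antitone A↓ z≤n))))

  sumᴮ-columns : ∀ i → sumᴮ (columns la mu) i ≡ mu i
  sumᴮ-columns i = trans (cong sum (sym (map-∘ (upTo (la 0))))) (trans (sum-upTo _ (la 0))
    (trans (Σ<-cong (la 0) (λ c _ → lt-conj B↓ vμ i c)) (Σ<-lt (≤-trans (B≤A i) (antitone A↓ z≤n)))))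

  columns-isColumn : ∀ {u} → u ∈ columns la mu → IsColumn N u
  columns-isColumn u∈ with ∈-map⁻ (column la mu) u∈
  ... | c , c∈ , refl = isColumn (Σ<-mono-≤ N (λ i _ → lt-mono c (B≤A i))) (conj-< A↓ v (∈-upTo⁻ c∈)) (conj≤N la c)

  -- A common left end of the rows gives all non-empty columns the same top, a common right end the
  -- same bottom. For empty columns monotonicity decides: one lying strictly between top and bottom
  -- of column `c` would be both to the left and to the right of `c`.
  columns-compatible : Aligned la mu → ∀ {u u'} → u ∈ columns la mu → u' ∈ columns la mu → Compatible u u'
  columns-compatible al u∈ u'∈ with ∈-map⁻ (column la mu) u∈ | ∈-map⁻ (column la mu) u'∈
  ... | c , _ , refl | c' , _ , refl = record
    { nested = nested al ; emptyᵛ = λ s<r e → between c c' s<r e ; emptyᵘ = emptyᵘ }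
    where
    r = conj la
    s = conj mu
    nonempty : ∀ {c i} → s c ≤ i → i < r c → mu i < la i
    nonempty s≤i i<r = ≤-<-trans (≤-conj B↓ vμ s≤i) (<-conj A↓ v i<r)
    nested : Aligned la mu → s c < r c → s c' < r c' → s c ≡ s c' ⊎ r c ≡ r c'
    nested (inj₁ al) h h' = inj₁ (≤-antisym (≮⇒≥ (not< c c' h h')) (≮⇒≥ (not< c' c h' h)))
      where
      not< : ∀ c c' → s c < r c → s c' < r c' → ¬ s c' < s c
      not< c c' h h' g = <⇒≱ (<-conj B↓ vμ g) (≤-trans (≤-reflexive (al {s c'} {s c} (nonempty ≤-refl h') (nonempty ≤-refl h))) (≤-conj B↓ vμ ≤-refl))
    nested (inj₂ al) h h' = inj₂ (≤-antisym (≮⇒≥ (not< c c' h h')) (≮⇒≥ (not< c' c h' h)))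
      where
      not< : ∀ c c' → s c < r c → s c' < r c' → ¬ r c' < r c
      not< c c' h h' g with r c in rc | r c' in rc'
      ... | suc p | suc p' = <⇒≱ (<-conj A↓ v {p'} {c'} (≤-reflexive (sym rc')))
            (≤-trans (≤-reflexive (al {p'} {p} (nonempty {c'} (≤-pred h') (≤-reflexive (sym rc')))
                (nonempty {c} (≤-pred h) (≤-reflexive (sym rc)))))
              (≤-conj A↓ v {p} {c'} (≤-trans (≤-reflexive rc') (≤-pred g))))
    between : ∀ c c' → s c < r c → s c' ≡ r c' → r c' ≤ s c ⊎ r c ≤ r c'
    between c c' h e with ≤-<-connex (r c') (s c) | ≤-<-connex (r c) (r c')
    ... | inj₁ g | _      = inj₁ g
    ... | inj₂ _ | inj₁ g = inj₂ g
    ... | inj₂ g | inj₂ f = ⊥-elim (<-irrefl refl (<-trans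
          (<-≤-trans (<-conj A↓ v f) (≤-conj A↓ v ≤-refl))
          (<-≤-trans (<-conj B↓ vμ (subst (s c <_) (sym e) g)) (≤-conj B↓ vμ ≤-refl))))
    emptyᵘ : s c ≡ r c → r c ≤ s c' ⊎ r c' ≤ r c
    emptyᵘ e with ≤-<-connex (r c) (s c') | ≤-<-connex (r c') (r c)
    ... | inj₁ g | _      = inj₁ g
    ... | inj₂ _ | inj₁ g = inj₂ g
    ... | inj₂ g | inj₂ f with between c' c (<-trans g f) e
    ...   | inj₁ x = inj₁ x
    ...   | inj₂ x = inj₂ x

stretch : ℕ → (ℕ → ℕ) → (ℕ → ℕ) → ℕ → ℕ
stretch n f f' i = n * f i + f' i

Skew-stretch : ∀ n {la mu la' mu'} → Skew la mu → Skew la' mu' → Skew (stretch n la la') (stretch n mu mu')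
Skew-stretch n sk sk' = record
  { A↓ = λ i → *-monoʳ-≤ n (Skew.A↓ sk i) ⊕ Skew.A↓ sk' i
  ; B↓ = λ i → *-monoʳ-≤ n (Skew.B↓ sk i) ⊕ Skew.B↓ sk' i
  ; B≤A = λ i → *-monoʳ-≤ n (Skew.B≤A sk i) ⊕ Skew.B≤A sk' i }

-- A crude bound, independent of `n`, for what λ'/μ' can add to a width: each minimum is replaced by
-- a sum.
widthBound : (la' mu' : ℕ → ℕ) → ℕ → ℕ → ℕ
widthBound la' mu' a zero    = 0
widthBound la' mu' a (suc m) = la' a + Σ< (λ j → la' (suc (a + j)) + mu' (a + j)) m

width-stretch : ∀ n {la mu} la' mu' → Skew la mu → ∀ a m →
                width (stretch n la la') (stretch n mu mu') a m ≤ n * width la mu a m + widthBound la' mu' a m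
width-stretch n         la' mu' sk a zero    = z≤n
width-stretch n {la} {mu} la' mu' sk a (suc m) = ≤-trans
  (difference (n * la a + la' a) (la a) (la' a) (mu a) (mu' a) (B≤A a) ≤-refl ⊕ sums m)
  (≤-reflexive (rearrange n (la a ∸ mu a) (la' a) (Σ< (λ j → fresh la mu (a + j)) m) _))
  where
  open Skew sk
  rearrange : ∀ n x y z w → n * x + y + (n * z + w) ≡ n * (x + z) + (y + w)
  rearrange n x y z w = solve (n ∷ x ∷ y ∷ z ∷ w ∷ [])
  difference : ∀ p z c b b' → b ≤ z → p ≤ n * z + c → p ∸ (n * b + b') ≤ n * (z ∸ b) + c
  difference p z c b b' b≤z p≤ = m≤n+o⇒m∸n≤o p (n * b + b') (≤-trans p≤
    (subst (λ y → n * y + c ≤ n * b + b' + (n * (z ∸ b) + c)) (m+[n∸m]≡n b≤z) (arith (z ∸ b))))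
    where
    arith : ∀ x → n * (b + x) + c ≤ n * b + b' + (n * x + c)
    arith x = lin b' (≤-refl {0}) (identity n b x c b')
      where
      identity : ∀ n b x c b' → n * (b + x) + c + 0 + b' ≡ n * b + b' + (n * x + c) + 0
      identity n b x c b' = solve (n ∷ b ∷ x ∷ c ∷ b' ∷ [])
  minimum : ∀ l l' k k' → (n * l + l') ⊓ (n * k + k') ≤ n * (l ⊓ k) + (l' + k')
  minimum l l' k k' with ≤-total l k
  ... | inj₁ h rewrite m≤n⇒m⊓n≡m h = ≤-trans (m⊓n≤m _ _) (+-monoʳ-≤ (n * l) (m≤m+n l' k'))
  ... | inj₂ h rewrite m≥n⇒m⊓n≡n h = ≤-trans (m⊓n≤n (n * l + l') _) (+-monoʳ-≤ (n * k) (m≤n+m k' l'))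
  one : ∀ i → fresh (stretch n la la') (stretch n mu mu') i ≤ n * fresh la mu i + (la' (suc i) + mu' i)
  one i = difference _ (la (suc i) ⊓ mu i) (la' (suc i) + mu' i) (mu (suc i)) (mu' (suc i)) (⊓-glb (B≤A (suc i)) (B↓ i))
            (minimum (la (suc i)) (la' (suc i)) (mu i) (mu' i))
  sums : ∀ m → Σ< (λ j → fresh (stretch n la la') (stretch n mu mu') (a + j)) m ≤
               n * Σ< (λ j → fresh la mu (a + j)) m + Σ< (λ j → la' (suc (a + j)) + mu' (a + j)) m
  sums zero    = z≤n
  sums (suc m) = ≤-trans (sums m ⊕ one (a + m)) (≤-reflexive (rearrange n _ _ _ _))

-- One to spare in λ/μ becomes `n` to spare in the n-fold shape, and this absorbs the constant
-- contributed by λ'/μ'.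
neutral-stretch : ∀ {N la mu la' mu' u} → Skew la mu → Neutral 1 N la mu u →
  ∀ n → mu' (proj₂ u) + widthBound la' mu' 0 (proj₂ u) + widthBound la' mu' (proj₁ u) N + la' (proj₁ u) ≤ n →
  Neutral 0 N (stretch n la la') (stretch n mu mu') u
neutral-stretch {N} {la} {mu} {la'} {mu'} {r , s} sk (neutral thick thin) n n≥ = neutral
  (λ h → thick' (mu s) (width la mu 0 s) (width la mu r N) (la (pred r)) (mu' s) (widthBound la' mu' 0 s) (widthBound la' mu' r N)
     (la' (pred r)) (la' r) _ _ (thick h) (width-stretch n la' mu' sk 0 s) (width-stretch n la' mu' sk r N) n≥)
  (λ e → thin' (la r) (mu (pred r)) (la' r) (mu' (pred r)) _ (thin e) n≥)
  where
  thick' : ∀ m a b l m' a' b' l' x w₀ w₁ → 1 + (m + a + b) ≤ l → w₀ ≤ n * a + a' → w₁ ≤ n * b + b' → m' + a' + b' + x ≤ n →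
           n * m + m' + w₀ + w₁ ≤ n * l + l'
  thick' m a b l m' a' b' l' x w₀ w₁ h h₀ h₁ h₂ = lin (x + l') (*-monoʳ-≤ n h ⊕ h₀ ⊕ h₁ ⊕ h₂) (identity n m a b l m' a' b' l' x w₀ w₁)
    where
    identity : ∀ n m a b l m' a' b' l' x w₀ w₁ →
      n * m + m' + w₀ + w₁ + (n * l + (n * a + a' + (n * b + b' + n))) + (x + l') ≡
      n * l + l' + (n * (1 + (m + a + b)) + (w₀ + (w₁ + (m' + a' + b' + x))))
    identity n m a b l m' a' b' l' x w₀ w₁ = solve (n ∷ m ∷ a ∷ b ∷ l ∷ m' ∷ a' ∷ b' ∷ l' ∷ x ∷ w₀ ∷ w₁ ∷ [])
  thin' : ∀ l m l' m' x → 1 + l ≤ m → x + l' ≤ n → n * l + l' ≤ n * m + m'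
  thin' l m l' m' x h h' = lin (x + m') (*-monoʳ-≤ n h ⊕ h') (identity n l m l' m' x)
    where
    identity : ∀ n l m l' m' x → n * l + l' + (n * m + n) + (x + m') ≡ n * m + m' + (n * (1 + l) + (x + l'))
    identity n l m l' m' x = solve (n ∷ l ∷ m ∷ l' ∷ m' ∷ x ∷ [])

module Stretched {N : ℕ} {la mu la' mu' : ℕ → ℕ} (sk : Skew la mu) (sk' : Skew la' mu')
                 (v : Vanishes N la) (v' : Vanishes N la') (al : Aligned la mu)
                 {q : ℕ → ℕ} (counts : ∀ n → Counts (q n) (LR (stretch n la la') (stretch n mu mu'))) where
  open Conjugate N

  E = columns la mu
  open Columns E (columns-isColumn sk v) (columns-compatible sk v al) public

  A B : ℕ → ℕ → ℕ
  A n = stretch n la la'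
  B n = stretch n mu mu'

  skₙ : ∀ n → Skew (A n) (B n)
  skₙ n = Skew-stretch n sk sk'

  vₙ : ∀ n → Vanishes N (A n)
  vₙ n i h rewrite v i h | v' i h | *-zeroʳ n = refl

  next : ∀ x f f' n → x ≡ f → n * f + f' + x ≡ suc n * f + f'
  next x f f' n refl = solve (x ∷ f' ∷ n ∷ [])

  nextᴬ : ∀ n i → (A n ⊞ᶠ sumᴬ E) i ≡ A (suc n) i
  nextᴬ n i = next _ (la i) (la' i) n (sumᴬ-columns sk v i)

  nextᴮ : ∀ n i → (B n ⊞ᶠ sumᴮ E) i ≡ B (suc n) i
  nextᴮ n i = next _ (mu i) (mu' i) n (sumᴮ-columns sk v i)

  grow : ∀ n {t} → LR (A n) (B n) t → LR (A (suc n)) (B (suc n)) (t ⊞ᵀ sumᵀ E)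
  grow n l = LR-resp (nextᴬ n) (nextᴮ n) (λ _ _ → refl) (LR-⊞ E (λ x → x) l)

  AllNeutral-suc : ∀ n → AllNeutral (A n) (B n) → AllNeutral (A (suc n)) (B (suc n))
  AllNeutral-suc n ok u∈ = Neutral-resp (nextᴬ n) (nextᴮ n) (neutral-⊞ E (λ x → x) (skₙ n) ok u∈ (ok u∈))

  step-≡ : ∀ n → AllNeutral (A n) (B n) → q n ≡ q (suc n)
  step-≡ n ok = count-≡ (counts n) (counts (suc n)) (sumᵀ E) (grow n)
    (λ l → remove-⊞ E (λ x → x) (skₙ n) (vₙ n) ok
      (LR-resp (λ i → sym (nextᴬ n i)) (λ i → sym (nextᴮ n i)) (λ _ _ → refl) l))

  -- A single column that is not neutral already yields a tableau outside the image of `grow`.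
  step : ∀ n → AllNeutral (A n) (B n) ⊎ q n < q (suc n)
  step n with search E (λ x → x)
    where
    search : ∀ w → (∀ {u} → u ∈ w → u ∈ E) → (∀ {u} → u ∈ w → Neutral 0 N (A n) (B n) u) ⊎
      (∃ λ t → LR (A n ⊞ᶠ sumᴬ E) (B n ⊞ᶠ sumᴮ E) t × (∀ t' → LR (A n) (B n) t' → ¬ ((t' ⊞ᵀ sumᵀ E) ≗₂ t)))
    search []      w⊆E = inj₁ (λ ())
    search (u ∷ w) w⊆E with neutral⊎new (skₙ n) (vₙ n) (columns-isColumn sk v (w⊆E (here refl))) | search w (λ x → w⊆E (there x))
    ... | inj₂ new | _        = inj₂ (new-⊞ (skₙ n) (vₙ n) (w⊆E (here refl)) new)
    ... | inj₁ _   | inj₂ new = inj₂ new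
    ... | inj₁ ok  | inj₁ oks = inj₁ (λ { (here refl) → ok ; (there x) → oks x })
  ... | inj₁ ok = inj₁ ok
  ... | inj₂ (t , l , new) = inj₂ (count-< (counts n) (counts (suc n)) (sumᵀ E) (grow n)
        (t , LR-resp (nextᴬ n) (nextᴮ n) (λ _ _ → refl) l , new))

  stable : ∀ {n} → AllNeutral (A n) (B n) → ∀ k → n ≤ k → q k ≡ q n × AllNeutral (A k) (B k)
  stable {n} ok k n≤k with m≤n⇒m<n∨m≡n n≤k
  ... | inj₂ refl = refl , ok
  stable {n} ok (suc k) _ | inj₁ (s≤s n≤k) with stable ok k n≤k
  ... | e , okₖ = trans (sym (step-≡ k okₖ)) e , AllNeutral-suc k okₖ

  -- λ/μ is built from the empty shape, on which every column is neutral, by inserting its own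
  -- columns. Hence each has one to spare in λ/μ, and a large stretch makes all of them neutral.
  eventually : ∃ λ m → AllNeutral (A m) (B m)
  eventually = Σₑ E , λ u∈ → neutral-stretch sk (strict u∈) (Σₑ E) (bound≤ u∈)
    where
    bound : Column → ℕ
    bound u = mu' (proj₂ u) + widthBound la' mu' 0 (proj₂ u) + widthBound la' mu' (proj₁ u) N + la' (proj₁ u)
    Σₑ : List Column → ℕ
    Σₑ w = sum (map bound w)
    bound≤ : ∀ {w u} → u ∈ w → bound u ≤ Σₑ w
    bound≤ (here refl) = m≤m+n _ _
    bound≤ (there u∈)  = ≤-trans (bound≤ u∈) (m≤n+m _ _)
    O : ℕ → ℕ
    O _ = 0
    width-O : ∀ a n → width O O a n ≡ 0
    width-O a zero    = refl
    width-O a (suc n) = Σ<-zero n (λ _ _ → refl)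
    neutral-O : AllNeutral O O
    neutral-O {u} _ = neutral (λ _ → ≤-reflexive (cong₂ _+_ (width-O 0 (proj₂ u)) (width-O (proj₁ u) N))) (λ _ → z≤n)
    strict : ∀ {u} → u ∈ E → Neutral 1 N la mu u
    strict u∈ = Neutral-resp (sumᴬ-columns sk v) (sumᴮ-columns sk v)
      (neutral-⊞-strict E (λ x → x) (record { A↓ = λ _ → z≤n ; B↓ = λ _ → z≤n ; B≤A = λ _ → z≤n }) neutral-O u∈)

-- Boolean tests and integer ranges

∧⁻ : ∀ {a b} → T (a ∧ b) → T a × T b
∧⁻ = Equivalence.to T-∧

∧⁺ : ∀ {a b} → T a → T b → T (a ∧ b)
∧⁺ p q = Equivalence.from T-∧ (p , q)

all⁻ : ∀ {X : Set} (p : X → Bool) xs → T (Bool.all p xs) → ∀ {x} → x ∈ xs → T (p x)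
all⁻ p (x ∷ xs) h (here refl) = proj₁ (∧⁻ h)
all⁻ p (x ∷ xs) h (there x∈)  = all⁻ p xs (proj₂ (∧⁻ {p x} h)) x∈

all⁺ : ∀ {X : Set} (p : X → Bool) xs → (∀ {x} → x ∈ xs → T (p x)) → T (Bool.all p xs)
all⁺ p []       h = _
all⁺ p (x ∷ xs) h = ∧⁺ (h (here refl)) (all⁺ p xs (λ x∈ → h (there x∈)))

∈-fromTo⁻ : ∀ {a b x} → x ∈ fromTo a b → a ≤ x × x ≤ b
∈-fromTo⁻ {a} {b} {x} x∈ with ∈-map⁻ (a +_) x∈
... | j , j∈ , refl = m≤m+n a j , ≤-pred (subst (suc (a + j) ≤_) (m+[n∸m]≡n a≤) (≤-trans (≤-reflexive (sym (+-suc a j))) (+-monoʳ-≤ a j<)))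
  where
  j< : j < suc b ∸ a
  j< = ∈-upTo⁻ j∈
  a≤ : a ≤ suc b
  a≤ with ≤-total a (suc b)
  ... | inj₁ h = h
  ... | inj₂ h = ⊥-elim (n≮0 (subst (j <_) (m≤n⇒m∸n≡0 h) j<))

∈-fromTo⁺ : ∀ {a b x} → a ≤ x → x ≤ b → x ∈ fromTo a b
∈-fromTo⁺ {a} {b} {x} a≤x x≤b = subst (_∈ fromTo a b) (m+[n∸m]≡n a≤x)
  (∈-map⁺ (a +_) (∈-upTo⁺ (∸-monoˡ-< (s≤s x≤b) a≤x)))

fromTo-unique : ∀ a b → Unique (fromTo a b)
fromTo-unique a b = Uniqueₚ.map⁺ (λ {x} {y} → +-cancelˡ-≡ a x y) (Uniqueₚ.upTo⁺ _)

get-applyUpTo : ∀ {X : Set} (d : X) (f : ℕ → X) {n} i → i < n → get d (applyUpTo f n) (suc i) ≡ f i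
get-applyUpTo d f {suc n} zero    _         = refl
get-applyUpTo d f {suc n} (suc i) (s≤s i<n) = get-applyUpTo d (λ j → f (suc j)) i i<n

get-beyond : ∀ {X : Set} (d : X) xs i → length xs ≤ i → get d xs (suc i) ≡ d
get-beyond d []       i       _       = refl
get-beyond d (x ∷ xs) (suc i) (s≤s h) = get-beyond d xs i h

get-ext : ∀ {X : Set} (d : X) xs ys → length xs ≡ length ys → (∀ i → get d xs (suc i) ≡ get d ys (suc i)) → xs ≡ ys
get-ext d []       []       _ _ = refl
get-ext d (x ∷ xs) (y ∷ ys) e h = cong₂ _∷_ (h 0) (get-ext d xs ys (suc-injective e) (λ i → h (suc i)))

-- Words and fillings

Within : ℕ → List ℕ → Set
Within N w = ∀ {x} → x ∈ w → 1 ≤ x × x ≤ N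

∈-words⁻ : ∀ {N} l {w} → w ∈ words N l → length w ≡ l × Within N w
∈-words⁻ zero    (here refl) = refl , λ ()
∈-words⁻ {N} (suc l) w∈ with ∈-cartesianProductWith⁻ _∷_ (fromTo 1 N) (words N l) w∈
... | x , w , x∈ , w∈' , refl with ∈-words⁻ l w∈'
...   | len , within = cong suc len , λ { (here refl) → ∈-fromTo⁻ x∈ ; (there y∈) → within y∈ }

∈-words⁺ : ∀ {N} w → Within N w → w ∈ words N (length w)
∈-words⁺ []      within = here refl
∈-words⁺ (x ∷ w) within = ∈-cartesianProductWith⁺ _∷_
  (∈-fromTo⁺ (proj₁ (within (here refl))) (proj₂ (within (here refl)))) (∈-words⁺ w (λ y∈ → within (there y∈)))

words-unique : ∀ N l → Unique (words N l)
words-unique N zero    = All.[] AllPairs.∷ AllPairs.[]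
words-unique N (suc l) = Uniqueₚ.cartesianProductWith⁺ _∷_ ∷-injective (fromTo-unique 1 N) (words-unique N l)

row : List (List ℕ) → ℕ → List ℕ
row Tab i = get [] Tab (suc i)

∈-fillingsRows⁻ : ∀ {N} rs {Tab} → Tab ∈ fillingsRows N rs →
                  length Tab ≡ length rs × (∀ i → length (row Tab i) ≡ get 0 rs (suc i) × Within N (row Tab i))
∈-fillingsRows⁻ []       (here refl) = refl , λ i → refl , λ ()
∈-fillingsRows⁻ {N} (r ∷ rs) Tab∈ with ∈-cartesianProductWith⁻ _∷_ (words N r) (fillingsRows N rs) Tab∈
... | w , Tab , w∈ , Tab∈' , refl with ∈-fillingsRows⁻ rs Tab∈'
...   | len , rows = cong suc len , λ { zero → ∈-words⁻ r w∈ ; (suc i) → rows i }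

∈-fillingsRows⁺ : ∀ {N} rs Tab → length Tab ≡ length rs → (∀ i → length (row Tab i) ≡ get 0 rs (suc i)) →
                  (∀ i → Within N (row Tab i)) → Tab ∈ fillingsRows N rs
∈-fillingsRows⁺ []       []        _ _ _ = here refl
∈-fillingsRows⁺ (r ∷ rs) (w ∷ Tab) e l within = ∈-cartesianProductWith⁺ _∷_
  (subst (λ z → w ∈ words _ z) (l 0) (∈-words⁺ w (within 0)))
  (∈-fillingsRows⁺ rs Tab (suc-injective e) (λ i → l (suc i)) (λ i → within (suc i)))

fillingsRows-unique : ∀ N rs → Unique (fillingsRows N rs)
fillingsRows-unique N []       = All.[] AllPairs.∷ AllPairs.[]
fillingsRows-unique N (r ∷ rs) = Uniqueₚ.cartesianProductWith⁺ _∷_ ∷-injective (words-unique N r) (fillingsRows-unique N rs)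

-- Sorted words and their multiplicities

count-∷ : ∀ k x w → count k (x ∷ w) ≡ eq x k + count k w
count-∷ k x w = go (x ≟ k)
  where
  go : Dec (x ≡ k) → count k (x ∷ w) ≡ eq x k + count k w
  go (yes refl) = trans (cong length (filter-accept (λ y → y ≟ k) refl)) (cong (_+ count k w) (sym (eq-refl k)))
  go (no x≢k)   = trans (cong length (filter-reject (λ y → y ≟ k) x≢k)) (cong (_+ count k w) (sym (eq-no x≢k)))

count-++ : ∀ k u v → count k (u ++ v) ≡ count k u + count k v
count-++ k u v = trans (cong length (filter-++ (λ x → x ≟ k) u v)) (length-++ (filter (λ x → x ≟ k) u))

count-reverse : ∀ k w → count k (reverse w) ≡ count k w
count-reverse k []      = refl
count-reverse k (x ∷ w) = begin
  count k (reverse (x ∷ w))          ≡⟨ cong (count k) (unfold-reverse x w) ⟩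
  count k (reverse w ++ (x ∷ []))    ≡⟨ count-++ k (reverse w) (x ∷ []) ⟩
  count k (reverse w) + count k (x ∷ []) ≡⟨ cong₂ _+_ (count-reverse k w) (trans (count-∷ k x []) (+-identityʳ _)) ⟩
  count k w + eq x k                 ≡⟨ +-comm (count k w) (eq x k) ⟩
  eq x k + count k w                 ≡⟨ sym (count-∷ k x w) ⟩
  count k (x ∷ w)                    ∎
  where open ≡-Reasoning

count-zero : ∀ k w → (∀ {x} → x ∈ w → x ≢ k) → count k w ≡ 0
count-zero k []      h = refl
count-zero k (x ∷ w) h = trans (count-∷ k x w) (cong₂ _+_ (eq-no (h (here refl))) (count-zero k w (λ y∈ → h (there y∈))))

count-replicate : ∀ k n → count k (replicate n k) ≡ n
count-replicate k zero    = refl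
count-replicate k (suc n) = trans (count-∷ k k (replicate n k)) (cong₂ _+_ (eq-refl k) (count-replicate k n))

atMost : ℕ → List ℕ → ℕ
atMost k []      = 0
atMost k (x ∷ w) = lt x (suc k) + atMost k w

atMost-Σ : ∀ {N} k w → Within N w → Σ< (λ j → count (suc j) w) k ≡ atMost k w
atMost-Σ k []      within = Σ<-zero k (λ _ _ → refl)
atMost-Σ k (x ∷ w) within = trans (Σ<-cong k (λ j _ → count-∷ (suc j) x w))
  (trans (Σ<-+ (λ j → eq x (suc j)) (λ j → count (suc j) w) k)
    (cong₂ _+_ (indicator x k (proj₁ (within (here refl)))) (atMost-Σ k w (λ y∈ → within (there y∈)))))
  where
  indicator : ∀ x k → 1 ≤ x → Σ< (λ j → eq x (suc j)) k ≡ lt x (suc k)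
  indicator (suc x) zero    _ = refl
  indicator (suc x) (suc k) h = trans (cong (_+ eq x k) (indicator (suc x) k h)) (sym (lt-sucʳ x k))

atMost-all : ∀ {N} w → Within N w → atMost N w ≡ length w
atMost-all []      within = refl
atMost-all (x ∷ w) within = cong₂ _+_ (lt-yes (s≤s (proj₂ (within (here refl))))) (atMost-all w (λ y∈ → within (there y∈)))

Sorted : List ℕ → Set
Sorted w = T (weaklyIncreasing w)

sorted-tail : ∀ x w → Sorted (x ∷ w) → Sorted w
sorted-tail x []      s = _
sorted-tail x (y ∷ w) s = proj₂ (∧⁻ {x ≤ᵇ y} s)

sorted-head : ∀ x w → Sorted (x ∷ w) → ∀ {y} → y ∈ w → x ≤ y
sorted-head x (y ∷ w) s (here refl) = ≤ᵇ⇒≤ x y (proj₁ (∧⁻ s))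
sorted-head x (y ∷ w) s (there z∈)  = ≤-trans (≤ᵇ⇒≤ x y (proj₁ (∧⁻ s))) (sorted-head y w (proj₂ (∧⁻ {x ≤ᵇ y} s)) z∈)

sorted-∷ : ∀ x w → (∀ {y} → y ∈ w → x ≤ y) → Sorted w → Sorted (x ∷ w)
sorted-∷ x []      h s = _
sorted-∷ x (y ∷ w) h s = ∧⁺ (≤⇒≤ᵇ (h (here refl))) s

sorted-++ : ∀ u v → Sorted u → Sorted v → (∀ {x y} → x ∈ u → y ∈ v → x ≤ y) → Sorted (u ++ v)
sorted-++ []      v su sv h = sv
sorted-++ (x ∷ u) v su sv h = sorted-∷ x (u ++ v) first (sorted-++ u v (sorted-tail x u su) sv (λ a b → h (there a) b))
  where
  first : ∀ {y} → y ∈ u ++ v → x ≤ y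
  first y∈ with ∈-++⁻ u y∈
  ... | inj₁ y∈u = sorted-head x u su y∈u
  ... | inj₂ y∈v = h (here refl) y∈v

atMost-none : ∀ k w → (∀ {y} → y ∈ w → k < y) → atMost k w ≡ 0
atMost-none k []      h = refl
atMost-none k (x ∷ w) h = cong₂ _+_ (lt-no (h (here refl))) (atMost-none k w (λ y∈ → h (there y∈)))

get-∈ : ∀ w p → p < length w → get 0 w (suc p) ∈ w
get-∈ (x ∷ w) zero    _       = here refl
get-∈ (x ∷ w) (suc p) (s≤s h) = there (get-∈ w p h)

get≤⇒ : ∀ w → Sorted w → ∀ k p → p < length w → get 0 w (suc p) ≤ k → p < atMost k w
get≤⇒ (x ∷ w) s k zero    _       g rewrite lt-yes (s≤s g) = s≤s z≤n
get≤⇒ (x ∷ w) s k (suc p) (s≤s h) g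
  rewrite lt-yes (s≤s (≤-trans (sorted-head x w s (get-∈ w p h)) g)) = s≤s (get≤⇒ w (sorted-tail x w s) k p h g)

⇒get≤ : ∀ w → Sorted w → ∀ k p → p < atMost k w → get 0 w (suc p) ≤ k
⇒get≤ (x ∷ w) s k p h with ≤-<-connex x k
⇒get≤ (x ∷ w) s k zero    h | inj₁ x≤k = x≤k
⇒get≤ (x ∷ w) s k (suc p) h | inj₁ x≤k rewrite lt-yes (s≤s x≤k) = ⇒get≤ w (sorted-tail x w s) k p (≤-pred h)
⇒get≤ (x ∷ w) s k p h | inj₂ k<x = ⊥-elim (n≮0 (subst (p <_) (atMost-none k (x ∷ w)
  (λ { (here refl) → k<x ; (there y∈) → <-≤-trans k<x (sorted-head x w s y∈) })) h))

-- If the heads differed, the smaller one would be missing from the other word.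
sorted-ext : ∀ u v → Sorted u → Sorted v → (∀ {x} → x ∈ u → 1 ≤ x) → (∀ {x} → x ∈ v → 1 ≤ x) →
             (∀ k → count (suc k) u ≡ count (suc k) v) → u ≡ v
sorted-ext []      []      _ _ _ _ _ = refl
sorted-ext []      (y ∷ v) _ _ _ pv h with y | pv (here refl) | h (pred y)
... | suc y' | _ | e = ⊥-elim (0≢1+n (trans e (trans (count-∷ (suc y') (suc y') v) (cong (_+ count (suc y') v) (eq-refl y')))))
sorted-ext (x ∷ u) []      _ _ pu _ h with x | pu (here refl) | h (pred x)
... | suc x' | _ | e = ⊥-elim (0≢1+n (sym (trans (sym (trans (count-∷ (suc x') (suc x') u) (cong (_+ count (suc x') u) (eq-refl x')))) e)))
sorted-ext (x ∷ u) (y ∷ v) su sv pu pv h = cong₂ _∷_ x≡y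
  (sorted-ext u v (sorted-tail x u su) (sorted-tail y v sv) (λ z∈ → pu (there z∈)) (λ z∈ → pv (there z∈))
    (λ k → +-cancelˡ-≡ (eq x (suc k)) _ _ (trans (sym (count-∷ (suc k) x u)) (trans (h k)
      (trans (count-∷ (suc k) y v) (cong (λ z → eq z (suc k) + count (suc k) v) (sym x≡y)))))))
  where
  absurd : ∀ x u y v → Sorted (y ∷ v) → 1 ≤ x → (∀ k → count (suc k) (x ∷ u) ≡ count (suc k) (y ∷ v)) → ¬ x < y
  absurd (suc x) u y v sv _ h x<y = 0≢1+n (trans (sym (count-zero (suc x) (y ∷ v)
      (λ { (here refl) e → <-irrefl (sym e) x<y ; (there z∈) e → <-irrefl (sym e) (<-≤-trans x<y (sorted-head y v sv z∈)) })))
    (trans (sym (h x)) (trans (count-∷ (suc x) (suc x) u) (cong (_+ count (suc x) u) (eq-refl x)))))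
  x≡y : x ≡ y
  x≡y with <-cmp x y
  ... | tri≈ _ e _ = e
  ... | tri< l _ _ = ⊥-elim (absurd x u y v sv (pu (here refl)) h l)
  ... | tri> _ _ g = ⊥-elim (absurd y v x u su (pv (here refl)) (λ k → sym (h k)) g)

sorted-split : ∀ m w → Sorted w → ∃ λ u → ∃ λ v → w ≡ u ++ v × (∀ {x} → x ∈ u → x ≤ m) × (∀ {x} → x ∈ v → m < x)
sorted-split m []      s = [] , [] , refl , (λ ()) , (λ ())
sorted-split m (x ∷ w) s with ≤-<-connex x m
... | inj₂ m<x = [] , x ∷ w , refl , (λ ()) , λ { (here refl) → m<x ; (there y∈) → <-≤-trans m<x (sorted-head x w s y∈) }
... | inj₁ x≤m with sorted-split m w (sorted-tail x w s)
...   | u , v , refl , hu , hv = x ∷ u , v , refl , (λ { (here refl) → x≤m ; (there y∈) → hu y∈ }) , hv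

sortedWord : (ℕ → ℕ) → ℕ → List ℕ
sortedWord f zero    = []
sortedWord f (suc m) = sortedWord f m ++ replicate (f m) (suc m)

∈-replicate : ∀ {n} {x y : ℕ} → y ∈ replicate n x → y ≡ x
∈-replicate {suc n} (here refl) = refl
∈-replicate {suc n} (there y∈)  = ∈-replicate y∈

sortedWord-within : ∀ f m → Within m (sortedWord f m)
sortedWord-within f (suc m) x∈ with ∈-++⁻ (sortedWord f m) x∈
... | inj₁ x∈' = proj₁ (sortedWord-within f m x∈') , m≤n⇒m≤1+n (proj₂ (sortedWord-within f m x∈'))
... | inj₂ x∈' rewrite ∈-replicate x∈' = s≤s z≤n , ≤-refl

replicate-sorted : ∀ n x → Sorted (replicate n x)
replicate-sorted zero    x = _
replicate-sorted (suc n) x = sorted-∷ x (replicate n x) (λ y∈ → ≤-reflexive (sym (∈-replicate y∈))) (replicate-sorted n x)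

sortedWord-sorted : ∀ f m → Sorted (sortedWord f m)
sortedWord-sorted f zero    = _
sortedWord-sorted f (suc m) = sorted-++ _ _ (sortedWord-sorted f m) (replicate-sorted (f m) (suc m))
  (λ x∈ y∈ → ≤-trans (m≤n⇒m≤1+n (proj₂ (sortedWord-within f m x∈))) (≤-reflexive (sym (∈-replicate y∈))))

sortedWord-length : ∀ f m → length (sortedWord f m) ≡ Σ< f m
sortedWord-length f zero    = refl
sortedWord-length f (suc m) = trans (length-++ (sortedWord f m)) (cong₂ _+_ (sortedWord-length f m) (length-replicate (f m)))

sortedWord-count : ∀ f m k → (m ≤ k → f k ≡ 0) → count (suc k) (sortedWord f m) ≡ f k
sortedWord-count f zero    k h = sym (h z≤n)
sortedWord-count f (suc m) k h with <-cmp k m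
... | tri< k<m _ _ = trans (count-++ (suc k) (sortedWord f m) _) (trans (cong₂ _+_
      (sortedWord-count f m k (λ m≤k → ⊥-elim (<⇒≱ k<m m≤k)))
      (count-zero (suc k) (replicate (f m) (suc m)) (λ y∈ e → <-irrefl (suc-injective (trans (sym e) (∈-replicate y∈))) k<m))) (+-identityʳ _))
... | tri≈ _ refl _ = trans (count-++ (suc k) (sortedWord f m) _) (cong₂ _+_
      (count-zero (suc k) _ (λ x∈ e → <-irrefl refl (≤-trans (≤-reflexive (sym e)) (proj₂ (sortedWord-within f m x∈)))))
      (count-replicate (suc k) (f k)))
... | tri> _ _ m<k = trans (count-zero (suc k) _ (λ x∈ e → <⇒≱ m<k (≤-pred (≤-trans (≤-reflexive (sym e)) (proj₂ (sortedWord-within f (suc m) x∈)))))) (sym (h m<k))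

-- Tableaux and arrays

∈-inits⁺ : ∀ {X : Set} (u v : List X) → u ∈ inits (u ++ v)
∈-inits⁺ []           v = here refl
∈-inits⁺ (x ∷ [])     v = there (here refl)
∈-inits⁺ (x ∷ y ∷ u) v with ∈-inits⁺ (y ∷ u) v
... | there yu∈ = there (there (∈-map⁺ (x ∷_) yu∈))

∈-inits⁻ : ∀ {X : Set} (w : List X) {u} → u ∈ inits w → ∃ λ v → w ≡ u ++ v
∈-inits⁻ w       (here refl) = w , refl
∈-inits⁻ (x ∷ w) (there (here refl)) = w , refl
∈-inits⁻ (x ∷ w) (there (there u∈)) with ∈-map⁻ (x ∷_) u∈
... | u , u∈' , refl with ∈-inits⁻ w (there u∈')
...   | v , refl = v , refl

++-split : ∀ {X : Set} (u z a b : List X) → u ++ z ≡ a ++ b → (∃ λ c → a ≡ u ++ c) ⊎ (∃ λ c → u ≡ a ++ c × b ≡ c ++ z)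
++-split []      z a       b e = inj₁ (a , refl)
++-split (x ∷ u) z []      b e = inj₂ (x ∷ u , refl , sym e)
++-split (x ∷ u) z (y ∷ a) b e with ∷-injectiveˡ e | ++-split u z a b (∷-injectiveʳ e)
... | refl | inj₁ (c , refl)        = inj₁ (c , refl)
... | refl | inj₂ (c , refl , refl) = inj₂ (c , refl , refl)

array : List (List ℕ) → Array
array Tab i k = count (suc k) (row Tab i)

prefix : List (List ℕ) → ℕ → List ℕ
prefix Tab i = reverseRowWord (take i Tab)

prefix-suc : ∀ Tab i → prefix Tab (suc i) ≡ prefix Tab i ++ reverse (row Tab i)
prefix-suc []        zero    = refl
prefix-suc []        (suc i) = refl
prefix-suc (w ∷ Tab) zero    = ++-identityʳ (reverse w)
prefix-suc (w ∷ Tab) (suc i) = trans (cong (reverse w ++_) (prefix-suc Tab i)) (sym (++-assoc (reverse w) (prefix Tab i) _))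

prefix-++ : ∀ Tab i → ∃ λ v → reverseRowWord Tab ≡ prefix Tab i ++ v
prefix-++ Tab i = reverseRowWord (drop i Tab) ,
  trans (cong reverseRowWord (sym (take++drop≡id i Tab))) (concatMap-++ reverse (take i Tab) (drop i Tab))

prefix-find : ∀ Tab {u v} → reverseRowWord Tab ≡ u ++ v → ∃ λ i → ∃ λ x → ∃ λ y → reverse (row Tab i) ≡ x ++ y × u ≡ prefix Tab i ++ x
prefix-find []        {[]} e = 0 , [] , [] , refl , refl
prefix-find (w ∷ Tab) {u} {v} e with ++-split u v (reverse w) (reverseRowWord Tab) (sym e)
... | inj₁ (c , e')         = 0 , u , c , e' , refl
... | inj₂ (c , refl , e') with prefix-find Tab {c} {v} e'
...   | i , x , y , e₁ , refl = suc i , x , y , e₁ , sym (++-assoc (reverse w) (prefix Tab i) x)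

mult-prefix : ∀ Tab i k → mult (array Tab) i k ≡ count (suc k) (prefix Tab i)
mult-prefix Tab zero    k = refl
mult-prefix Tab (suc i) k = sym (trans (cong (count (suc k)) (prefix-suc Tab i)) (trans (count-++ (suc k) (prefix Tab i) _)
  (cong₂ _+_ (sym (mult-prefix Tab i k)) (count-reverse (suc k) (row Tab i)))))

count-≤-++ : ∀ k u v → count k u ≤ count k (u ++ v)
count-≤-++ k u v = ≤-trans (m≤m+n _ _) (≤-reflexive (sym (count-++ k u v)))

-- The test is applied to the prefix that stops in row `i + 1` just after its entries above `k + 1`:
-- it contains all entries `k + 2` and no entry `k + 1` of that row.
lattice⇒ : ∀ {N} Tab → (∀ i → Sorted (row Tab i)) → (∀ i → Within N (row Tab i)) → T (isLattice N (reverseRowWord Tab)) →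
           ∀ i k → mult (array Tab) (suc i) (suc k) ≤ mult (array Tab) i k
lattice⇒ {N} Tab sorted within h i k with ≤-<-connex (suc k) N
... | inj₂ N<k = ≤-trans (≤-reflexive (Σ<-zero (suc i) (λ j _ → count-zero (suc (suc k)) (row Tab j)
        (λ x∈ e → <⇒≱ N<k (≤-trans (n≤1+n (suc k)) (≤-trans (≤-reflexive (sym e)) (proj₂ (within j x∈)))))))) z≤n
... | inj₁ k≤N with sorted-split (suc k) (row Tab i) (sorted i)
...   | x , y , e , x≤ , y> = begin
  mult (array Tab) i (suc k) + count (suc (suc k)) (row Tab i)  ≡⟨ cong₂ _+_ (mult-prefix Tab i (suc k)) big ⟩
  count (suc (suc k)) P + count (suc (suc k)) (reverse y)       ≡⟨ sym (count-++ (suc (suc k)) P (reverse y)) ⟩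
  count (suc (suc k)) (P ++ reverse y)                          ≤⟨ ≤ᵇ⇒≤ _ _ (all⁻ _ (fromTo 1 N) (all⁻ _ (inits (reverseRowWord Tab)) h
                                                                     (subst (λ z → P ++ reverse y ∈ inits z) (sym word) (∈-inits⁺ (P ++ reverse y) _)))
                                                                     (∈-fromTo⁺ (s≤s z≤n) k≤N)) ⟩
  count (suc k) (P ++ reverse y)                                ≡⟨ count-++ (suc k) P (reverse y) ⟩
  count (suc k) P + count (suc k) (reverse y)                   ≡⟨ cong₂ _+_ (sym (mult-prefix Tab i k)) small ⟩
  mult (array Tab) i k + 0                                      ≡⟨ +-identityʳ _ ⟩
  mult (array Tab) i k                                          ∎
  where
  open ≤-Reasoning
  P = prefix Tab i
  big : count (suc (suc k)) (row Tab i) ≡ count (suc (suc k)) (reverse y)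
  big = trans (cong (count (suc (suc k))) e) (trans (count-++ (suc (suc k)) x y)
    (cong₂ _+_ (count-zero (suc (suc k)) x (λ x∈ e → <-irrefl refl (≤-trans (≤-reflexive (sym e)) (x≤ x∈)))) (sym (count-reverse (suc (suc k)) y))))
  small : count (suc k) (reverse y) ≡ 0
  small = trans (count-reverse (suc k) y) (count-zero (suc k) y (λ y∈ e → <-irrefl (sym e) (y> y∈)))
  word : reverseRowWord Tab ≡ (P ++ reverse y) ++ (reverse x ++ proj₁ (prefix-++ Tab (suc i)))
  word = trans (proj₂ (prefix-++ Tab (suc i))) (trans (cong (_++ rest) (trans (prefix-suc Tab i)
      (trans (cong (λ z → P ++ reverse z) e) (trans (cong (P ++_) (reverse-++ x y)) (sym (++-assoc P (reverse y) (reverse x)))))))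
    (++-assoc (P ++ reverse y) (reverse x) rest))
    where rest = proj₁ (prefix-++ Tab (suc i))

-- A prefix stops inside some row. Its entries `k + 2` are at most those up to the end of this row,
-- its entries `k + 1` at least those of the rows before.
⇒lattice : ∀ N Tab → (∀ i k → mult (array Tab) (suc i) (suc k) ≤ mult (array Tab) i k) → T (isLattice N (reverseRowWord Tab))
⇒lattice N Tab latt = all⁺ _ (inits (reverseRowWord Tab)) (λ u∈ → all⁺ _ (fromTo 1 N) (λ k∈ → ≤⇒≤ᵇ (check u∈ (proj₁ (∈-fromTo⁻ k∈)))))
  where
  check : ∀ {u k} → u ∈ inits (reverseRowWord Tab) → 1 ≤ k → count (suc k) u ≤ count k u
  check {u} {suc k} u∈ _ with ∈-inits⁻ (reverseRowWord Tab) u∈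
  ... | v , e with prefix-find Tab {u} {v} e
  ...   | i , x , y , e₁ , refl = begin
    count (suc (suc k)) (prefix Tab i ++ x)                         ≡⟨ count-++ (suc (suc k)) (prefix Tab i) x ⟩
    count (suc (suc k)) (prefix Tab i) + count (suc (suc k)) x      ≤⟨ ≤-reflexive (sym (mult-prefix Tab i (suc k))) ⊕ part ⟩
    mult (array Tab) (suc i) (suc k)                                ≤⟨ latt i k ⟩
    mult (array Tab) i k                                            ≡⟨ mult-prefix Tab i k ⟩
    count (suc k) (prefix Tab i)                                    ≤⟨ count-≤-++ (suc k) (prefix Tab i) x ⟩
    count (suc k) (prefix Tab i ++ x)                               ∎
    where
    open ≤-Reasoning
    part : count (suc (suc k)) x ≤ count (suc (suc k)) (row Tab i)
    part = ≤-trans (count-≤-++ (suc (suc k)) x y) (≤-reflexive (trans (cong (count (suc (suc k))) (sym e₁)) (count-reverse (suc (suc k)) (row Tab i))))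

module Translation (α β : List ℕ) (sk : Skew (λ i → α ! suc i) (λ i → β ! suc i)) where
  open Skew sk
  A B : ℕ → ℕ
  A i = α ! suc i
  B i = β ! suc i
  n = length α

  A-vanishes : ∀ i → n ≤ i → A i ≡ 0
  A-vanishes = get-beyond 0 α

  rowLengths : List ℕ
  rowLengths = map (λ i → α ! i ∸ β ! i) (fromTo 1 n)

  rowLengths≡ : rowLengths ≡ applyUpTo (λ i → A i ∸ B i) n
  rowLengths≡ = trans (cong (map _) (map-upTo suc n)) (map-applyUpTo suc (λ i → α ! i ∸ β ! i) n)

  get-rowLengths : ∀ i → get 0 rowLengths (suc i) ≡ A i ∸ B i
  get-rowLengths i rewrite rowLengths≡ with <-≤-connex i n
  ... | inj₁ i<n = get-applyUpTo 0 (λ i → A i ∸ B i) i i<n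
  ... | inj₂ n≤i = trans (get-beyond 0 (applyUpTo (λ i → A i ∸ B i) n) i (≤-trans (≤-reflexive (length-applyUpTo (λ i → A i ∸ B i) n)) n≤i))
                     (sym (trans (cong (_∸ B i) (A-vanishes i n≤i)) (0∸n≡0 (B i))))

  record IsFilling (N : ℕ) (Tab : List (List ℕ)) : Set where
    field
      height  : length Tab ≡ n
      lengths : ∀ i → length (row Tab i) ≡ A i ∸ B i
      within  : ∀ i → Within N (row Tab i)

  ∈-fillings⁻ : ∀ {N Tab} → Tab ∈ fillings α β N → IsFilling N Tab
  ∈-fillings⁻ Tab∈ with ∈-fillingsRows⁻ rowLengths Tab∈
  ... | len , rows = record
    { height = trans len (trans (cong length rowLengths≡) (length-applyUpTo _ n))
    ; lengths = λ i → trans (proj₁ (rows i)) (get-rowLengths i) ; within = λ i → proj₂ (rows i) }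

  ∈-fillings⁺ : ∀ {N Tab} → IsFilling N Tab → Tab ∈ fillings α β N
  ∈-fillings⁺ f = ∈-fillingsRows⁺ rowLengths _ (trans height (sym (trans (cong length rowLengths≡) (length-applyUpTo _ n))))
      (λ i → trans (lengths i) (sym (get-rowLengths i))) within
    where open IsFilling f

  module _ {N : ℕ} {Tab : List (List ℕ)} (f : IsFilling N Tab) (sorted : ∀ i → Sorted (row Tab i)) where
    open IsFilling f

    end-atMost : ∀ i k → end B (array Tab) i k ≡ B i + atMost k (row Tab i)
    end-atMost i k = cong (B i +_) (atMost-Σ k (row Tab i) (within i))

    atMost≤length : ∀ k w → atMost k w ≤ length w
    atMost≤length k []      = z≤n
    atMost≤length k (x ∷ w) = lt≤1 x (suc k) ⊕ atMost≤length k w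

    end≤ : ∀ i k → end B (array Tab) i k ≤ A i
    end≤ i k = ≤-trans (≤-reflexive (end-atMost i k)) (≤-trans (+-monoʳ-≤ (B i) (atMost≤length k (row Tab i)))
      (≤-reflexive (trans (cong (B i +_) (lengths i)) (m+[n∸m]≡n (B≤A i)))))

    Cell : ℕ → ℕ → Set
    Cell i j = T (if (B (suc i) <ᵇ j) ∧ (j ≤ᵇ A (suc i))
                  then entry β Tab (suc i) j <ᵇ entry β Tab (suc (suc i)) j else true)

    cell⇒ : ∀ {i j} → B (suc i) < j → j ≤ A (suc i) → Cell i j → entry β Tab (suc i) j < entry β Tab (suc (suc i)) j
    cell⇒ {i} {j} p q h with (B (suc i) <ᵇ j) in e₁ | (j ≤ᵇ A (suc i)) in e₂
    ... | true  | true  = <ᵇ⇒< _ _ h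
    ... | false | _     = ⊥-elim (subst T e₁ (<⇒<ᵇ p))
    ... | true  | false = ⊥-elim (subst T e₂ (≤⇒≤ᵇ q))

    ⇒cell : ∀ {i j} → (B (suc i) < j → j ≤ A (suc i) → entry β Tab (suc i) j < entry β Tab (suc (suc i)) j) → Cell i j
    ⇒cell {i} {j} h with (B (suc i) <ᵇ j) in e₁ | (j ≤ᵇ A (suc i)) in e₂
    ... | true  | true  = <⇒<ᵇ (h (<ᵇ⇒< _ _ (subst T (sym e₁) _)) (≤ᵇ⇒≤ _ _ (subst T (sym e₂) _)))
    ... | false | _     = _
    ... | true  | false = _

    entry-≤ : ∀ {i j k} → B i < j → j ≤ end B (array Tab) i k → entry β Tab (suc i) j ≤ k
    entry-≤ {i} {j} {k} B<j j≤ with j ∸ B i in e | m+[n∸m]≡n (<⇒≤ B<j)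
    ... | zero  | j≡ = ⊥-elim (<-irrefl (trans (sym (+-identityʳ (B i))) j≡) B<j)
    ... | suc p | j≡ = ⇒get≤ (row Tab i) (sorted i) k p (+-cancelˡ-≤ (B i) _ _
          (≤-trans (≤-reflexive j≡) (≤-trans j≤ (≤-reflexive (end-atMost i k)))))

    ≤-entry : ∀ {i j k} → B i < j → j ≤ A i → entry β Tab (suc i) j ≤ k → j ≤ end B (array Tab) i k
    ≤-entry {i} {j} {k} B<j j≤A h with j ∸ B i in e | m+[n∸m]≡n (<⇒≤ B<j)
    ... | zero  | j≡ = ⊥-elim (<-irrefl (trans (sym (+-identityʳ (B i))) j≡) B<j)
    ... | suc p | j≡ = ≤-trans (≤-reflexive (sym j≡)) (≤-trans (+-monoʳ-≤ (B i) (get≤⇒ (row Tab i) (sorted i) k p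
          (≤-trans (≤-reflexive (sym e)) (≤-trans (∸-monoˡ-≤ (B i) j≤A) (≤-reflexive (sym (lengths i))))) h))
          (≤-reflexive (sym (end-atMost i k))))

    -- If the inequality failed, the column just after `end B (array Tab) i k` would hold an entry
    -- above `k` in the upper row and an entry of at most `k + 1` in the lower one.
    columns⇒ : (∀ i j → i < n → B i < j → j ≤ A i → Cell i j) → ∀ i k → end B (array Tab) (suc i) (suc k) ≤ end B (array Tab) i k
    columns⇒ h i k with ≤-<-connex (end B (array Tab) (suc i) (suc k)) (end B (array Tab) i k)
    ... | inj₁ g = g
    ... | inj₂ g = ⊥-elim (<⇒≱ (cell⇒ B₁<j j≤A₁ (h i j i<n B<j (≤-trans j≤A₁ (A↓ i)))) (≤-trans (entry-≤ B₁<j g) k<))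
      where
      j = suc (end B (array Tab) i k)
      B<j : B i < j
      B<j = s≤s (m≤m+n (B i) _)
      B₁<j : B (suc i) < j
      B₁<j = ≤-<-trans (B↓ i) B<j
      j≤A₁ : j ≤ A (suc i)
      j≤A₁ = ≤-trans g (end≤ (suc i) (suc k))
      i<n : i < n
      i<n with <-≤-connex i n
      ... | inj₁ x = x
      ... | inj₂ x = ⊥-elim (n≮0 (subst (j ≤_) (A-vanishes i x) (≤-trans j≤A₁ (A↓ i))))
      k< : suc k ≤ entry β Tab (suc i) j
      k< with ≤-<-connex (entry β Tab (suc i) j) k
      ... | inj₂ x = x
      ... | inj₁ x = ⊥-elim (<-irrefl refl (≤-entry B<j (≤-trans j≤A₁ (A↓ i)) x))

    ⇒columns : (∀ i k → end B (array Tab) (suc i) (suc k) ≤ end B (array Tab) i k) → ∀ i j → B i < j → j ≤ A i → Cell i j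
    ⇒columns cols i j B<j j≤A = ⇒cell check
      where
      check : B (suc i) < j → j ≤ A (suc i) → entry β Tab (suc i) j < entry β Tab (suc (suc i)) j
      check p q with entry β Tab (suc (suc i)) j in e
      -- An entry 0 is only the default of `get`; it would put `j` into the inner shape.
      ... | zero  = ⊥-elim (<⇒≱ p (≤-trans (≤-entry p q (≤-reflexive e)) (≤-reflexive (+-identityʳ (B (suc i))))))
      ... | suc k = s≤s (entry-≤ B<j (≤-trans (≤-entry p q (≤-reflexive e)) (cols i k)))

-- Contents as partitions

Σ<-front : ∀ f n → Σ< f (suc n) ≡ f 0 + Σ< (λ i → f (suc i)) n
Σ<-front f zero    = +-comm 0 (f 0)
Σ<-front f (suc n) = trans (cong (_+ f (suc n)) (Σ<-front f n)) (+-assoc (f 0) _ _)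

Σ<-sum : ∀ xs → Σ< (λ i → xs ! suc i) (length xs) ≡ sum xs
Σ<-sum []       = refl
Σ<-sum (x ∷ xs) = trans (Σ<-front (λ i → (x ∷ xs) ! suc i) (length xs)) (cong (x +_) (Σ<-sum xs))

Σ<-swap : ∀ (t : Array) m n → Σ< (λ k → Σ< (λ i → t i k) m) n ≡ Σ< (λ i → Σ< (λ k → t i k) n) m
Σ<-swap t m zero    = sym (Σ<-zero m (λ _ _ → refl))
Σ<-swap t m (suc n) = trans (cong (_+ Σ< (λ i → t i n) m) (Σ<-swap t m n)) (sym (Σ<-+ (λ i → Σ< (t i) n) (λ i → t i n) m))

isPartition⁺ : ∀ xs → (∀ {x} → x ∈ xs → 1 ≤ x) → (∀ i → xs ! suc (suc i) ≤ xs ! suc i) → IsPartition xs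
isPartition⁺ []           pos dec = _
isPartition⁺ (x ∷ [])     pos dec = <⇒<ᵇ (pos (here refl))
isPartition⁺ (x ∷ y ∷ xs) pos dec = ∧⁺ (≤⇒≤ᵇ (dec 0)) (isPartition⁺ (y ∷ xs) (λ z∈ → pos (there z∈)) (λ i → dec (suc i)))

-- Partitions are lists of positive parts, so the multiplicities of a tableau are cut at the first
-- zero.
trim : (ℕ → ℕ) → ℕ → List ℕ
trim f zero    = []
trim f (suc m) with f 0
... | zero  = []
... | suc x = suc x ∷ trim (λ i → f (suc i)) m

trim-positive : ∀ f m {x} → x ∈ trim f m → 1 ≤ x
trim-positive f (suc m) x∈ with f 0
trim-positive f (suc m) (here refl) | suc x = s≤s z≤n
trim-positive f (suc m) (there x∈)  | suc x = trim-positive (λ i → f (suc i)) m x∈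

trim-get : ∀ f m → Decreasing f → Vanishes m f → ∀ k → trim f m ! suc k ≡ f k
trim-get f zero    d v k = sym (v k z≤n)
trim-get f (suc m) d v k with f 0 in e
... | zero = sym (n≤0⇒n≡0 (≤-trans (antitone d z≤n) (≤-reflexive e)))
trim-get f (suc m) d v zero    | suc x = sym e
trim-get f (suc m) d v (suc k) | suc x = trim-get (λ i → f (suc i)) m (λ i → d (suc i)) (λ i h → v (suc i) (s≤s h)) k

trim-sum : ∀ f m → Decreasing f → sum (trim f m) ≡ Σ< f m
trim-sum f zero    d = refl
trim-sum f (suc m) d with f 0 in e
... | zero  = sym (Σ<-zero (suc m) (λ i _ → n≤0⇒n≡0 (≤-trans (antitone d z≤n) (≤-reflexive e))))
... | suc x = trans (cong₂ _+_ (sym e) (trim-sum (λ i → f (suc i)) m (λ i → d (suc i)))) (sym (Σ<-front f m))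

∈⇒≤sum : ∀ xs {x} → x ∈ xs → x ≤ sum xs
∈⇒≤sum (y ∷ xs) (here refl) = m≤m+n y _
∈⇒≤sum (y ∷ xs) (there x∈)  = ≤-trans (∈⇒≤sum xs x∈) (m≤n+m _ y)

length≤sum : ∀ xs → (∀ {x} → x ∈ xs → 1 ≤ x) → length xs ≤ sum xs
length≤sum []       pos = z≤n
length≤sum (x ∷ xs) pos = pos (here refl) ⊕ length≤sum xs (λ y∈ → pos (there y∈))

partitionsOf-unique : ∀ s → Unique (partitionsOf s)
partitionsOf-unique s = Uniqueₚ.filter⁺ (λ ν → T? (isPartition ν ∧ (sum ν ≡ᵇ s))) (Uniqueₚ.concat⁺ (Allₚ.map⁺ (All.universal (words-unique s) (fromTo 0 s)))
  (AllPairsₚ.map⁺ (AllPairs.map disjoint (fromTo-unique 0 s))))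
  where
  disjoint : ∀ {a b} → a ≢ b → ∀ {w} → ¬ (w ∈ words s a × w ∈ words s b)
  disjoint {a} {b} a≢b (p , q) = a≢b (trans (sym (proj₁ (∈-words⁻ a p))) (proj₁ (∈-words⁻ b q)))

∈-partitionsOf⁺ : ∀ xs → IsPartition xs → (∀ {x} → x ∈ xs → 1 ≤ x) → xs ∈ partitionsOf (sum xs)
∈-partitionsOf⁺ xs part pos = ∈-filter⁺ (λ ν → T? (isPartition ν ∧ (sum ν ≡ᵇ sum xs)))
  (∈-concatMap⁺ (words (sum xs)) (lose (∈-fromTo⁺ z≤n (length≤sum xs pos)) (∈-words⁺ xs (λ x∈ → pos x∈ , ∈⇒≤sum xs x∈))))
  (∧⁺ part (≡⇒≡ᵇ (sum xs) (sum xs) refl))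

∈-partitionsOf⁻ : ∀ s {xs} → xs ∈ partitionsOf s → ∀ {x} → x ∈ xs → 1 ≤ x
∈-partitionsOf⁻ s {xs} xs∈ x∈ with find (∈-concatMap⁻ (words s) {xs = fromTo 0 s} (proj₁ (∈-filter⁻ (λ ν → T? (isPartition ν ∧ (sum ν ≡ᵇ s))) {xs = listsUpTo s s} xs∈)))
... | l , _ , w∈ = proj₁ (proj₂ (∈-words⁻ l w∈) x∈)

positive-ext : ∀ xs ys → (∀ {x} → x ∈ xs → 1 ≤ x) → (∀ {x} → x ∈ ys → 1 ≤ x) → (∀ k → xs ! suc k ≡ ys ! suc k) → xs ≡ ys
positive-ext []       []       _  _  _ = refl
positive-ext []       (y ∷ ys) _  py h = ⊥-elim (<-irrefl (h 0) (py (here refl)))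
positive-ext (x ∷ xs) []       px _  h = ⊥-elim (<-irrefl (sym (h 0)) (px (here refl)))
positive-ext (x ∷ xs) (y ∷ ys) px py h = cong₂ _∷_ (h 0) (positive-ext xs ys (λ z → px (there z)) (λ z → py (there z)) (λ k → h (suc k)))

distinct-map : ∀ {X : Set} (f : X → Array) {xs} → Unique xs → (∀ {x y} → x ∈ xs → y ∈ xs → f x ≗₂ f y → x ≡ y) →
               AllPairs (λ t t' → ¬ t ≗₂ t') (map f xs)
distinct-map f AllPairs.[]       inj = AllPairs.[]
distinct-map f (x∉ AllPairs.∷ u) inj =
  Allₚ.map⁺ (All.tabulate (λ y∈ e → All.lookup x∉ y∈ (inj (here refl) (there y∈) e))) AllPairs.∷
  distinct-map f u (λ x∈ y∈ → inj (there x∈) (there y∈))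

-- Littlewood-Richardson coefficients as numbers of arrays

module _ (α β : List ℕ) (sk : Skew (λ i → α ! suc i) (λ i → β ! suc i)) where
  open Skew sk
  open Translation α β sk

  WithContent : List ℕ → Array → Set
  WithContent ν t = LR A B t × (∀ k → mult t n k ≡ ν ! suc k)

  row-sorted : ∀ Tab → T (Bool.all weaklyIncreasing Tab) → ∀ i → Sorted (row Tab i)
  row-sorted []        h i       = _
  row-sorted (w ∷ Tab) h zero    = proj₁ (∧⁻ h)
  row-sorted (w ∷ Tab) h (suc i) = row-sorted Tab (proj₂ (∧⁻ {weaklyIncreasing w} h)) i

  sorted-rows : ∀ Tab → (∀ i → Sorted (row Tab i)) → T (Bool.all weaklyIncreasing Tab)
  sorted-rows []        h = _
  sorted-rows (w ∷ Tab) h = ∧⁺ (h 0) (sorted-rows Tab (λ i → h (suc i)))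

  whole : ∀ {N Tab} → IsFilling N Tab → prefix Tab n ≡ reverseRowWord Tab
  whole {Tab = Tab} f = cong reverseRowWord (take-all n Tab (≤-reflexive (IsFilling.height f)))

  module _ {ν : List ℕ} {Tab : List (List ℕ)} (f : IsFilling (length ν) Tab) where
    open IsFilling f

    large-zero : ∀ i k → length ν ≤ k → array Tab i k ≡ 0
    large-zero i k h = count-zero (suc k) (row Tab i) (λ x∈ e → <⇒≱ (s≤s h) (≤-trans (≤-reflexive (sym e)) (proj₂ (within i x∈))))

    tableau⇒ : T (isLRTableau α β ν Tab) → (∀ i → Sorted (row Tab i)) × WithContent ν (array Tab)
    tableau⇒ h = sorted , record { rows = rows ; cols = cols ; latt = latt } , content
      where
      ssyt = proj₁ (∧⁻ {isSSYT α β Tab} h)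
      rest = proj₂ (∧⁻ {isSSYT α β Tab} h)
      sorted : ∀ i → Sorted (row Tab i)
      sorted = row-sorted Tab (proj₁ (∧⁻ {Bool.all weaklyIncreasing Tab} ssyt))
      cols : ∀ i k → end B (array Tab) (suc i) (suc k) ≤ end B (array Tab) i k
      cols = columns⇒ f sorted (λ i j i<n B<j j≤A → all⁻ _ (fromTo (suc (B i)) (A i))
        (all⁻ _ (fromTo 1 n) (proj₂ (∧⁻ {Bool.all weaklyIncreasing Tab} ssyt)) (∈-fromTo⁺ (s≤s z≤n) i<n)) (∈-fromTo⁺ B<j j≤A))
      latt : ∀ i k → mult (array Tab) (suc i) (suc k) ≤ mult (array Tab) i k
      latt = lattice⇒ Tab sorted within (proj₁ (∧⁻ rest))
      small-zero : ∀ i k → suc i ≤ k → array Tab i k ≡ 0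
      small-zero i k i<k = n≤0⇒n≡0 (subst (array Tab i k ≤_) (lattice⇒mult-zero {array Tab} latt i<k) (m≤n+m _ _))
      rows : ∀ i → end B (array Tab) i (suc i) ≡ A i
      -- Entries are bounded by `length ν` and, through the lattice condition, by `i + 1`. Neither
      -- bound need be the smaller one, so both sums are compared with a common longer one.
      rows i = begin
        B i + Σ< (array Tab i) (suc i)               ≡⟨ cong (B i +_) (sym (Σ<-stable (array Tab i) (m≤n+m (suc i) (length ν)) (small-zero i))) ⟩
        B i + Σ< (array Tab i) (length ν + suc i)    ≡⟨ cong (B i +_) (Σ<-stable (array Tab i) (m≤m+n (length ν) (suc i)) (large-zero i)) ⟩
        B i + Σ< (array Tab i) (length ν)            ≡⟨ cong (B i +_) (atMost-Σ (length ν) (row Tab i) (within i)) ⟩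
        B i + atMost (length ν) (row Tab i)          ≡⟨ cong (B i +_) (trans (atMost-all (row Tab i) (within i)) (lengths i)) ⟩
        B i + (A i ∸ B i)                            ≡⟨ m+[n∸m]≡n (B≤A i) ⟩
        A i                                          ∎
        where open ≡-Reasoning
      content : ∀ k → mult (array Tab) n k ≡ ν ! suc k
      content k with <-≤-connex k (length ν)
      ... | inj₁ k<N = trans (mult-prefix Tab n k) (trans (cong (count (suc k)) (whole f))
              (≡ᵇ⇒≡ _ _ (all⁻ _ (fromTo 1 (length ν)) (proj₂ (∧⁻ {isLattice (length ν) (reverseRowWord Tab)} rest)) (∈-fromTo⁺ (s≤s z≤n) k<N))))
      ... | inj₂ N≤k = trans (Σ<-zero n (λ i _ → large-zero i k N≤k)) (sym (get-beyond 0 ν k N≤k))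

    ⇒tableau : (∀ i → Sorted (row Tab i)) → WithContent ν (array Tab) → T (isLRTableau α β ν Tab)
    ⇒tableau sorted (l , content) = ∧⁺ (∧⁺ (sorted-rows Tab sorted)
        (all⁺ _ (fromTo 1 n) (λ i∈ → all⁺ _ (fromTo _ _) (λ j∈ → cell (proj₁ (∈-fromTo⁻ i∈)) (∈-fromTo⁻ j∈)))))
      (∧⁺ (⇒lattice (length ν) Tab (LR.latt l)) (all⁺ _ (fromTo 1 (length ν)) (λ k∈ → good (proj₁ (∈-fromTo⁻ k∈)))))
      where
      cell : ∀ {i j} → 1 ≤ i → suc (β ! i) ≤ j × j ≤ α ! i →
             T (if (β ! suc i <ᵇ j) ∧ (j ≤ᵇ α ! suc i) then entry β Tab i j <ᵇ entry β Tab (suc i) j else true)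
      cell {suc i} {j} _ (p , q) = ⇒columns f sorted (LR.cols l) i j p q
      good : ∀ {k} → 1 ≤ k → T (count k (reverseRowWord Tab) ≡ᵇ ν ! k)
      good {suc k} _ = ≡⇒≡ᵇ _ _ (trans (cong (count (suc k)) (sym (whole f))) (trans (sym (mult-prefix Tab n k)) (content k)))

  -- A tableau is recovered from its array because its rows are sorted; conversely the sorted words
  -- with the prescribed multiplicities form a tableau.
  counts-content : ∀ ν → Counts (c α β ν) (WithContent ν)
  counts-content ν = record
    { elements = map array tableaux
    ; size = length-map array tableaux
    ; sound = Allₚ.map⁺ (All.tabulate (λ Tab∈ → proj₂ (valid Tab∈)))
    ; distinct = distinct-map array (Uniqueₚ.filter⁺ (λ Tab → T? (isLRTableau α β ν Tab)) (fillingsRows-unique (length ν) rowLengths)) injective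
    ; complete = complete }
    where
    tableaux = filterᵇ (isLRTableau α β ν) (fillings α β (length ν))
    ∈-tableaux : ∀ {Tab} → Tab ∈ tableaux → Tab ∈ fillings α β (length ν) × T (isLRTableau α β ν Tab)
    ∈-tableaux = ∈-filter⁻ (λ Tab → T? (isLRTableau α β ν Tab))
    valid : ∀ {Tab} → Tab ∈ tableaux → (∀ i → Sorted (row Tab i)) × WithContent ν (array Tab)
    valid {Tab} Tab∈ = tableau⇒ {ν} (∈-fillings⁻ (proj₁ (∈-tableaux Tab∈))) (proj₂ (∈-tableaux Tab∈))
    injective : ∀ {Tab Tab'} → Tab ∈ tableaux → Tab' ∈ tableaux → array Tab ≗₂ array Tab' → Tab ≡ Tab'
    injective {Tab} {Tab'} p p' e = get-ext [] Tab Tab' (trans (IsFilling.height f) (sym (IsFilling.height f')))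
      (λ i → sorted-ext (row Tab i) (row Tab' i) (proj₁ (valid p) i) (proj₁ (valid p') i)
        (λ x∈ → proj₁ (IsFilling.within f i x∈)) (λ x∈ → proj₁ (IsFilling.within f' i x∈)) (e i))
      where
      f = ∈-fillings⁻ (proj₁ (∈-tableaux p))
      f' = ∈-fillings⁻ (proj₁ (∈-tableaux p'))
    complete : ∀ {t} → WithContent ν t → Any (t ≗₂_) (map array tableaux)
    complete {t} (l , content) = Anyₚ.map⁺ (lose (∈-filter⁺ (λ Tab → T? (isLRTableau α β ν Tab)) (∈-fillings⁺ f)
        (⇒tableau {ν} f sorted (LR-resp (λ _ → refl) (λ _ → refl) (λ i k → sym (array≡ i k)) l ,
          λ k → trans (Σ<-cong n (λ i _ → array≡ i k)) (content k))))
        (λ i k → sym (array≡ i k)))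
      where
      N = length ν
      Tab = applyUpTo (λ i → sortedWord (t i) N) n
      t-beyond : ∀ i k → n ≤ i → t i k ≡ 0
      t-beyond i k n≤i with ≤-<-connex k i
      ... | inj₂ i<k = entry-zero l i<k
      ... | inj₁ k≤i = n≤0⇒n≡0 (≤-trans (≤-trans (m≤n+m (t i k) (B i + Σ< (t i) k)) (≤-reflexive (+-assoc (B i) _ _)))
              (≤-trans (end≤A l i (suc k)) (≤-reflexive (A-vanishes i n≤i))))
      t-large : ∀ i k → N ≤ k → t i k ≡ 0
      t-large i k N≤k with <-≤-connex i n
      ... | inj₂ n≤i = t-beyond i k n≤i
      ... | inj₁ i<n = n≤0⇒n≡0 (≤-trans (≤-trans (m≤n+m (t i k) _) (Σ<-extend (λ j → t j k) i<n))
              (≤-reflexive (trans (content k) (get-beyond 0 ν k N≤k))))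
      row-inside : ∀ {i} → i < n → row Tab i ≡ sortedWord (t i) N
      row-inside {i} i<n = get-applyUpTo [] (λ i → sortedWord (t i) N) i i<n
      row-outside : ∀ {i} → n ≤ i → row Tab i ≡ []
      row-outside {i} n≤i = get-beyond [] Tab i (≤-trans (≤-reflexive (length-applyUpTo (λ i → sortedWord (t i) N) n)) n≤i)
      array≡ : ∀ i k → array Tab i k ≡ t i k
      array≡ i k with <-≤-connex i n
      ... | inj₁ i<n = trans (cong (count (suc k)) (row-inside i<n)) (sortedWord-count (t i) N k (t-large i k))
      ... | inj₂ n≤i = trans (cong (count (suc k)) (row-outside n≤i)) (sym (t-beyond i k n≤i))
      sorted : ∀ i → Sorted (row Tab i)
      sorted i with <-≤-connex i n
      ... | inj₁ i<n = subst Sorted (sym (row-inside i<n)) (sortedWord-sorted (t i) N)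
      ... | inj₂ n≤i = subst Sorted (sym (row-outside n≤i)) _
      f : IsFilling N Tab
      f = record { height = length-applyUpTo (λ i → sortedWord (t i) N) n ; lengths = lengths ; within = within }
        where
        lengths : ∀ i → length (row Tab i) ≡ A i ∸ B i
        lengths i with <-≤-connex i n
        ... | inj₂ n≤i = trans (cong length (row-outside n≤i)) (sym (trans (cong (_∸ B i) (A-vanishes i n≤i)) (0∸n≡0 (B i))))
        ... | inj₁ i<n = trans (cong length (row-inside i<n)) (trans (sortedWord-length (t i) N) (trans
              (trans (sym (Σ<-stable (t i) (m≤m+n N (suc i)) (t-large i))) (Σ<-stable (t i) (m≤n+m (suc i) N) (λ k → entry-zero l)))
              (trans (sym (m+n∸m≡n (B i) _)) (cong (_∸ B i) (LR.rows l i)))))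
        within : ∀ i → Within N (row Tab i)
        within i {x} with <-≤-connex i n
        ... | inj₁ i<n = subst (λ w → x ∈ w → 1 ≤ x × x ≤ N) (sym (row-inside i<n)) (sortedWord-within (t i) N)
        ... | inj₂ n≤i = subst (λ w → x ∈ w → 1 ≤ x × x ≤ N) (sym (row-outside n≤i)) (λ ())

  -- The classes are disjoint: lists of positive numbers with the same parts are equal, so an array
  -- has only one content in `νs`.
  counts-sum : ∀ νs → Unique νs → (∀ {ν} → ν ∈ νs → ∀ {x} → x ∈ ν → 1 ≤ x) →
               Counts (sum (map (c α β) νs)) (λ t → Any (λ ν → WithContent ν t) νs)
  counts-sum []       u pos = record
    { elements = [] ; size = refl ; sound = All.[] ; distinct = AllPairs.[] ; complete = λ () }
  counts-sum (ν ∷ νs) (ν∉ AllPairs.∷ u) pos = record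
    { elements = C.elements ++ D.elements
    ; size = trans (length-++ C.elements) (cong₂ _+_ C.size D.size)
    ; sound = Allₚ.++⁺ (All.map here C.sound) (All.map there D.sound)
    ; distinct = AllPairsₚ.++⁺ C.distinct D.distinct (All.map (λ p → All.map (λ q e → clash p q e) D.sound) C.sound)
    ; complete = λ { (here p) → Anyₚ.++⁺ˡ (C.complete p) ; (there q) → Anyₚ.++⁺ʳ C.elements (D.complete q) } }
    where
    module C = Counts (counts-content ν)
    module D = Counts (counts-sum νs u (λ ν∈ → pos (there ν∈)))
    clash : ∀ {t t'} → WithContent ν t → Any (λ ν → WithContent ν t') νs → ¬ t ≗₂ t'
    clash (_ , content) q e with find q
    ... | ν' , ν'∈ , (_ , content') = All.lookup ν∉ ν'∈ (positive-ext ν ν' (pos (here refl)) (pos (there ν'∈))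
          (λ k → trans (sym (content k)) (trans (Σ<-cong n (λ i _ → e i k)) (content' k))))

  total : ∀ {t} → LR A B t → Σ< (mult t n) n ≡ sum α ∸ sum β
  total {t} l = begin
    Σ< (mult t n) n               ≡⟨ Σ<-swap t n n ⟩
    Σ< (λ i → Σ< (t i) n) n       ≡⟨ Σ<-cong n (λ i i<n → Σ<-stable (t i) i<n (λ k → entry-zero l)) ⟩
    Σ< (λ i → Σ< (t i) (suc i)) n ≡⟨ sym (m+n∸m≡n (Σ< B n) _) ⟩
    Σ< B n + Σ< (λ i → Σ< (t i) (suc i)) n ∸ Σ< B n ≡⟨ cong₂ _∸_ (trans (sym (Σ<-+ B _ n)) (trans (Σ<-cong n (λ i _ → LR.rows l i)) (Σ<-sum α))) sumβ ⟩
    sum α ∸ sum β                 ∎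
    where
    open ≡-Reasoning
    sumβ : Σ< B n ≡ sum β
    sumβ = trans (trans (sym (Σ<-stable B (m≤m+n n (length β)) (λ i h → n≤0⇒n≡0 (≤-trans (B≤A i) (≤-reflexive (A-vanishes i h))))))
      (Σ<-stable B (m≤n+m (length β) n) (λ i h → get-beyond 0 β i h))) (Σ<-sum β)

  -- Every array has a content in the list: `latt` makes the total multiplicities decreasing, and
  -- `total` fixes their sum.
  counts-sumLR : Counts (sumLR α β) (LR A B)
  counts-sumLR = record
    { elements = C.elements ; size = C.size ; sound = All.map (λ p → proj₁ (proj₂ (proj₂ (find p)))) C.sound
    ; distinct = C.distinct ; complete = λ l → C.complete (some l) }
    where
    module C = Counts (counts-sum (partitionsOf (sum α ∸ sum β)) (partitionsOf-unique (sum α ∸ sum β)) (∈-partitionsOf⁻ (sum α ∸ sum β)))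
    some : ∀ {t} → LR A B t → Any (λ ν → WithContent ν t) (partitionsOf (sum α ∸ sum β))
    some {t} l = lose (subst (λ z → ν ∈ partitionsOf z) (trans (trim-sum f n f↓) (total l)) (∈-partitionsOf⁺ ν
        (isPartition⁺ ν (trim-positive f n) (λ i → subst₂ _≤_ (sym (get-f (suc i))) (sym (get-f i)) (f↓ i))) (trim-positive f n)))
        (l , λ k → sym (get-f k))
      where
      f : ℕ → ℕ
      f = mult t n
      f↓ : Decreasing f
      f↓ k = ≤-trans (Σ<-extend (λ j → t j (suc k)) (n≤1+n n)) (LR.latt l n k)
      get-f : ∀ k → trim f n ! suc k ≡ f k
      get-f = trim-get f n f↓ (λ k h → mult-zero l h)
      ν = trim f n

-- Compressed diagrams

rank-∷ : ∀ k ks x → rank (k ∷ ks) x ≡ lt k (suc x) + rank ks x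
rank-∷ k ks x = go (k ≤? x)
  where
  go : Dec (k ≤ x) → rank (k ∷ ks) x ≡ lt k (suc x) + rank ks x
  go (yes h) = trans (cong length (filter-accept (_≤? x) h)) (cong (_+ rank ks x) (sym (lt-yes (s≤s h))))
  go (no h)  = trans (cong length (filter-reject (_≤? x) h)) (cong (_+ rank ks x) (sym (lt-no (≰⇒> h))))

rank-mono : ∀ ks {x y} → x ≤ y → rank ks x ≤ rank ks y
rank-mono []       h = z≤n
rank-mono (k ∷ ks) {x} {y} h = subst₂ _≤_ (sym (rank-∷ k ks x)) (sym (rank-∷ k ks y)) (lt-mono k (s≤s h) ⊕ rank-mono ks h)

rank-strict : ∀ ks {x y} → y ∈ ks → x < y → rank ks x < rank ks y
rank-strict (k ∷ ks) {x} {y} (here refl) h = subst₂ _<_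
  (sym (trans (rank-∷ k ks x) (cong (_+ rank ks x) (lt-no h)))) (sym (trans (rank-∷ k ks y) (cong (_+ rank ks y) (lt-yes (n<1+n y)))))
  (s≤s (rank-mono ks (<⇒≤ h)))
rank-strict (k ∷ ks) {x} {y} (there y∈) h = subst₂ _<_ (sym (rank-∷ k ks x)) (sym (rank-∷ k ks y))
  (≤-trans (≤-reflexive (sym (+-suc (lt k (suc x)) _))) (lt-mono k (s≤s (<⇒≤ h)) ⊕ rank-strict ks y∈ h))

rank-injective : ∀ ks {x y} → x ∈ ks → y ∈ ks → rank ks x ≡ rank ks y → x ≡ y
rank-injective ks {x} {y} x∈ y∈ e with <-cmp x y
... | tri≈ _ x≡y _ = x≡y
... | tri< l _ _ = ⊥-elim (<-irrefl e (rank-strict ks y∈ l))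
... | tri> _ _ g = ⊥-elim (<-irrefl (sym e) (rank-strict ks x∈ g))

any⁺ : ∀ {X : Set} (p : X → _) (xs : List X) {x} → x ∈ xs → T (p x) → T (Bool.any p xs)
any⁺ p (y ∷ xs) (here refl) h = Equivalence.from T-∨ (inj₁ h)
any⁺ p (y ∷ xs) (there x∈)  h = Equivalence.from (T-∨ {p y}) (inj₂ (any⁺ p xs x∈ h))

module _ (la mu : List ℕ) (la↓ : Decreasing (λ i → la ! suc i)) where
  private
    R = nonemptyRows la mu
    C = nonemptyCols la mu

  Box : ℕ → ℕ → Set
  Box i j = (1 ≤ i × i ≤ length la) × (mu ! i < j × j ≤ la ! i)

  ∈-boxes⁺ : ∀ {i j} → Box i j → (i , j) ∈ boxes la mu
  ∈-boxes⁺ {i} ((p , q) , (r , s)) = ∈-concatMap⁺ _ (lose (∈-fromTo⁺ p q) (∈-map⁺ (λ j → (i , j)) (∈-fromTo⁺ r s)))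

  ∈-boxes⁻ : ∀ {i j} → (i , j) ∈ boxes la mu → Box i j
  ∈-boxes⁻ b∈ with find (∈-concatMap⁻ (λ i → map (λ j → (i , j)) (fromTo (suc (mu ! i)) (la ! i))) {xs = fromTo 1 (length la)} b∈)
  ... | i , i∈ , b∈' with ∈-map⁻ (λ j → (i , j)) b∈'
  ...   | j , j∈ , refl = ∈-fromTo⁻ i∈ , ∈-fromTo⁻ j∈

  Box-row : ∀ {i j} → Box i j → i ∈ R
  Box-row ((p , q) , (r , s)) = ∈-filter⁺ (λ i → mu ! i <? la ! i) (∈-fromTo⁺ p q) (<-≤-trans r s)

  Box-col : ∀ {i j} → Box i j → j ∈ C
  Box-col {suc i} {j} b@((p , q) , (r , s)) = ∈-filter⁺ (λ j → T? (Bool.any (λ b → proj₂ b ≡ᵇ j) (boxes la mu)))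
    (∈-fromTo⁺ (≤-trans (s≤s z≤n) r) (≤-trans s (antitone la↓ {0} {i} z≤n)))
    (any⁺ (λ b → proj₂ b ≡ᵇ j) (boxes la mu) (∈-boxes⁺ b) (≡⇒≡ᵇ j j refl))

  ∈-compressed⁺ : ∀ {i j} → Box i j → (rank R i , rank C j) ∈ compressed la mu
  ∈-compressed⁺ b = ∈-map⁺ _ (∈-boxes⁺ b)

  ∈-compressed⁻ : ∀ {p q} → (p , q) ∈ compressed la mu → ∃ λ i → ∃ λ j → Box i j × p ≡ rank R i × q ≡ rank C j
  ∈-compressed⁻ pq∈ with ∈-map⁻ _ pq∈
  ... | (i , j) , b∈ , e = i , j , ∈-boxes⁻ b∈ , ,-injectiveˡ e , ,-injectiveʳ e

  same-row : ∀ {i q} → i ∈ R → (rank R i , q) ∈ compressed la mu → ∃ λ j → Box i j × q ≡ rank C j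
  same-row i∈ pq∈ with ∈-compressed⁻ pq∈
  ... | i' , j , b , e , e' with rank-injective R i∈ (Box-row b) e
  ...   | refl = j , b , e'

  nonempty-box : ∀ {i} → mu ! suc i < la ! suc i → ∀ {j} → mu ! suc i < j → j ≤ la ! suc i → Box (suc i) j
  nonempty-box {i} h p q = (s≤s z≤n , inside) , (p , q)
    where
    inside : suc i ≤ length la
    inside with ≤-<-connex (suc i) (length la)
    ... | inj₁ g = g
    ... | inj₂ (s≤s g) = ⊥-elim (n≮0 (subst (mu ! suc i <_) (get-beyond 0 la i g) h))

  -- Every row of a Young diagram contains column 1, so the leftmost box of each non-empty row has
  -- column rank 1; `rank` is injective on kept columns, hence these boxes share a column. In a
  -- rotated diagram the last column `ρ ! 1` does the same for the rightmost boxes.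
  aligned : SkewIsPartition la mu ⊎ SkewIsRotatedPartition la mu → Aligned (λ i → la ! suc i) (λ i → mu ! suc i)
  aligned (inj₁ (ρ , _ , shape)) = inj₁ (λ {i} {j} p q → suc-injective (rank-injective C (Box-col (left p)) (Box-col (left q))
      (trans (first p) (sym (first q)))))
    where
    left : ∀ {i} → mu ! suc i < la ! suc i → Box (suc i) (suc (mu ! suc i))
    left h = nonempty-box h ≤-refl h
    first : ∀ {i} → mu ! suc i < la ! suc i → rank C (suc (mu ! suc i)) ≡ 1
    first {i} h with Equivalence.to (shape (rank R (suc i)) (rank C (suc (mu ! suc i)))) (∈-compressed⁺ (left h))
    ... | 1≤p , 1≤q , q≤ with same-row (Box-row (left h)) (Equivalence.from (shape (rank R (suc i)) 1) (1≤p , ≤-refl , ≤-trans 1≤q q≤))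
    ...   | j , b , e = ≤-antisym (≤-trans (rank-mono C (proj₁ (proj₂ b))) (≤-reflexive (sym e))) 1≤q
  aligned (inj₂ (ρ , _ , shape)) = inj₂ (λ {i} {j} p q → rank-injective C (Box-col (right p)) (Box-col (right q))
      (trans (last p) (sym (last q))))
    where
    right : ∀ {i} → mu ! suc i < la ! suc i → Box (suc i) (la ! suc i)
    right h = nonempty-box h h ≤-refl
    last : ∀ {i} → mu ! suc i < la ! suc i → rank C (la ! suc i) ≡ ρ ! 1
    last {i} h with Equivalence.to (shape (rank R (suc i)) (rank C (la ! suc i))) (∈-compressed⁺ (right h))
    ... | 1≤p , p≤ , 1≤q , q≤ , corner with same-row (Box-row (right h)) (Equivalence.from (shape (rank R (suc i)) (ρ ! 1))
            (1≤p , p≤ , ≤-trans 1≤q q≤ , ≤-refl , ≤-trans (≤-trans (≤-reflexive (m+n∸n≡m 1 (ρ ! 1))) (m<n⇒0<n∸m (s≤s q≤))) corner))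
    ...   | j , b , e = ≤-antisym q≤ (≤-trans (≤-reflexive e) (rank-mono C (proj₂ (proj₂ b))))

-- From lists to functions

isPartition⁻ : ∀ xs → IsPartition xs → Decreasing (λ i → xs ! suc i)
isPartition⁻ []           p i       = z≤n
isPartition⁻ (x ∷ [])     p i       = z≤n
isPartition⁻ (x ∷ y ∷ xs) p zero    = ≤ᵇ⇒≤ y x (proj₁ (∧⁻ p))
isPartition⁻ (x ∷ y ∷ xs) p (suc i) = isPartition⁻ (y ∷ xs) (proj₂ (∧⁻ {y ≤ᵇ x} p)) i

get-addP : ∀ xs ys i → addP xs ys ! suc i ≡ xs ! suc i + ys ! suc i
get-addP []       ys       i       = refl
get-addP (x ∷ xs) []       i       = sym (+-identityʳ _)
get-addP (x ∷ xs) (y ∷ ys) zero    = refl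
get-addP (x ∷ xs) (y ∷ ys) (suc i) = get-addP xs ys i

get-scale : ∀ n xs i → scale n xs ! suc i ≡ n * (xs ! suc i)
get-scale n []       i       = sym (*-zeroʳ n)
get-scale n (x ∷ xs) zero    = refl
get-scale n (x ∷ xs) (suc i) = get-scale n xs i

parts : List ℕ → ℕ → ℕ
parts xs i = xs ! suc i

counts-Q : ∀ la mu la' mu' → Skew (parts la) (parts mu) → Skew (parts la') (parts mu') → ∀ n →
           Counts (Q la mu la' mu' n) (LR (stretch n (parts la) (parts la')) (stretch n (parts mu) (parts mu')))
counts-Q la mu la' mu' sk sk' n = record
  { elements = C.elements ; size = C.size ; sound = All.map (LR-resp (part la la') (part mu mu') (λ _ _ → refl)) C.sound
  ; distinct = C.distinct ; complete = λ l → C.complete (LR-resp (λ i → sym (part la la' i)) (λ i → sym (part mu mu' i)) (λ _ _ → refl) l) }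
  where
  part : ∀ xs ys i → addP (scale n xs) ys ! suc i ≡ stretch n (parts xs) (parts ys) i
  part xs ys i = trans (get-addP (scale n xs) ys i) (cong (_+ ys ! suc i) (get-scale n xs i))
  module C = Counts (counts-sumLR (addP (scale n la) la') (addP (scale n mu) mu')
    (Skew-resp (λ i → sym (part la la' i)) (λ i → sym (part mu mu' i)) (Skew-stretch n sk sk')))

module Main (la mu la' mu' : List ℕ) (sk : Skew (parts la) (parts mu)) (sk' : Skew (parts la') (parts mu'))
            (al : Aligned (parts la) (parts mu)) where
  N = length la + length la'
  open Stretched {N} sk sk' (λ i h → get-beyond 0 la i (≤-trans (m≤m+n (length la) (length la')) h))
    (λ i h → get-beyond 0 la' i (≤-trans (m≤n+m (length la') (length la)) h)) al (counts-Q la mu la' mu' sk sk') public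

  stabilizes : ∃ λ m → StabilizesFrom (Q la mu la' mu') m
  stabilizes = proj₁ eventually , λ n m≤n → proj₁ (stable (proj₂ eventually) n m≤n)

  -- Without growth at `i` all columns would be neutral there and Q constant from `i` on, before the
  -- least such index.
  increasing : ∀ m → LeastStabilization (Q la mu la' mu') m → StrictlyIncreasingUpTo (Q la mu la' mu') m
  increasing m (_ , least) i i<m with step i
  ... | inj₂ h  = h
  ... | inj₁ ok = ⊥-elim (<⇒≱ i<m (least i (λ n i≤n → proj₁ (stable ok n i≤n))))

-- Rational upper bounds

infix 4 _≤ᴺ_
-- The formula is accessed only through its natural upper bounds, for which ceiling, maximum and
-- fraction can be undone one after the other.
_≤ᴺ_ : ℚ → ℕ → Set
p ≤ᴺ n = toℚᵘ p ℚᵘ.≤ mkℚᵘ (int n) 0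

≤ᴺ⇒ : ∀ p n → p ≤ᴺ n → ↥ p ℤ.≤ int n ℤ.* ↧ p
≤ᴺ⇒ (mkℚ a d _) n (ℚᵘ.*≤* h) = ℤₚ.≤-trans (ℤₚ.≤-reflexive (sym (ℤₚ.*-identityʳ a))) h

⇒≤ᴺ : ∀ p n → ↥ p ℤ.≤ int n ℤ.* ↧ p → p ≤ᴺ n
⇒≤ᴺ (mkℚ a d _) n h = ℚᵘ.*≤* (ℤₚ.≤-trans (ℤₚ.≤-reflexive (ℤₚ.*-identityʳ a)) h)

floor-lower : ∀ a d k → k ℤ.* int (suc d) ℤ.≤ a → k ℤ.≤ a ℤ./ int (suc d)
floor-lower a d k h = ℤₚ.≮⇒≥ (λ g → ℤₚ.<-irrefl refl (ℤₚ.<-≤-trans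
  (subst (λ z → a ℤ.< ℤ.suc z ℤ.* int (suc d)) (sym (ℤᵈ.div-pos-is-/ℕ a (suc d))) (ℤᵈ.n<s[n/ℕd]*d a (suc d)))
  (ℤₚ.≤-trans (ℤₚ.*-monoʳ-≤-nonNeg (int (suc d)) (ℤₚ.i<j⇒suc[i]≤j g)) h)))

-- Negation of rationals computes only on the constructors of the numerator, hence the three cases.
floor-neg : ∀ p → ℚ.floor (ℚ.- p) ≡ (ℤ.- ↥ p) ℤ./ ↧ p
floor-neg (mkℚ (int zero)     d _) = refl
floor-neg (mkℚ (int (suc a))    d _) = refl
floor-neg (mkℚ (ℤ.-[1+ a ]) d _) = refl

ceiling≤⇒ : ∀ p n → ℚ.ceiling p ℤ.≤ int n → p ≤ᴺ n
ceiling≤⇒ p@(mkℚ a d _) n h = ⇒≤ᴺ p n (ℤₚ.neg-cancel-≤ (begin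
  ℤ.- (int n ℤ.* int (suc d))               ≡⟨ ℤₚ.neg-distribˡ-* (int n) (int (suc d)) ⟩
  ℤ.- int n ℤ.* int (suc d)                 ≤⟨ ℤₚ.*-monoʳ-≤-nonNeg (int (suc d)) (ℤₚ.≤-trans (ℤₚ.neg-mono-≤ h) (ℤₚ.≤-reflexive (ℤₚ.neg-involutive _))) ⟩
  ℚ.floor (ℚ.- p) ℤ.* int (suc d)         ≡⟨ cong (ℤ._* int (suc d)) (floor-neg p) ⟩
  (ℤ.- a) ℤ./ int (suc d) ℤ.* int (suc d)     ≤⟨ ℤᵈ.[n/d]*d≤n (ℤ.- a) (int (suc d)) ⟩
  ℤ.- a                               ∎))
  where open ℤₚ.≤-Reasoning

⇒ceiling≤ : ∀ p n → p ≤ᴺ n → ℚ.ceiling p ℤ.≤ int n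
⇒ceiling≤ p@(mkℚ a d _) n h = ℤₚ.≤-trans (ℤₚ.neg-mono-≤ (ℤₚ.≤-trans
    (floor-lower (ℤ.- a) d (ℤ.- int n) (ℤₚ.≤-trans (ℤₚ.≤-reflexive (sym (ℤₚ.neg-distribˡ-* (int n) (int (suc d))))) (ℤₚ.neg-mono-≤ (≤ᴺ⇒ p n h))))
    (ℤₚ.≤-reflexive (sym (floor-neg p)))))
  (ℤₚ.≤-reflexive (ℤₚ.neg-involutive (int n)))

frac≤⇒ : ∀ z d n → 1 ≤ d → frac z d ≤ᴺ n → z ℤ.≤ int (n * d)
frac≤⇒ z (suc d) n _ h with ℚᵘₚ.≤-respˡ-≃ (ℚₚ.toℚᵘ-fromℚᵘ (mkℚᵘ z d)) h
... | ℚᵘ.*≤* g = ℤₚ.≤-trans (ℤₚ.≤-reflexive (sym (ℤₚ.*-identityʳ z))) (ℤₚ.≤-trans g (ℤₚ.≤-reflexive (sym (ℤₚ.pos-* n (suc d)))))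

⇒frac≤ : ∀ z d n → 1 ≤ d → z ℤ.≤ int (n * d) → frac z d ≤ᴺ n
⇒frac≤ z (suc d) n _ h = ℚᵘₚ.≤-respˡ-≃ (ℚᵘₚ.≃-sym (ℚₚ.toℚᵘ-fromℚᵘ (mkℚᵘ z d)))
  (ℚᵘ.*≤* (ℤₚ.≤-trans (ℤₚ.≤-reflexive (ℤₚ.*-identityʳ z)) (ℤₚ.≤-trans h (ℤₚ.≤-reflexive (ℤₚ.pos-* n (suc d))))))

⊔≤⇒ : ∀ p q n → p ℚ.⊔ q ≤ᴺ n → p ≤ᴺ n × q ≤ᴺ n
⊔≤⇒ p q n h = ℚᵘₚ.≤-trans (ℚₚ.toℚᵘ-mono-≤ (ℚₚ.p≤p⊔q p q)) h , ℚᵘₚ.≤-trans (ℚₚ.toℚᵘ-mono-≤ (ℚₚ.p≤q⊔p p q)) h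

⇒⊔≤ : ∀ p q n → p ≤ᴺ n → q ≤ᴺ n → p ℚ.⊔ q ≤ᴺ n
⇒⊔≤ p q n h g with ℚₚ.⊔-sel p q
... | inj₁ e = subst (_≤ᴺ n) (sym e) h
... | inj₂ e = subst (_≤ᴺ n) (sym e) g

foldr-⊔≤⇒ : ∀ b ps n → foldr ℚ._⊔_ b ps ≤ᴺ n → ∀ {p} → p ∈ ps → p ≤ᴺ n
foldr-⊔≤⇒ b (p ∷ ps) n h (here refl) = proj₁ (⊔≤⇒ p _ n h)
foldr-⊔≤⇒ b (p ∷ ps) n h (there p∈)  = foldr-⊔≤⇒ b ps n (proj₂ (⊔≤⇒ p _ n h)) p∈

⇒foldr-⊔≤ : ∀ b ps n → b ≤ᴺ n → (∀ {p} → p ∈ ps → p ≤ᴺ n) → foldr ℚ._⊔_ b ps ≤ᴺ n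
⇒foldr-⊔≤ b []       n hb h = hb
⇒foldr-⊔≤ b (p ∷ ps) n hb h = ⇒⊔≤ p _ n (h (here refl)) (⇒foldr-⊔≤ b ps n hb (λ p∈ → h (there p∈)))

numerator-+ : ∀ a b c e f → int a ℤ.- int b ℤ.+ int c ℤ.+ int e ℤ.- int f ℤ.+ int (b + f) ≡ int (a + c + e)
numerator-+ a b c e f = trans (cong (λ z → int a ℤ.- int b ℤ.+ int c ℤ.+ int e ℤ.- int f ℤ.+ z) (ℤₚ.pos-+ b f))
  (trans (identity (int a) (int b) (int c) (int e) (int f)) (sym (trans (ℤₚ.pos-+ (a + c) e) (cong (ℤ._+ int e) (ℤₚ.pos-+ a c)))))
  where
  identity : ∀ (a b c e f : ℤ) → a ℤ.- b ℤ.+ c ℤ.+ e ℤ.- f ℤ.+ (b ℤ.+ f) ≡ a ℤ.+ c ℤ.+ e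
  identity = ℤring.solve-∀

numerator≤⇒ : ∀ a b c e f m → int a ℤ.- int b ℤ.+ int c ℤ.+ int e ℤ.- int f ℤ.≤ int m → a + c + e ≤ m + (b + f)
numerator≤⇒ a b c e f m h = ℤₚ.drop‿+≤+ (ℤₚ.≤-trans (ℤₚ.≤-reflexive (sym (numerator-+ a b c e f)))
  (ℤₚ.≤-trans (ℤₚ.+-monoˡ-≤ (int (b + f)) h) (ℤₚ.≤-reflexive (sym (ℤₚ.pos-+ m (b + f))))))

⇒numerator≤ : ∀ a b c e f m → a + c + e ≤ m + (b + f) → int a ℤ.- int b ℤ.+ int c ℤ.+ int e ℤ.- int f ℤ.≤ int m
⇒numerator≤ a b c e f m h = subst₂ ℤ._≤_ (cancel _ (int (b + f))) (cancel (int m) (int (b + f)))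
  (ℤₚ.+-monoˡ-≤ (ℤ.- int (b + f)) (ℤₚ.≤-trans (ℤₚ.≤-reflexive (numerator-+ a b c e f))
    (ℤₚ.≤-trans (ℤ.+≤+ h) (ℤₚ.≤-reflexive (ℤₚ.pos-+ m (b + f))))))
  where
  cancel : ∀ (x y : ℤ) → x ℤ.+ y ℤ.- y ≡ x
  cancel = ℤring.solve-∀

∣⊔0∣≤⇒ : ∀ z n → ℤ.∣ z ℤ.⊔ 0ℤ ∣ ≤ n → z ℤ.≤ int n
∣⊔0∣≤⇒ z n h = ℤₚ.≤-trans (ℤₚ.i≤i⊔j z 0ℤ) (ℤₚ.≤-trans (ℤₚ.≤-reflexive (sym (ℤₚ.0≤i⇒+∣i∣≡i (ℤₚ.i≤j⊔i z 0ℤ)))) (ℤ.+≤+ h))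

⇒∣⊔0∣≤ : ∀ z n → z ℤ.≤ int n → ℤ.∣ z ℤ.⊔ 0ℤ ∣ ≤ n
⇒∣⊔0∣≤ z n h = ℤₚ.drop‿+≤+ (ℤₚ.≤-trans (ℤₚ.≤-reflexive (ℤₚ.0≤i⇒+∣i∣≡i (ℤₚ.i≤j⊔i z 0ℤ))) (ℤₚ.⊔-lub h (ℤ.+≤+ z≤n)))

-- Diagrams without empty columns

-- Without empty columns every fresh part is `B i - B (i + 1)`, so the width telescopes.
width-basic : ∀ {A B} → Skew A B → (∀ i → B i ≤ A (suc i)) → ∀ a m → width A B a (suc m) + B (a + m) ≡ A a
width-basic {A} {B} sk basic a zero rewrite +-identityʳ a | +-identityʳ (A a ∸ B a) = m∸n+n≡m (Skew.B≤A sk a)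
width-basic {A} {B} sk basic a (suc m) = trans (arith (A a ∸ B a) (Σ< (λ j → fresh A B (a + j)) m) (fresh A B (a + m)) (B (a + suc m)) (B (a + m))
    (trans (cong (fresh A B (a + m) +_) (cong B (+-suc a m))) (trans (fresh+B sk (a + m)) (m≥n⇒m⊓n≡n (basic (a + m))))))
  (width-basic sk basic a m)
  where
  arith : ∀ x y z b b' → z + b ≡ b' → x + (y + z) + b ≡ x + y + b'
  arith x y z b _ refl = solve (x ∷ y ∷ z ∷ b ∷ [])

-- The explicit formula

replicate-++-low : ∀ p (x : ℕ) ys i → i < p → (replicate p x ++ ys) ! suc i ≡ x
replicate-++-low (suc p) x ys zero    _       = refl
replicate-++-low (suc p) x ys (suc i) (s≤s h) = replicate-++-low p x ys i h

replicate-++-high : ∀ p (x : ℕ) ys j → (replicate p x ++ ys) ! suc (p + j) ≡ ys ! suc j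
replicate-++-high zero    x ys j = refl
replicate-++-high (suc p) x ys j = replicate-++-high p x ys j

replicate-suc-++ : ∀ p (x : ℕ) ys → replicate (suc p) x ++ ys ≡ replicate p x ++ x ∷ ys
replicate-suc-++ zero    x ys = refl
replicate-suc-++ (suc p) x ys = cong (x ∷_) (replicate-suc-++ p x ys)

balanced : ∀ n y d m w u l l₀ k → w + k ≡ l₀ →
  (n * 0 + m + w + (n * y + u) ≤ n * (d + y) + l → l₀ + u + m ≤ n * d + (l + k)) ×
  (l₀ + u + m ≤ n * d + (l + k) → n * 0 + m + w + (n * y + u) ≤ n * (d + y) + l)
balanced n y d m w u l _ k refl =
  (λ h → lin 0 h (id₁ n y d m w u l k)) , (λ h → lin 0 h (id₂ n y d m w u l k))
  where
  id₁ : ∀ n y d m w u l k → w + k + u + m + (n * (d + y) + l) + 0 ≡ n * d + (l + k) + (n * 0 + m + w + (n * y + u))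
  id₁ n y d m w u l k = solve (n ∷ y ∷ d ∷ m ∷ w ∷ u ∷ l ∷ k ∷ [])
  id₂ : ∀ n y d m w u l k → n * 0 + m + w + (n * y + u) + (n * d + (l + k)) + 0 ≡ n * (d + y) + l + (w + k + u + m)
  id₂ n y d m w u l k = solve (n ∷ y ∷ d ∷ m ∷ w ∷ u ∷ l ∷ k ∷ [])

+-left-comm : ∀ a b c → a + (b + c) ≡ b + (a + c)
+-left-comm a b c = solve (a ∷ b ∷ c ∷ [])

module Special (x : ℕ) (α' : List ℕ) (p : ℕ) (la' mu' : List ℕ) (αpart : IsPartition (x ∷ α'))
               (la'part : IsPartition la') (mu'part : IsPartition mu') (mu'⊆la' : mu' ⊆ₚ la') (basic' : Basic la' mu') where
  α : List ℕ
  α = x ∷ α'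
  a₁ : ℕ
  a₁ = suc p
  la mu : List ℕ
  la = lamOf α a₁
  mu = muOf α a₁

  α↓ : Decreasing (parts α)
  α↓ = isPartition⁻ α αpart

  la-low : ∀ {i} → i < p → parts la i ≡ x
  la-low {i} h = trans (cong (λ z → z ! suc i) (replicate-suc-++ p x α')) (replicate-++-low p x α i h)

  la-high : ∀ j → parts la (p + j) ≡ parts α j
  la-high j = trans (cong (λ z → z ! suc (p + j)) (replicate-suc-++ p x α')) (replicate-++-high p x α j)

  mu-low : ∀ {i} → i < p → parts mu i ≡ x
  mu-low {i} h = trans (cong (λ z → z ! suc i) (sym (++-identityʳ mu))) (replicate-++-low p x [] i h)

  mu-high : ∀ {i} → p ≤ i → parts mu i ≡ 0
  mu-high {i} h = get-beyond 0 mu i (≤-trans (≤-reflexive (length-replicate p)) h)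

  data Position : ℕ → Set where
    low  : ∀ {i} → i < p → Position i
    high : ∀ j → Position (p + j)

  position : ∀ i → Position i
  position i with <-≤-connex i p
  ... | inj₁ h = low h
  ... | inj₂ h = subst Position (m+[n∸m]≡n h) (high (i ∸ p))

  la≤x : ∀ i → parts la i ≤ x
  la≤x i with position i
  ... | low h  = ≤-reflexive (la-low h)
  ... | high j = ≤-trans (≤-reflexive (la-high j)) (antitone α↓ {0} {j} z≤n)

  la-after : ∀ j → parts la (suc (p + j)) ≡ parts α (suc j)
  la-after j = trans (cong (parts la) (sym (+-suc p j))) (la-high (suc j))

  sk : Skew (parts la) (parts mu)
  sk = record { A↓ = la↓ ; B↓ = mu↓ ; B≤A = mu≤la }
    where
    la↓ : Decreasing (parts la)
    la↓ i with position i
    ... | low h  = ≤-trans (la≤x (suc i)) (≤-reflexive (sym (la-low h)))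
    ... | high j = subst₂ _≤_ (sym (la-after j)) (sym (la-high j)) (α↓ j)
    mu↓ : Decreasing (parts mu)
    mu↓ i with <-≤-connex (suc i) p
    ... | inj₁ h = ≤-reflexive (trans (mu-low h) (sym (mu-low (<-trans (n<1+n i) h))))
    ... | inj₂ h = ≤-trans (≤-reflexive (mu-high h)) z≤n
    mu≤la : ∀ i → parts mu i ≤ parts la i
    mu≤la i with <-≤-connex i p
    ... | inj₁ h = ≤-reflexive (trans (mu-low h) (sym (la-low h)))
    ... | inj₂ h = ≤-trans (≤-reflexive (mu-high h)) z≤n

  sk' : Skew (parts la') (parts mu')
  sk' = record { A↓ = isPartition⁻ la' la'part ; B↓ = isPartition⁻ mu' mu'part ; B≤A = λ i → mu'⊆la' (suc i) }

  al : Aligned (parts la) (parts mu)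
  al = inj₁ (λ {i} {j} h g → trans (zero! i h) (sym (zero! j g)))
    where
    zero! : ∀ i → parts mu i < parts la i → parts mu i ≡ 0
    zero! i h with <-≤-connex i p
    ... | inj₁ g = ⊥-elim (<-irrefl (trans (mu-low g) (sym (la-low g))) h)
    ... | inj₂ g = mu-high g

  open Main la mu la' mu' sk sk' al public

  basic : ∀ n i → B n i ≤ A n (suc i)
  basic n i = *-monoʳ-≤ n first ⊕ second
    where
    first : parts mu i ≤ parts la (suc i)
    first with <-≤-connex i p
    ... | inj₂ h = ≤-trans (≤-reflexive (mu-high h)) z≤n
    ... | inj₁ h with m≤n⇒m<n∨m≡n h
    ...   | inj₁ g = ≤-reflexive (trans (mu-low h) (sym (la-low g)))
    ...   | inj₂ g = ≤-reflexive (trans (mu-low h) (sym (trans (cong (parts la) (trans g (sym (+-identityʳ p)))) (la-high 0))))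
    second : parts mu' i ≤ parts la' (suc i)
    second with ≤-<-connex (suc i) (length la')
    ... | inj₁ h = proj₂ (basic' (suc i) (s≤s z≤n) h)
    ... | inj₂ (s≤s h) = ≤-trans (mu'⊆la' (suc i)) (≤-trans (≤-reflexive (get-beyond 0 la' i h)) z≤n)

  open Conjugate N

  v : Vanishes N (parts la)
  v i h = get-beyond 0 la i (≤-trans (m≤m+n (length la) (length la')) h)

  gap : ℕ → ℕ
  gap j = parts α j ∸ parts α (suc j)

  μ₋ : ℕ
  μ₋ = muPrev la' mu' a₁

  -- The term of index `j + 1` is at most `n`, with the denominator cleared and the subtracted parts
  -- moved to the other side.
  Bound : ℕ → ℕ → Set
  Bound n j = parts la' 0 + parts la' (suc (p + j)) + parts mu' p ≤ n * gap j + (parts la' (p + j) + μ₋)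

  module _ (n : ℕ) where

    Thick : ℕ → Set
    Thick j = B n p + width (A n) (B n) 0 p + width (A n) (B n) (suc (p + j)) N ≤ A n (p + j)

    width-lower : ∀ j → width (A n) (B n) (suc (p + j)) N ≡ n * parts α (suc j) + parts la' (suc (p + j))
    width-lower j = trans (trans (sym (trans (cong (λ z → width (A n) (B n) (suc (p + j)) N + z) vanish) (+-identityʳ _)))
        (width-basic (skₙ n) (basic n) (suc (p + j)) (pred N)))
      (cong (λ z → n * z + parts la' (suc (p + j))) (la-after j))
      where
      -- This row lies beyond all parts, so the telescoped width is the full row length.
      vanish : B n (suc (p + j) + pred N) ≡ 0
      vanish = n≤0⇒n≡0 (≤-trans (Skew.B≤A (skₙ n) (suc (p + j) + pred N)) (≤-reflexive (vₙ n _ (s≤s (m≤n+m _ (p + j))))))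

    -- Origin of the convention for μ'_0: with no rows above, the width is 0 and λ'_1 has to stand
    -- in. Otherwise the width telescopes to λ'_1 - μ'_p, since the contributions `n * x` of both
    -- ends cancel.
    width-upper : ∀ p' → p' ≡ p → width (A n) (B n) 0 p' + muPrev la' mu' (suc p') ≡ parts la' 0
    width-upper zero     e = refl
    width-upper (suc p') e = +-cancelˡ-≡ (n * x) _ _ (trans (trans (+-left-comm (n * x) (width (A n) (B n) 0 (suc p')) (mu' ! suc p'))
        (cong (λ z → width (A n) (B n) 0 (suc p') + (n * z + mu' ! suc p')) (sym (mu-low (≤-reflexive e)))))
        (width-basic (skₙ n) (basic n) 0 p'))

    thick⇔ : ∀ j → (Thick j → Bound n j) × (Bound n j → Thick j)
    thick⇔ j with balanced n (parts α (suc j)) (gap j) (parts mu' p) (width (A n) (B n) 0 p) (parts la' (suc (p + j)))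
                    (parts la' (p + j)) (parts la' 0) μ₋ (width-upper p refl)
    ... | to , from = (λ h → to (subst₂ _≤_ lhs rhs h)) , (λ h → subst₂ _≤_ (sym lhs) (sym rhs) (from h))
      where
      lhs : B n p + width (A n) (B n) 0 p + width (A n) (B n) (suc (p + j)) N ≡
            n * 0 + parts mu' p + width (A n) (B n) 0 p + (n * parts α (suc j) + parts la' (suc (p + j)))
      lhs = cong₂ _+_ (cong (λ z → n * z + parts mu' p + width (A n) (B n) 0 p) (mu-high ≤-refl)) (width-lower j)
      rhs : A n (p + j) ≡ n * (gap j + parts α (suc j)) + parts la' (p + j)
      rhs = cong (λ z → n * z + parts la' (p + j)) (trans (la-high j) (sym (m∸n+n≡m (α↓ j))))

  conj-mu : ∀ {c} → c < x → conj (parts mu) c ≡ p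
  conj-mu {c} c<x = ≤-antisym (≮⇒≥ (λ h → n≮0 (subst (c <_) (mu-high ≤-refl) (<-conj (Skew.B↓ sk) (vμ sk v) h)))) (below p ≤-refl)
    where
    below : ∀ q → q ≤ p → q ≤ conj (parts mu) c
    below zero    _ = z≤n
    below (suc q) h = conj-< (Skew.B↓ sk) (vμ sk v) (subst (c <_) (sym (mu-low h)) c<x)

  -- Each column of λ/μ starts below the `p` rows of μ and ends where α descends; with `∈-column`
  -- this identifies the columns with the index set of the maximum.
  column-∈ : ∀ j → parts α (suc j) < parts α j → (suc (p + j) , p) ∈ columns (parts la) (parts mu)
  column-∈ j h = subst (_∈ columns (parts la) (parts mu)) (cong₂ _,_ r≡ (conj-mu c<x)) (∈-map⁺ (column (parts la) (parts mu)) (∈-upTo⁺ c<x))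
    where
    c₀ : ℕ
    c₀ = parts α (suc j)
    c<x : c₀ < x
    c<x = <-≤-trans h (antitone α↓ {0} {j} z≤n)
    r≡ : conj (parts la) c₀ ≡ suc (p + j)
    r≡ = ≤-antisym (≮⇒≥ (λ g → <-irrefl refl (subst (c₀ <_) (la-after j) (<-conj (Skew.A↓ sk) v g))))
           (conj-< (Skew.A↓ sk) v (subst (c₀ <_) (sym (la-high j)) h))

  ∈-column : ∀ {u} → u ∈ columns (parts la) (parts mu) → ∃ λ j → u ≡ (suc (p + j) , p) × parts α (suc j) < parts α j
  ∈-column u∈ with ∈-map⁻ (column (parts la) (parts mu)) u∈
  ... | c , c∈ , refl = j , cong₂ _,_ (sym r≡) (conj-mu c<x) , ≤-<-trans
          (subst (_≤ c) (la-after j) (≤-conj (Skew.A↓ sk) v (≤-reflexive (sym r≡))))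
          (subst (c <_) (la-high j) (<-conj (Skew.A↓ sk) v (≤-reflexive r≡)))
    where
    c<x : c < x
    c<x = ∈-upTo⁻ c∈
    p<r : p < conj (parts la) c
    p<r = conj-< (Skew.A↓ sk) v (subst (c <_) (sym (trans (cong (parts la) (sym (+-identityʳ p))) (la-high 0))) c<x)
    j : ℕ
    j = conj (parts la) c ∸ suc p
    r≡ : suc (p + j) ≡ conj (parts la) c
    r≡ = m+[n∸m]≡n p<r

  neutral⇒bound : ∀ n → AllNeutral (A n) (B n) → ∀ j → parts α (suc j) < parts α j → Bound n j
  neutral⇒bound n ok j h = proj₁ (thick⇔ n j) (Neutral.thick (ok (column-∈ j h)) (s≤s (m≤m+n p j)))

  bound⇒neutral : ∀ n → (∀ j → parts α (suc j) < parts α j → Bound n j) → AllNeutral (A n) (B n)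
  bound⇒neutral n ok u∈ with ∈-column u∈
  ... | j , refl , h = neutral (λ _ → proj₂ (thick⇔ n j) (ok j h)) (λ e → ⊥-elim (<-irrefl e (s≤s (m≤m+n p j))))

  term⇒bound : ∀ n j → parts α (suc j) < parts α j → term α a₁ la' mu' (suc j) ≤ᴺ n → Bound n j
  term⇒bound n j h t≤ rewrite +-suc p j = numerator≤⇒ (la' ! 1) (la' ! suc (p + j)) (la' ! suc (suc (p + j))) (mu' ! a₁) μ₋ (n * gap j)
    (frac≤⇒ _ (gap j) n (m<n⇒0<n∸m h) t≤)

  bound⇒term : ∀ n j → parts α (suc j) < parts α j → Bound n j → term α a₁ la' mu' (suc j) ≤ᴺ n
  bound⇒term n j h b rewrite +-suc p j = ⇒frac≤ _ (gap j) n (m<n⇒0<n∸m h)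
    (⇒numerator≤ (la' ! 1) (la' ! suc (p + j)) (la' ! suc (suc (p + j))) (mu' ! a₁) μ₋ (n * gap j) b)

  -- Admits the initial value of the fold in `maxTerm`: the last part of α is positive.
  last-descent : parts α (suc (length α')) < parts α (length α')
  last-descent = subst (_< parts α (length α')) (sym (get-beyond 0 α (suc (length α')) ≤-refl)) (positive-last x α' αpart)
    where
    positive-last : ∀ x xs → IsPartition (x ∷ xs) → 0 < parts (x ∷ xs) (length xs)
    positive-last x []       h = <ᵇ⇒< 0 x h
    positive-last x (y ∷ xs) h = positive-last y xs (proj₂ (∧⁻ {y ≤ᵇ x} h))

  -- The formula can be negative, for instance for α = λ' = (1), μ' empty and a₁ = 1, whereas
  -- indices start at 0; hence the maximum with 0.
  minimal : ℕ
  minimal = ℤ.∣ formulaℤ α a₁ la' mu' ℤ.⊔ 0ℤ ∣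

  terms : List ℚ
  terms = map (term α a₁ la' mu') (filter (λ j → α ! suc j <? α ! j) (fromTo 1 (length α)))

  minimal≤⇒neutral : ∀ n → minimal ≤ n → AllNeutral (A n) (B n)
  minimal≤⇒neutral n h = bound⇒neutral n (λ j g → term⇒bound n j g (foldr-⊔≤⇒ _ terms n max≤
      (∈-map⁺ (term α a₁ la' mu') (∈-filter⁺ (λ j → α ! suc j <? α ! j) (∈-fromTo⁺ (s≤s z≤n) (inside j g)) g))))
    where
    max≤ : maxTerm α a₁ la' mu' ≤ᴺ n
    max≤ = ceiling≤⇒ (maxTerm α a₁ la' mu') n (∣⊔0∣≤⇒ (formulaℤ α a₁ la' mu') n h)
    inside : ∀ j → parts α (suc j) < parts α j → suc j ≤ length α
    inside j g with ≤-<-connex (suc j) (length α)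
    ... | inj₁ l = l
    ... | inj₂ (s≤s l) = ⊥-elim (n≮0 (subst (parts α (suc j) <_) (get-beyond 0 α j l) g))

  neutral⇒minimal≤ : ∀ n → AllNeutral (A n) (B n) → minimal ≤ n
  neutral⇒minimal≤ n ok = ⇒∣⊔0∣≤ (formulaℤ α a₁ la' mu') n (⇒ceiling≤ (maxTerm α a₁ la' mu') n
    (⇒foldr-⊔≤ _ terms n (each (length α') last-descent) found))
    where
    each : ∀ j → parts α (suc j) < parts α j → term α a₁ la' mu' (suc j) ≤ᴺ n
    each j g = bound⇒term n j g (neutral⇒bound n ok j g)
    found : ∀ {q} → q ∈ terms → q ≤ᴺ n
    found q∈ with ∈-map⁻ (term α a₁ la' mu') q∈
    ... | zero , j∈ , _ = ⊥-elim (n≮0 (proj₁ (∈-fromTo⁻ {1} {length α} (proj₁ (∈-filter⁻ (λ j → α ! suc j <? α ! j) {xs = fromTo 1 (length α)} j∈)))))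
    ... | suc j , j∈ , refl = each j (proj₂ (∈-filter⁻ (λ j → α ! suc j <? α ! j) {xs = fromTo 1 (length α)} j∈))

  below-minimal : StrictlyIncreasingUpTo (Q la mu la' mu') minimal
  below-minimal i i< with step i
  ... | inj₂ h  = h
  ... | inj₁ ok = ⊥-elim (<⇒≱ i< (neutral⇒minimal≤ i ok))

  -- Q grows strictly at every index below `minimal`, so it cannot be constant from such an index
  -- on.
  least : LeastStabilization (Q la mu la' mu') minimal
  least = (λ n h → proj₁ (stable (minimal≤⇒neutral minimal ≤-refl) n h)) , λ m' st → ≮⇒≥ (λ m'< →
    <-irrefl (sym (st (suc m') (n≤1+n m'))) (below-minimal m' m'<))

theorem4p2 : ((la mu la' mu' : List ℕ) →
    IsPartition la → IsPartition mu → IsPartition la' → IsPartition mu' →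
    mu ⊆ₚ la → mu' ⊆ₚ la' →
    (SkewIsPartition la mu ⊎ SkewIsRotatedPartition la mu) →
    (∃ λ m → StabilizesFrom (Q la mu la' mu') m) ×
    (∀ m → LeastStabilization (Q la mu la' mu') m →
    StrictlyIncreasingUpTo (Q la mu la' mu') m))
    ×
    ((α : List ℕ) (a1 : ℕ) (la' mu' : List ℕ) →
    IsPartition α → 1 ≤ length α → 1 ≤ a1 →
    IsPartition la' → IsPartition mu' → mu' ⊆ₚ la' → Basic la' mu' →
    LeastStabilization (Q (lamOf α a1) (muOf α a1) la' mu')
    ∣ formulaℤ α a1 la' mu' ⊔ 0ℤ ∣ ×
    StrictlyIncreasingUpTo (Q (lamOf α a1) (muOf α a1) la' mu')
    ∣ formulaℤ α a1 la' mu' ⊔ 0ℤ ∣)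
theorem4p2 =
  (λ la mu la' mu' p q p' q' h h' shape →
     let open Main la mu la' mu' (skew la mu p q h) (skew la' mu' p' q' h') (aligned la mu (isPartition⁻ la p) shape)
     in stabilizes , increasing) ,
  λ { (x ∷ α') (suc p) la' mu' αp _ _ p' q' h' basic' →
        let open Special x α' p la' mu' αp p' q' h' basic' in least , below-minimal }
  where
  skew : ∀ la mu → IsPartition la → IsPartition mu → mu ⊆ₚ la → Skew (parts la) (parts mu)
  skew la mu p q h = record { A↓ = isPartition⁻ la p ; B↓ = isPartition⁻ mu q ; B≤A = λ i → h (suc i) }
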